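{- There exists an absolute constant $C$ such that for every $\Delta$ and every bipartite $\Delta$-bounded graph sequence $\mathcal{F}=\{F_1,F_2,\ldots\}$, the vertex set of every $2$-edge-colored complete graph can be partitioned into at most $2^{C\Delta}$ vertex-disjoint monochromatic copies of graphs from $\mathcal{F}$.
   Context: A sequence $\mathcal{F}=\{F_1,F_2,\ldots\}$ of graphs is $\Delta$-bounded if for every $n$, $F_n$ is a graph on exactly $n$ vertices with maximum degree at most $\Delta$; it is bipartite if every $F_n$ is bipartite. A monochromatic copy of a graph $F$ in an edge-colored complete graph is a subgraph isomorphic to $F$ all of whose edges have the same color. -}

module Defs where

open import Data.Nat using (ℕ; suc; _≤_; _^_; _*_)
open import Data.Fin using (Fin)
open import Data.Bool using (Bool; true; false; if_then_else_)
open import Data.List using (List; allFin; map)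
open import Data.Nat.ListAction using (sum)
open import Data.Product using (Σ; ∃; _×_)
open import Relation.Binary.PropositionalEquality using (_≡_; _≢_)
open import Function.Definitions using (Injective)

record Graph (n : ℕ) : Set where
  field
    adj   : Fin n → Fin n → Bool
    sym   : ∀ i j → adj i j ≡ adj j i
    irref : ∀ i → adj i i ≡ false
open Graph public

degree : ∀ {n} → Graph n → Fin n → ℕ
degree {n} G i = sum (map (λ j → if adj G i j then 1 else 0) (allFin n))

MaxDegreeAtMost : ∀ {n} → ℕ → Graph n → Set
MaxDegreeAtMost Δ G = ∀ i → degree G i ≤ Δ

IsBipartite : ∀ {n} → Graph n → Set
IsBipartite {n} G = Σ (Fin n → Bool) λ side → ∀ i j → adj G i j ≡ true → side i ≢ side j

-- A graph sequence F_1, F_2, ...: (Seq k) is the graph F_{k+1}, on k+1 vertices.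
GraphSeq : Set
GraphSeq = (k : ℕ) → Graph (suc k)

DeltaBounded : ℕ → GraphSeq → Set
DeltaBounded Δ F = ∀ k → MaxDegreeAtMost Δ (F k)

BipartiteSeq : GraphSeq → Set
BipartiteSeq F = ∀ k → IsBipartite (F k)

-- A 2-edge-coloring of the complete graph on Fin N (symmetric; diagonal irrelevant).
record TwoColoring (N : ℕ) : Set where
  field
    col    : Fin N → Fin N → Bool
    colSym : ∀ u v → col u v ≡ col v u
open TwoColoring public

record MonoCopy (F : GraphSeq) {N : ℕ} (c : TwoColoring N) : Set where
  field
    index  : ℕ
    colour : Bool
    emb    : Fin (suc index) → Fin N
    inj    : Injective _≡_ _≡_ emb
    mono   : ∀ i j → adj (F index) i j ≡ true → col c (emb i) (emb j) ≡ colour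
open MonoCopy public

IsPartition : ∀ (F : GraphSeq) {N : ℕ} (c : TwoColoring N) (m : ℕ) → (Fin m → MonoCopy F c) → Set
IsPartition F {N} c m parts =
  (∀ (v : Fin N) → ∃ λ p → ∃ λ x → emb (parts p) x ≡ v)
  × (∀ p q x y → emb (parts p) x ≡ emb (parts q) y → p ≡ q)

PartitionableInto : (F : GraphSeq) {N : ℕ} (c : TwoColoring N) → ℕ → Set
PartitionableInto F c bound =
  Σ ℕ λ m → m ≤ bound × Σ (Fin m → MonoCopy F c) λ parts → IsPartition F c m parts

module Submission where

-- Call a pair (A, B) dense in a colour if, for every large T ⊆ B, all but few vertices of A have a fixed proportion of T as neighbours in
-- that colour, and vice versa.  A dense pair of equal sizes is spanned by two copies of F_n with the roles of A and B exchanged: the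
-- smaller side X of F_n is placed greedily in A, and then the larger side Y is matched onto everything that must be covered in B.  The
-- greedy choices are made by the method of conditional expectations for two potentials, which together force Hall's condition.  A further
-- vertex either has many neighbours in A and may join B, or is joined to A almost completely in the other colour; vertices of the second
-- kind are few and are covered by two copies in that colour.  Sizes are adjusted by removing single monochromatic copies.
--
-- If the two halves of the vertex set do not form a dense pair in the first colour, there is a pair of proportion 2^(−poly(Δ)) that is
-- nearly complete in the second colour, hence dense.  By dependent random choice every set of 2^(8Δ) k vertices contains a monochromatic
-- F_k, so 2^(O(Δ)) poly(Δ) copies cover all other vertices up to a number small in comparison with this pair.

open import Defs renaming (sym to adj-sym)
open import Data.Nat using (ℕ; zero; suc; _+_; _*_; _∸_; _^_; _≤_; _<_; _≤ᵇ_; _≤?_; _<?_; z≤n; s≤s; ⌊_/2⌋; ⌈_/2⌉; NonZero; nonZero; >-nonZero)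
open import Data.Nat.Properties hiding (_≟_; _<?_; _≤?_)
open import Data.Nat.Tactic.RingSolver using (solve-∀)
open import Data.Fin using (Fin; zero; suc)
open import Data.Fin.Properties using (_≟_; all?) renaming (suc-injective to Fin-suc-injective)
open import Data.Bool using (Bool; true; false; not; _∧_; _∨_; if_then_else_)
open import Data.Vec using (Vec; []; _∷_; lookup; tabulate)
open import Data.Vec.Properties using (lookup∘tabulate)
open import Data.Maybe using (Maybe; just; nothing)
open import Data.Maybe.Properties using (just-injective)
open import Data.Product using (Σ; ∃; _×_; _,_; proj₁; proj₂)
open import Data.Sum using (_⊎_; inj₁; inj₂; [_,_]′)
open import Data.Empty using (⊥; ⊥-elim)
open import Function using (_∘_; id; case_of_)
open import Data.Bool.Properties using () renaming (_≟_ to _≟ᵇ_)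
open import Relation.Nullary using (¬_; Dec; yes; no; does)
open import Relation.Nullary.Decidable using (_×-dec_; _→-dec_)
open import Relation.Binary.PropositionalEquality using (_≡_; _≢_; refl; sym; trans; cong; cong₂; subst)
import Algebra.Properties.Semiring.Sum +-*-semiring as Sum
open import Data.List as List using (List)
open import Data.Nat.ListAction as ListAction using ()
open import Data.List.Properties using (map-tabulate)
open import Data.Nat.DivMod using (_/_; _%_; m≡m%n+[m/n]*n; m%n<n)

open ≤-Reasoning

-- Finite sets and counting

𝟙 : Bool → ℕ
𝟙 true  = 1
𝟙 false = 0

infix 4 _⊑_
_⊑_ : ∀ {n} → (Fin n → Bool) → (Fin n → Bool) → Set
p ⊑ q = ∀ i → p i ≡ true → q i ≡ true

infixl 7 _∩_
infixl 6 _∪_ _∖_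
_∩_ _∪_ _∖_ : ∀ {n} → (Fin n → Bool) → (Fin n → Bool) → Fin n → Bool
(p ∩ q) i = p i ∧ q i
(p ∪ q) i = p i ∨ q i
(p ∖ q) i = p i ∧ not (q i)

∧-intro : ∀ {a b} → a ≡ true → b ≡ true → a ∧ b ≡ true
∧-intro refl refl = refl

∧-left : ∀ {a b} → a ∧ b ≡ true → a ≡ true
∧-left {true} _ = refl

∧-right : ∀ {a b} → a ∧ b ≡ true → b ≡ true
∧-right {true} e = e

∨-introˡ : ∀ {a b} → a ≡ true → a ∨ b ≡ true
∨-introˡ refl = refl

∨-introʳ : ∀ {a b} → b ≡ true → a ∨ b ≡ true
∨-introʳ {true}  _ = refl
∨-introʳ {false} e = e

∨-elim : ∀ {a b} → a ∨ b ≡ true → a ≡ true ⊎ b ≡ true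
∨-elim {true}  _ = inj₁ refl
∨-elim {false} e = inj₂ e

not-intro : ∀ {a} → a ≡ false → not a ≡ true
not-intro refl = refl

not-elim : ∀ {a} → not a ≡ true → a ≡ false
not-elim {false} _ = refl

true≢false : ∀ {a} → a ≡ true → a ≡ false → ⊥
true≢false refl ()

bool-dec : ∀ a → a ≡ true ⊎ a ≡ false
bool-dec true  = inj₁ refl
bool-dec false = inj₂ refl

bool-ext : ∀ {a b} → (a ≡ true → b ≡ true) → (b ≡ true → a ≡ true) → a ≡ b
bool-ext {true}          f g = sym (f refl)
bool-ext {false} {true}  f g = g refl
bool-ext {false} {false} f g = refl

¬true⇒false : ∀ {a} → ¬ (a ≡ true) → a ≡ false
¬true⇒false {true}  h = ⊥-elim (h refl)
¬true⇒false {false} h = refl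

does-true : ∀ {P : Set} (d : Dec P) → P → does d ≡ true
does-true (yes _) _ = refl
does-true (no ¬p) p = ⊥-elim (¬p p)

does-elim : ∀ {P : Set} (d : Dec P) → does d ≡ true → P
does-elim (yes p) _ = p

≤ᵇ-true : ∀ {m n} → m ≤ n → (m ≤ᵇ n) ≡ true
≤ᵇ-true {m} {n} h = case bool-dec (m ≤ᵇ n) of λ
  { (inj₁ e) → e
  ; (inj₂ e) → ⊥-elim (subst T e (≤⇒≤ᵇ h)) }
  where open import Data.Bool using (T)

≤ᵇ-elim : ∀ {m n} → (m ≤ᵇ n) ≡ true → m ≤ n
≤ᵇ-elim {m} {n} e = ≤ᵇ⇒≤ m n (subst T (sym e) _)
  where open import Data.Bool using (T)

≤ᵇ-false : ∀ {m n} → (m ≤ᵇ n) ≡ false → n < m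
≤ᵇ-false {m} {n} e = ≰⇒> (λ h → true≢false (≤ᵇ-true h) e)

𝟙-mono : ∀ {a b} → (a ≡ true → b ≡ true) → 𝟙 a ≤ 𝟙 b
𝟙-mono {true}  h rewrite h refl = ≤-refl
𝟙-mono {false} h = z≤n

𝟙≤1 : ∀ a → 𝟙 a ≤ 1
𝟙≤1 true  = ≤-refl
𝟙≤1 false = z≤n

𝟙-∧ : ∀ a b → 𝟙 (a ∧ b) ≡ 𝟙 a * 𝟙 b
𝟙-∧ true  b = sym (+-identityʳ (𝟙 b))
𝟙-∧ false b = refl

opaque
  sum : ∀ {n} → (Fin n → ℕ) → ℕ
  sum = Sum.sum

  sum-suc : ∀ {n} (f : Fin (suc n) → ℕ) → sum f ≡ f zero + sum (f ∘ suc)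
  sum-suc f = refl

  sum-zero : (f : Fin 0 → ℕ) → sum f ≡ 0
  sum-zero f = refl

  sum-cong : ∀ {n} {f g : Fin n → ℕ} → (∀ i → f i ≡ g i) → sum f ≡ sum g
  sum-cong = Sum.sum-cong-≗

  sum-+ : ∀ {n} (f g : Fin n → ℕ) → sum (λ i → f i + g i) ≡ sum f + sum g
  sum-+ = Sum.∑-distrib-+

  sum-swap : ∀ {m n} (f : Fin m → Fin n → ℕ) → sum (λ i → sum (f i)) ≡ sum (λ j → sum (λ i → f i j))
  sum-swap = Sum.∑-comm

  *-sum : ∀ {n} x (f : Fin n → ℕ) → x * sum f ≡ sum (λ i → x * f i)
  *-sum = Sum.*-distribˡ-sum

  sum-* : ∀ {n} x (f : Fin n → ℕ) → sum f * x ≡ sum (λ i → f i * x)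
  sum-* = Sum.*-distribʳ-sum

  sum-mono : ∀ {n} {f g : Fin n → ℕ} → (∀ i → f i ≤ g i) → sum f ≤ sum g
  sum-mono {zero}  h = z≤n
  sum-mono {suc n} h = +-mono-≤ (h zero) (sum-mono (h ∘ suc))

  sum-const : ∀ n c → sum {n} (λ _ → c) ≡ n * c
  sum-const zero    c = refl
  sum-const (suc n) c = cong (c +_) (sum-const n c)

  sum-pos : ∀ {n} {f : Fin n → ℕ} → 0 < sum f → ∃ λ i → 0 < f i
  sum-pos {suc n} {f} h with f zero in e
  ... | suc x = zero , subst (0 <_) (sym e) (s≤s z≤n)
  ... | zero  = let i , q = sum-pos {n} {f ∘ suc} h in suc i , q

  term≤sum : ∀ {n} (f : Fin n → ℕ) i → f i ≤ sum f
  term≤sum f zero    = m≤m+n _ _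
  term≤sum f (suc i) = ≤-trans (term≤sum (f ∘ suc) i) (m≤n+m _ _)

opaque
  count : ∀ {n} → (Fin n → Bool) → ℕ
  count p = sum (λ i → 𝟙 (p i))

opaque
  unfolding count

  count-sum : ∀ {n} (p : Fin n → Bool) → count p ≡ sum (λ i → 𝟙 (p i))
  count-sum p = refl

  count-suc : ∀ {n} (p : Fin (suc n) → Bool) → count p ≡ 𝟙 (p zero) + count (p ∘ suc)
  count-suc p = sum-suc _

  count-cong : ∀ {n} {p q : Fin n → Bool} → (∀ i → p i ≡ q i) → count p ≡ count q
  count-cong h = sum-cong (λ i → cong 𝟙 (h i))

  count-mono : ∀ {n} {p q : Fin n → Bool} → p ⊑ q → count p ≤ count q
  count-mono h = sum-mono (λ i → 𝟙-mono (h i))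

  count-true : ∀ n → count {n} (λ _ → true) ≡ n
  count-true n = trans (sum-const n 1) (*-identityʳ n)

  count≤n : ∀ {n} (p : Fin n → Bool) → count p ≤ n
  count≤n {n} p = ≤-trans (count-mono {q = λ _ → true} (λ _ _ → refl)) (≤-reflexive (count-true n))

  count-split : ∀ {n} (p q : Fin n → Bool) → count p ≡ count (p ∩ q) + count (p ∖ q)
  count-split p q = trans (sum-cong (λ i → bit (p i) (q i))) (sum-+ _ _)
    where
    bit : ∀ a b → 𝟙 a ≡ 𝟙 (a ∧ b) + 𝟙 (a ∧ not b)
    bit true true   = refl
    bit true false  = refl
    bit false _     = refl

  count-∖-⊑ : ∀ {n} (p q : Fin n → Bool) → q ⊑ p → count p ≡ count q + count (p ∖ q)
  count-∖-⊑ p q h = trans (count-split p q) (cong (_+ count (p ∖ q))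
    (count-cong (λ i → bool-ext ∧-right (λ e → ∧-intro (h i e) e))))

  count-∪ : ∀ {n} (p q : Fin n → Bool) → count (p ∪ q) ≤ count p + count q
  count-∪ p q = ≤-trans (sum-mono (λ i → bit (p i) (q i))) (≤-reflexive (sum-+ _ _))
    where
    bit : ∀ a b → 𝟙 (a ∨ b) ≤ 𝟙 a + 𝟙 b
    bit true  b = s≤s z≤n
    bit false b = ≤-refl

  count-⊎ : ∀ {n} (p q r : Fin n → Bool) → (∀ i → r i ≡ true → p i ≡ true ⊎ q i ≡ true) → count r ≤ count p + count q
  count-⊎ p q r h = ≤-trans (count-mono (λ i e → [ ∨-introˡ , ∨-introʳ {p i} ]′ (h i e))) (count-∪ p q)

  count≤count-∖ : ∀ {n} (p q : Fin n → Bool) → count p ≤ count q + count (p ∖ q)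
  count≤count-∖ p q = count-⊎ q (p ∖ q) p λ i e →
    [ inj₁ , (λ f → inj₂ (∧-intro e (not-intro f))) ]′ (bool-dec (q i))

  count-disjoint : ∀ {n} (p q r : Fin n → Bool) → p ⊑ r → q ⊑ r → (∀ i → p i ≡ true → q i ≡ true → ⊥) → count p + count q ≤ count r
  count-disjoint p q r pr qr dis = begin
    count p + count q        ≤⟨ +-monoʳ-≤ (count p) (count-mono (λ i e → ∧-intro (qr i e) (not-intro (¬true⇒false (λ e′ → dis i e′ e))))) ⟩
    count p + count (r ∖ p)  ≡⟨ count-∖-⊑ r p pr ⟨
    count r                  ∎

  count-pick : ∀ {n} {p : Fin n → Bool} → 0 < count p → ∃ λ i → p i ≡ true
  count-pick {p = p} h = let i , q = sum-pos h in i , pos q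
    where
    pos : ∀ {a} → 0 < 𝟙 a → a ≡ true
    pos {true} _ = refl

  count-pos : ∀ {n} {p : Fin n → Bool} i → p i ≡ true → 0 < count p
  count-pos {p = p} i e = ≤-trans (≤-reflexive (cong 𝟙 (sym e))) (term≤sum (𝟙 ∘ p) i)

  count-zero : ∀ {n} {p : Fin n → Bool} → count p ≤ 0 → ∀ i → p i ≡ false
  count-zero h i = ¬true⇒false (λ e → <⇒≱ (count-pos i e) h)

  count-none : ∀ {n} {p : Fin n → Bool} → (∀ i → p i ≡ false) → count p ≡ 0
  count-none {n} h = trans (count-cong h) (trans (sum-const n 0) (*-zeroʳ n))

  pick-∖ : ∀ {n} (p q : Fin n → Bool) → count q < count p → ∃ λ i → p i ≡ true × q i ≡ false
  pick-∖ p q h = let i , e = count-pick pos in i , ∧-left e , not-elim (∧-right {p i} e)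
    where
    pos : 0 < count (p ∖ q)
    pos = +-cancelˡ-< (count q) 0 _ (begin-strict
      count q + 0              ≡⟨ +-identityʳ _ ⟩
      count q                  <⟨ h ⟩
      count p                  ≤⟨ count≤count-∖ p q ⟩
      count q + count (p ∖ q)  ∎)

  ⊑-full : ∀ {n} (p q : Fin n → Bool) → p ⊑ q → count q ≤ count p → q ⊑ p
  ⊑-full p q s h i e = [ id , (λ f → ⊥-elim (true≢false (∧-intro e (not-intro f)) (count-zero none i))) ]′ (bool-dec (p i))
    where
    none : count (q ∖ p) ≤ 0
    none = +-cancelˡ-≤ (count p) _ 0 (begin
      count p + count (q ∖ p)  ≡⟨ count-∖-⊑ q p s ⟨
      count q                  ≤⟨ h ⟩
      count p                  ≡⟨ +-identityʳ _ ⟨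
      count p + 0              ∎)

  subset-of-size : ∀ {n} (p : Fin n → Bool) k → k ≤ count p → ∃ λ q → q ⊑ p × count q ≡ k
  subset-of-size {n} p zero h = (λ _ → false) , (λ _ ()) , count-none {n} (λ _ → refl)
  subset-of-size {zero}  p (suc k) h = case subst (suc k ≤_) (sum-zero _) h of λ ()
  subset-of-size {suc n} p (suc k) h with p zero in e | count-suc p
  ... | true  | c₀ = let q , s , c = subset-of-size (p ∘ suc) k (≤-pred (subst (suc k ≤_) c₀ h)) in
    (λ { zero → true ; (suc i) → q i }) , (λ { zero _ → e ; (suc i) → s i }) , trans (count-suc {n} _) (cong suc c)
  ... | false | c₀ = let q , s , c = subset-of-size (p ∘ suc) (suc k) (subst (suc k ≤_) c₀ h) in
    (λ { zero → false ; (suc i) → q i }) , (λ { zero () ; (suc i) → s i }) , trans (count-suc {n} _) c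

opaque
  allB anyB : ∀ {n} → (Fin n → Bool) → Bool
  allB {zero}  p = true
  allB {suc n} p = p zero ∧ allB (p ∘ suc)
  anyB {zero}  p = false
  anyB {suc n} p = p zero ∨ anyB (p ∘ suc)

  allB-intro : ∀ {n} {p : Fin n → Bool} → (∀ i → p i ≡ true) → allB p ≡ true
  allB-intro {zero}  h = refl
  allB-intro {suc n} h = ∧-intro (h zero) (allB-intro (h ∘ suc))

  allB-elim : ∀ {n} {p : Fin n → Bool} → allB p ≡ true → ∀ i → p i ≡ true
  allB-elim e zero    = ∧-left e
  allB-elim {p = p} e (suc i) = allB-elim {p = p ∘ suc} (∧-right {p zero} e) i

  anyB-intro : ∀ {n} {p : Fin n → Bool} i → p i ≡ true → anyB p ≡ true
  anyB-intro zero e = ∨-introˡ e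
  anyB-intro {p = p} (suc i) e = ∨-introʳ {p zero} (anyB-intro {p = p ∘ suc} i e)

  anyB-elim : ∀ {n} {p : Fin n → Bool} → anyB p ≡ true → ∃ λ i → p i ≡ true
  anyB-elim {suc n} {p} e with ∨-elim {p zero} e
  ... | inj₁ e₀ = zero , e₀
  ... | inj₂ e₁ = let i , q = anyB-elim {n} {p ∘ suc} e₁ in suc i , q

  anyB-false : ∀ {n} {p : Fin n → Bool} → anyB p ≡ false → ∀ i → p i ≡ false
  anyB-false e i = ¬true⇒false (λ q → true≢false (anyB-intro i q) e)

opaque
  unfolding count

  𝟙-anyB : ∀ {n} (p : Fin n → Bool) → 𝟙 (anyB p) ≤ count p
  𝟙-anyB p with bool-dec (anyB p)
  ... | inj₁ e = let i , q = anyB-elim e in ≤-trans (𝟙≤1 (anyB p)) (count-pos i q)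
  ... | inj₂ e rewrite e = z≤n

  count-anyB : ∀ {m n} (R : Fin m → Fin n → Bool) → count (λ a → anyB (λ y → R y a)) ≤ sum (λ y → count (R y))
  count-anyB R = ≤-trans (sum-mono (λ a → 𝟙-anyB (λ y → R y a))) (≤-reflexive (sum-swap (λ a y → 𝟙 (R y a))))

  markov : ∀ {n} (p : Fin n → Bool) (f : Fin n → ℕ) c → (∀ i → p i ≡ true → c ≤ f i) → count p * c ≤ sum f
  markov p f c h = ≤-trans (≤-reflexive (sum-* c (𝟙 ∘ p))) (sum-mono (λ i → bit i))
    where
    bit : ∀ i → 𝟙 (p i) * c ≤ f i
    bit i with p i in e
    ... | true  = ≤-trans (≤-reflexive (+-identityʳ c)) (h i e)
    ... | false = z≤n

  sum-on-mono : ∀ {n} (p : Fin n → Bool) (f g : Fin n → ℕ) → (∀ i → p i ≡ true → f i ≤ g i) →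
    sum (λ i → 𝟙 (p i) * f i) ≤ sum (λ i → 𝟙 (p i) * g i)
  sum-on-mono p f g h = sum-mono bit
    where
    bit : ∀ i → 𝟙 (p i) * f i ≤ 𝟙 (p i) * g i
    bit i with p i in e
    ... | true  = *-monoʳ-≤ 1 (h i e)
    ... | false = z≤n

  sum-on-const : ∀ {n} (p : Fin n → Bool) c → sum (λ i → 𝟙 (p i) * c) ≡ count p * c
  sum-on-const p c = sym (sum-* c (𝟙 ∘ p))

  averaging : ∀ {n} (p : Fin n → Bool) (f g : Fin n → ℕ) → 0 < count p →
    sum (λ i → 𝟙 (p i) * f i) ≤ sum (λ i → 𝟙 (p i) * g i) → ∃ λ i → p i ≡ true × f i ≤ g i
  averaging p f g pos h with anyB (λ i → p i ∧ (f i ≤ᵇ g i)) in e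
  ... | true  = let i , q = anyB-elim e in i , ∧-left q , ≤ᵇ-elim (∧-right {p i} q)
  ... | false = ⊥-elim (<-irrefl refl (begin-strict
      sum (λ i → 𝟙 (p i) * g i)                    <⟨ m<m+n _ pos ⟩
      sum (λ i → 𝟙 (p i) * g i) + count p          ≡⟨ sum-+ (λ i → 𝟙 (p i) * g i) (𝟙 ∘ p) ⟨
      sum (λ i → 𝟙 (p i) * g i + 𝟙 (p i))          ≡⟨ sum-cong (λ i → rearr (𝟙 (p i)) (g i)) ⟩
      sum (λ i → 𝟙 (p i) * suc (g i))              ≤⟨ sum-on-mono p _ f (λ i pi → ≤ᵇ-false (¬true⇒false (λ le → true≢false (∧-intro pi le) (anyB-false e i)))) ⟩
      sum (λ i → 𝟙 (p i) * f i)                    ≤⟨ h ⟩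
      sum (λ i → 𝟙 (p i) * g i)                    ∎))
    where
    rearr : ∀ x y → x * y + x ≡ x * suc y
    rearr x y = trans (+-comm (x * y) x) (sym (*-suc x y))

  count-≟ : ∀ {n} (i : Fin n) → count (λ j → does (i ≟ j)) ≡ 1
  count-≟ {suc n} zero    = trans (count-suc {n} _) (cong suc (count-none {n} (λ _ → refl)))
  count-≟ {suc n} (suc i) = trans (count-suc {n} _) (trans (count-cong (λ j → bit j)) (count-≟ i))
    where
    bit : ∀ j → does (suc i ≟ suc j) ≡ does (i ≟ j)
    bit j with i ≟ j
    ... | yes _ = refl
    ... | no  _ = refl

  count-image : ∀ {m n} (p : Fin m → Bool) (f : Fin m → Fin n) →
    count (λ v → anyB (λ i → p i ∧ does (f i ≟ v))) ≤ count p
  count-image p f = begin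
    count (λ v → anyB (λ i → p i ∧ does (f i ≟ v)))  ≤⟨ count-anyB (λ i v → p i ∧ does (f i ≟ v)) ⟩
    sum (λ i → count (λ v → p i ∧ does (f i ≟ v)))   ≡⟨ sum-cong (λ i → col-i (p i) (f i)) ⟩
    count p                                          ∎
    where
    col-i : ∀ {n} b (x : Fin n) → count (λ v → b ∧ does (x ≟ v)) ≡ 𝟙 b
    col-i true  x = count-≟ x
    col-i {n} false x = count-none {n} (λ _ → refl)

  count-injective : ∀ {m n} (p : Fin m → Bool) (q : Fin n → Bool) (f : Fin m → Fin n) →
    (∀ i → p i ≡ true → q (f i) ≡ true) → (∀ i j → p i ≡ true → p j ≡ true → f i ≡ f j → i ≡ j) → count p ≤ count q
  count-injective {m} {n} p q f pq inj = begin
    count p                                               ≡⟨ sum-cong (λ i → trans (sym (*-identityʳ (𝟙 (p i)))) (trans (cong (𝟙 (p i) *_) (sym (count-≟ (f i)))) (*-sum (𝟙 (p i)) (λ v → 𝟙 (does (f i ≟ v)))))) ⟩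
    sum (λ i → sum (λ v → 𝟙 (p i) * 𝟙 (does (f i ≟ v))))  ≡⟨ sum-swap _ ⟩
    sum (λ v → sum (λ i → 𝟙 (p i) * 𝟙 (does (f i ≟ v))))  ≤⟨ sum-mono fibre ⟩
    count q                                               ∎
    where
    unique : ∀ {k} (r : Fin k → Bool) → (∀ i j → r i ≡ true → r j ≡ true → i ≡ j) → count r ≤ 1
    unique {zero}  r u = ≤-trans (≤-reflexive (sum-zero _)) z≤n
    unique {suc k} r u with r zero in e | count-suc r
    ... | true  | c = ≤-reflexive (trans c (cong suc (count-none {k} (λ i → ¬true⇒false (λ ri → case u zero (suc i) e ri of λ ())))))
    ... | false | c = ≤-trans (≤-reflexive c) (unique (r ∘ suc) (λ i j ri rj → Fin-suc-injective (u (suc i) (suc j) ri rj)))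
    fibre : ∀ v → sum (λ i → 𝟙 (p i) * 𝟙 (does (f i ≟ v))) ≤ 𝟙 (q v)
    fibre v with q v in e
    ... | true  = ≤-trans (≤-reflexive (sum-cong (λ i → sym (𝟙-∧ (p i) _))))
        (unique (λ i → p i ∧ does (f i ≟ v)) (λ i j ri rj → inj i j (∧-left ri) (∧-left rj)
          (trans (does-elim (f i ≟ v) (∧-right {p i} ri)) (sym (does-elim (f j ≟ v) (∧-right {p j} rj))))))
    ... | false = ≤-reflexive (trans (sum-cong (λ i → sym (𝟙-∧ (p i) _)))
        (count-none (λ i → ¬true⇒false (λ ri → true≢false (trans (cong q (sym (does-elim (f i ≟ v) (∧-right {p i} ri)))) (pq i (∧-left ri))) e))))

search-vec : ∀ n {P : Vec Bool n → Set} → (∀ v → Dec (P v)) → ∃ P ⊎ (∀ v → ¬ P v)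
search-vec zero P? with P? []
... | yes p = inj₁ ([] , p)
... | no ¬p = inj₂ λ { [] → ¬p }
search-vec (suc n) P? with search-vec n (P? ∘ (true ∷_)) | search-vec n (P? ∘ (false ∷_))
... | inj₁ (v , p) | _            = inj₁ (true ∷ v , p)
... | inj₂ _       | inj₁ (v , p) = inj₁ (false ∷ v , p)
... | inj₂ h₁      | inj₂ h₂      = inj₂ λ { (true ∷ v) → h₁ v ; (false ∷ v) → h₂ v }

search-set : ∀ {n} (P : (Fin n → Bool) → Set) → (∀ {T T′} → (∀ i → T i ≡ T′ i) → P T → P T′) → (∀ T → Dec (P T)) →
  ∃ P ⊎ (∀ T → ¬ P T)
search-set {n} P resp P? with search-vec n (P? ∘ lookup)
... | inj₁ (v , p) = inj₁ (lookup v , p)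
... | inj₂ h       = inj₂ λ T p → h (tabulate T) (resp (λ i → sym (lookup∘tabulate T i)) p)

_⊑?_ : ∀ {n} (p q : Fin n → Bool) → Dec (p ⊑ q)
p ⊑? q = all? (λ i → (p i ≟ᵇ true) →-dec (q i ≟ᵇ true))

-- Hall's theorem

neighbours : ∀ {n N} → (Fin n → Fin N → Bool) → (Fin n → Bool) → Fin N → Bool
neighbours Γ S v = anyB (λ y → S y ∧ Γ y v)

⁅_⁆ : ∀ {n} → Fin n → Fin n → Bool
⁅ i ⁆ j = does (i ≟ j)

Disjoint : ∀ {n} → (Fin n → Bool) → (Fin n → Bool) → Set
Disjoint p q = ∀ i → p i ≡ true → q i ≡ true → ⊥

∖-disjoint : ∀ {n} (p q : Fin n → Bool) → Disjoint (p ∖ q) q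
∖-disjoint p q i e = λ e′ → true≢false e′ (not-elim (∧-right {p i} e))

InjectivePM : ∀ {n N} → (Fin n → Maybe (Fin N)) → Set
InjectivePM ρ = ∀ {x y v} → ρ x ≡ just v → ρ y ≡ just v → x ≡ y

record Matching {n N} (S : Fin n → Bool) (W : Fin N → Bool) (Γ : Fin n → Fin N → Bool) : Set where
  field
    match     : Fin n → Maybe (Fin N)
    total     : ∀ y → S y ≡ true → ∃ λ w → match y ≡ just w
    sound     : ∀ {y w} → match y ≡ just w → S y ≡ true × W w ≡ true × Γ y w ≡ true
    injective : InjectivePM match

HallCondition : ∀ {n N} → (Fin n → Bool) → (Fin N → Bool) → (Fin n → Fin N → Bool) → Set
HallCondition S W Γ = ∀ S′ → S′ ⊑ S → count S′ ≤ count (W ∩ neighbours Γ S′)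

matching-∪ : ∀ {n N} {S S₁ S₂ : Fin n → Bool} {W W₁ W₂ : Fin N → Bool} {Γ : Fin n → Fin N → Bool} →
  S₁ ⊑ S → S₂ ⊑ S → (∀ y → S y ≡ true → S₁ y ≡ false → S₂ y ≡ true) → W₁ ⊑ W → W₂ ⊑ W → Disjoint W₂ W₁ →
  Matching S₁ W₁ Γ → Matching S₂ W₂ Γ → Matching S W Γ
matching-∪ {n} {N} {S} {S₁} {S₂} {W} {W₁} {W₂} {Γ} S₁⊑ S₂⊑ cover W₁⊑ W₂⊑ dis m₁ m₂ = record
  { match = μ ; total = tot ; sound = λ {y} {w} → snd y w ; injective = λ {x} {y} {v} → inj′ x y v }
  where
  module M₁ = Matching m₁
  module M₂ = Matching m₂
  μ : Fin n → Maybe (Fin N)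
  μ y = if S₁ y then M₁.match y else M₂.match y
  tot : ∀ y → S y ≡ true → ∃ λ w → μ y ≡ just w
  tot y e with S₁ y in f
  ... | true  = M₁.total y f
  ... | false = M₂.total y (cover y e f)
  snd : ∀ y w → μ y ≡ just w → S y ≡ true × W w ≡ true × Γ y w ≡ true
  snd y w e with S₁ y
  ... | true  = let a , b , c = M₁.sound e in S₁⊑ y a , W₁⊑ w b , c
  ... | false = let a , b , c = M₂.sound e in S₂⊑ y a , W₂⊑ w b , c
  clash : ∀ {x y v} → M₁.match x ≡ just v → M₂.match y ≡ just v → ⊥
  clash {v = v} e f = let _ , a , _ = M₁.sound e ; _ , b , _ = M₂.sound f in dis v b a
  inj′ : ∀ x y v → μ x ≡ just v → μ y ≡ just v → x ≡ y
  inj′ x y v e f with S₁ x | S₁ y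
  ... | true  | true  = M₁.injective e f
  ... | true  | false = ⊥-elim (clash e f)
  ... | false | true  = ⊥-elim (clash f e)
  ... | false | false = M₂.injective e f

matching-empty : ∀ {n N} {S : Fin n → Bool} {W : Fin N → Bool} {Γ : Fin n → Fin N → Bool} → (∀ y → S y ≡ false) → Matching S W Γ
matching-empty h = record
  { match = λ _ → nothing ; total = λ y Sy → ⊥-elim (true≢false Sy (h y)) ; sound = λ () ; injective = λ () }

matching-single : ∀ {n N} {Γ : Fin n → Fin N → Bool} y w → Γ y w ≡ true → Matching ⁅ y ⁆ ⁅ w ⁆ Γ
matching-single {n} {N} {Γ} y₀ w₀ Γ₀ = record
  { match = μ ; total = tot ; sound = λ {y} {w} → snd y w ; injective = λ {x} {y} {v} e f → trans (sym (proj₁ (eqs x v e))) (proj₁ (eqs y v f)) }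
  where
  μ : Fin n → Maybe (Fin N)
  μ y = if ⁅ y₀ ⁆ y then just w₀ else nothing
  tot : ∀ y → ⁅ y₀ ⁆ y ≡ true → ∃ λ w → μ y ≡ just w
  tot y e = w₀ , cong (λ b → if b then just w₀ else nothing) e
  eqs : ∀ y w → μ y ≡ just w → y₀ ≡ y × w₀ ≡ w
  eqs y w e with y₀ ≟ y
  eqs y w refl | yes p = p , refl
  snd : ∀ y w → μ y ≡ just w → ⁅ y₀ ⁆ y ≡ true × ⁅ w₀ ⁆ w ≡ true × Γ y w ≡ true
  snd y w e with eqs y w e
  ... | refl , refl = does-true (y₀ ≟ y₀) refl , does-true (w₀ ≟ w₀) refl , Γ₀

neighbours-cong : ∀ {n N} (Γ : Fin n → Fin N → Bool) {S S′} → S ⊑ S′ → neighbours Γ S ⊑ neighbours Γ S′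
neighbours-cong Γ {S} h w e = let y , q = anyB-elim e in anyB-intro y (∧-intro (h y (∧-left q)) (∧-right {S y} q))

module _ {n N} (S : Fin n → Bool) (W : Fin N → Bool) (Γ : Fin n → Fin N → Bool) (H : HallCondition S W Γ) where

  Critical : (Fin n → Bool) → Set
  Critical T = T ⊑ S × count T < count S × 0 < count T × count (W ∩ neighbours Γ T) ≤ count T

  critical-set? : ∃ Critical ⊎ (∀ T → ¬ Critical T)
  critical-set? = search-set Critical resp
    (λ T → (T ⊑? S) ×-dec (count T <? count S) ×-dec (0 <? count T) ×-dec (count (W ∩ neighbours Γ T) ≤? count T))
    where
    resp : ∀ {T T′} → (∀ i → T i ≡ T′ i) → Critical T → Critical T′
    resp {T} {T′} same (sub , small , pos , tight) =
      (λ i e → sub i (trans (same i) e)) , subst (_< count S) c small , subst (0 <_) c pos ,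
      ≤-trans (count-mono (λ w e → ∧-intro (∧-left e) (neighbours-cong Γ (λ i q → trans (same i) q) w (∧-right {W w} e)))) (subst (count (W ∩ neighbours Γ T) ≤_) c tight)
      where
      c : count T ≡ count T′
      c = count-cong same

  hall-outside-critical : ∀ T → Critical T → HallCondition (S ∖ T) (W ∖ neighbours Γ T) Γ
  hall-outside-critical T (T⊑S , _ , _ , tight) R R⊑ = +-cancelˡ-≤ (count T) _ _ (begin
    count T + count R                                                          ≤⟨ count-disjoint T R (T ∪ R) (λ i → ∨-introˡ) (λ i → ∨-introʳ {T i}) (λ i e f → ∖-disjoint S T i (R⊑ i f) e) ⟩
    count (T ∪ R)                                                              ≤⟨ H (T ∪ R) (λ i e → [ T⊑S i , ∧-left ∘ R⊑ i ]′ (∨-elim e)) ⟩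
    count (W ∩ neighbours Γ (T ∪ R))                                           ≤⟨ count-⊎ (W ∩ neighbours Γ T) _ _ split ⟩
    count (W ∩ neighbours Γ T) + count ((W ∖ neighbours Γ T) ∩ neighbours Γ R)  ≤⟨ +-monoˡ-≤ _ tight ⟩
    count T + count ((W ∖ neighbours Γ T) ∩ neighbours Γ R)                    ∎)
    where
    split : ∀ w → (W ∩ neighbours Γ (T ∪ R)) w ≡ true → (W ∩ neighbours Γ T) w ≡ true ⊎ ((W ∖ neighbours Γ T) ∩ neighbours Γ R) w ≡ true
    split w e with bool-dec (neighbours Γ T w)
    ... | inj₁ f = inj₁ (∧-intro (∧-left e) f)
    ... | inj₂ f with anyB-elim (∧-right {W w} e)
    ... | y , q with ∨-elim {T y} (∧-left q)
    ... | inj₁ a = ⊥-elim (true≢false (anyB-intro y (∧-intro a (∧-right {(T ∪ R) y} q))) f)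
    ... | inj₂ a = inj₂ (∧-intro (∧-intro (∧-left e) (not-intro f)) (anyB-intro y (∧-intro a (∧-right {(T ∪ R) y} q))))

  hall-after-edge : (∀ T → ¬ Critical T) → ∀ y w → S y ≡ true → HallCondition (S ∖ ⁅ y ⁆) (W ∖ ⁅ w ⁆) Γ
  hall-after-edge loose y₀ w₀ Sy₀ T T⊑ = case bool-dec (1 ≤ᵇ count T) of λ
    { (inj₂ e) → ≤-trans (≤-pred (≤ᵇ-false {1} e)) z≤n
    ; (inj₁ e) → +-cancelˡ-≤ 1 _ _ (begin
        suc (count T)                                                  ≤⟨ ≰⇒> (λ le → loose T (T⊑S , smaller , ≤ᵇ-elim {1} e , le)) ⟩
        count (W ∩ neighbours Γ T)                                     ≤⟨ count-⊎ ⁅ w₀ ⁆ _ _ split ⟩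
        count ⁅ w₀ ⁆ + count ((W ∖ ⁅ w₀ ⁆) ∩ neighbours Γ T)           ≡⟨ cong (_+ count ((W ∖ ⁅ w₀ ⁆) ∩ neighbours Γ T)) (count-≟ w₀) ⟩
        1 + count ((W ∖ ⁅ w₀ ⁆) ∩ neighbours Γ T)                      ∎) }
    where
    T⊑S : T ⊑ S
    T⊑S i e = ∧-left (T⊑ i e)
    smaller : count T < count S
    smaller = begin
      suc (count T)                       ≡⟨ cong (_+ count T) (count-≟ y₀) ⟨
      count ⁅ y₀ ⁆ + count T              ≤⟨ count-disjoint ⁅ y₀ ⁆ T S (λ i e → subst (λ i → S i ≡ true) (does-elim (y₀ ≟ i) e) Sy₀) T⊑S (λ i e f → ∖-disjoint S ⁅ y₀ ⁆ i (T⊑ i f) e) ⟩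
      count S                             ∎
    split : ∀ w → (W ∩ neighbours Γ T) w ≡ true → ⁅ w₀ ⁆ w ≡ true ⊎ ((W ∖ ⁅ w₀ ⁆) ∩ neighbours Γ T) w ≡ true
    split w e with bool-dec (⁅ w₀ ⁆ w)
    ... | inj₁ f = inj₁ f
    ... | inj₂ f = inj₂ (∧-intro (∧-intro (∧-left e) (not-intro f)) (∧-right {W w} e))

  hall-edge : ∀ y → S y ≡ true → ∃ λ w → W w ≡ true × Γ y w ≡ true
  hall-edge y₀ Sy₀ = w , ∧-left e , edge (anyB-elim (∧-right {W w} e))
    where
    target : ∃ λ w → (W ∩ neighbours Γ ⁅ y₀ ⁆) w ≡ true
    target = count-pick (≤-trans (≤-reflexive (sym (count-≟ y₀))) (H ⁅ y₀ ⁆ (λ i e → subst (λ i → S i ≡ true) (does-elim (y₀ ≟ i) e) Sy₀)))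
    w = proj₁ target
    e = proj₂ target
    edge : (∃ λ y → ⁅ y₀ ⁆ y ∧ Γ y w ≡ true) → Γ y₀ w ≡ true
    edge (y , q) = subst (λ y → Γ y w ≡ true) (sym (does-elim (y₀ ≟ y) (∧-left q))) (∧-right {⁅ y₀ ⁆ y} q)

hall : ∀ {n N} k (S : Fin n → Bool) (W : Fin N → Bool) (Γ : Fin n → Fin N → Bool) → count S ≤ k → HallCondition S W Γ → Matching S W Γ
hall zero S W Γ size H = matching-empty (count-zero size)
hall (suc k) S W Γ size H with critical-set? S W Γ H
... | inj₁ (T , crit@(T⊑S , small , pos , _)) =
  matching-∪ {S₁ = T} {S₂ = S ∖ T} {W₁ = W ∩ neighbours Γ T} {W₂ = W ∖ neighbours Γ T}
    T⊑S (λ i → ∧-left) (λ y e f → ∧-intro e (not-intro f)) (λ i → ∧-left) (λ i → ∧-left)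
    (λ i e f → ∖-disjoint W (neighbours Γ T) i e (∧-right {W i} f))
    (hall k T (W ∩ neighbours Γ T) Γ (≤-pred (≤-trans small size)) λ R R⊑ → ≤-trans (H R (λ i → T⊑S i ∘ R⊑ i))
      (count-mono (λ w e → ∧-intro (∧-intro (∧-left e) (neighbours-cong Γ R⊑ w (∧-right {W w} e))) (∧-right {W w} e))))
    (hall k (S ∖ T) (W ∖ neighbours Γ T) Γ (≤-pred (≤-trans (≤-trans (+-monoˡ-≤ _ pos) (≤-reflexive (sym (count-∖-⊑ S T T⊑S)))) size))
      (hall-outside-critical S W Γ H T crit))
... | inj₂ loose with bool-dec (anyB S)
... | inj₂ e = matching-empty (anyB-false e)
... | inj₁ e with anyB-elim e
... | y , Sy with hall-edge S W Γ H y Sy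
... | w , Ww , Γyw =
  matching-∪ {S₁ = ⁅ y ⁆} {S₂ = S ∖ ⁅ y ⁆} {W₁ = ⁅ w ⁆} {W₂ = W ∖ ⁅ w ⁆}
    single⊑ (λ i → ∧-left) (λ y e f → ∧-intro e (not-intro f))
    (λ i e → subst (λ i → W i ≡ true) (does-elim (w ≟ i) e) Ww) (λ i → ∧-left) (∖-disjoint W ⁅ w ⁆)
    (matching-single y w Γyw)
    (hall k (S ∖ ⁅ y ⁆) (W ∖ ⁅ w ⁆) Γ
      (≤-pred (≤-trans (≤-reflexive (sym (trans (count-∖-⊑ S ⁅ y ⁆ single⊑) (cong (_+ count (S ∖ ⁅ y ⁆)) (count-≟ y))))) size))
      (hall-after-edge S W Γ H loose y w Sy))
  where
  single⊑ : ⁅ y ⁆ ⊑ S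
  single⊑ i e = subst (λ i → S i ≡ true) (does-elim (y ≟ i) e) Sy

hall-greedy : ∀ {n N} (S : Fin n → Bool) (W : Fin N → Bool) (Γ : Fin n → Fin N → Bool) →
  (∀ y → S y ≡ true → count S ≤ count (W ∩ Γ y)) → Matching S W Γ
hall-greedy S W Γ h = hall (count S) S W Γ ≤-refl cond
  where
  cond : HallCondition S W Γ
  cond T T⊑ with anyB T in e
  ... | false = ≤-trans (≤-reflexive (count-none (anyB-false e))) z≤n
  ... | true  = let y , Ty = anyB-elim e in ≤-trans (count-mono T⊑) (≤-trans (h y (T⊑ y Ty))
    (count-mono (λ w q → ∧-intro (∧-left q) (anyB-intro y (∧-intro Ty (∧-right {W w} q))))))

-- Partial embeddings and covers

sum-list : ∀ {n} (f : Fin n → ℕ) → ListAction.sum (List.tabulate f) ≡ sum f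
sum-list {zero}  f = sym (sum-zero f)
sum-list {suc n} f = trans (cong (f zero +_) (sum-list (f ∘ suc))) (sym (sum-suc f))

degree-count : ∀ {n} (G : Graph n) i → degree G i ≡ count (adj G i)
degree-count G i = trans (cong ListAction.sum (map-tabulate id (λ j → if adj G i j then 1 else 0))) (trans (sum-list (λ j → if adj G i j then 1 else 0)) (trans (sum-cong (λ j → bit (adj G i j))) (sym (count-sum (adj G i)))))
  where
  bit : ∀ b → (if b then 1 else 0) ≡ 𝟙 b
  bit true  = refl
  bit false = refl

module _ {n N : ℕ} where

  PartialMap : Set
  PartialMap = Fin n → Maybe (Fin N)

  dom : PartialMap → Fin n → Bool
  dom ρ x with ρ x
  ... | just _  = true
  ... | nothing = false

  hits : Maybe (Fin N) → Fin N → Bool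
  hits nothing  v = false
  hits (just a) v = does (a ≟ v)

  image : PartialMap → Fin N → Bool
  image ρ v = anyB (λ x → hits (ρ x) v)

  infixl 8 _[_≔_]
  _[_≔_] : PartialMap → Fin n → Fin N → PartialMap
  (ρ [ x ≔ a ]) z = if does (x ≟ z) then just a else ρ z

  hits-just : ∀ {m v} → hits m v ≡ true → m ≡ just v
  hits-just {just a} {v} e = cong just (does-elim (a ≟ v) e)

  image-intro : ∀ {ρ x v} → ρ x ≡ just v → image ρ v ≡ true
  image-intro {ρ} {x} {v} e = anyB-intro x (subst (λ m → hits m v ≡ true) (sym e) (does-true (v ≟ v) refl))

  image-elim : ∀ {ρ v} → image ρ v ≡ true → ∃ λ x → ρ x ≡ just v
  image-elim e = let x , q = anyB-elim e in x , hits-just q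

  image-nothing : ∀ {ρ v} → image ρ v ≡ false → ∀ {x} → ρ x ≡ just v → ⊥
  image-nothing {ρ} f e = true≢false (image-intro {ρ} e) f

  dom-intro : ∀ {ρ : PartialMap} {x v} → ρ x ≡ just v → dom ρ x ≡ true
  dom-intro {ρ} {x} e with ρ x
  ... | just _ = refl

  dom-elim : ∀ {ρ : PartialMap} {x} → dom ρ x ≡ true → ∃ λ v → ρ x ≡ just v
  dom-elim {ρ} {x} e with ρ x
  ... | just v = v , refl

  dom-nothing : ∀ {ρ : PartialMap} {x} → dom ρ x ≡ false → ρ x ≡ nothing
  dom-nothing {ρ} {x} e with ρ x
  ... | nothing = refl

  nothing-dom : ∀ {ρ : PartialMap} {x} → ρ x ≡ nothing → dom ρ x ≡ false
  nothing-dom {ρ} {x} e with ρ x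
  ... | nothing = refl

  count-image≤dom : ∀ ρ → count (image ρ) ≤ count (dom ρ)
  count-image≤dom ρ = begin
    count (image ρ)                  ≤⟨ count-anyB (λ x v → hits (ρ x) v) ⟩
    sum (λ x → count (hits (ρ x)))   ≡⟨ sum-cong fibre ⟩
    sum (λ x → 𝟙 (dom ρ x))          ≡⟨ count-sum (dom ρ) ⟨
    count (dom ρ)                    ∎
    where
    fibre : ∀ x → count (hits (ρ x)) ≡ 𝟙 (dom ρ x)
    fibre x with ρ x
    ... | just a  = count-≟ a
    ... | nothing = count-none {N} (λ _ → refl)

  injective-count : ∀ (ρ : PartialMap) → InjectivePM ρ → count (dom ρ) ≤ count (image ρ)
  injective-count ρ inj with bool-dec (anyB (dom ρ))
  ... | inj₂ e = ≤-trans (≤-reflexive (count-none (anyB-false e))) z≤n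
  ... | inj₁ e = count-injective (dom ρ) (image ρ) f (λ x d → image-intro {ρ} (f-spec x d)) (λ x y dx dy q → inj (f-spec x dx) (trans (f-spec y dy) (cong just (sym q))))
    where
    default = proj₁ (dom-elim {ρ} (proj₂ (anyB-elim e)))
    f : Fin n → Fin N
    f x with ρ x
    ... | just a  = a
    ... | nothing = default
    f-spec : ∀ x → dom ρ x ≡ true → ρ x ≡ just (f x)
    f-spec x d with ρ x
    ... | just a = refl

  update-elim : ∀ {ρ x a z v} → (ρ [ x ≔ a ]) z ≡ just v → (x ≡ z × a ≡ v) ⊎ ρ z ≡ just v
  update-elim {x = x} {z = z} e with x ≟ z
  ... | yes p = inj₁ (p , just-injective e)
  ... | no _  = inj₂ e

  update-same : ∀ {ρ : PartialMap} {x a} → (ρ [ x ≔ a ]) x ≡ just a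
  update-same {x = x} with x ≟ x
  ... | yes _ = refl
  ... | no q  = ⊥-elim (q refl)

  update-other : ∀ {ρ : PartialMap} {x a z} → x ≢ z → (ρ [ x ≔ a ]) z ≡ ρ z
  update-other {x = x} {z = z} ne with x ≟ z
  ... | yes p = ⊥-elim (ne p)
  ... | no _  = refl

  update-keeps : ∀ {ρ : PartialMap} {x a z} → ρ x ≡ nothing → dom ρ z ≡ true → (ρ [ x ≔ a ]) z ≡ ρ z
  update-keeps {ρ} {x} {a} {z} e d = update-other {ρ} {x} λ { refl → true≢false d (nothing-dom {ρ} e) }

  count-dom-update : ∀ (ρ : PartialMap) x a (p : Fin n → Bool) → ρ x ≡ nothing →
    count (p ∩ dom (ρ [ x ≔ a ])) ≡ count (p ∩ dom ρ) + 𝟙 (p x)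
  count-dom-update ρ x a p e = begin-equality
    count (p ∩ dom (ρ [ x ≔ a ]))                      ≡⟨ count-sum _ ⟩
    sum (λ z → 𝟙 (p z ∧ dom (ρ [ x ≔ a ]) z))          ≡⟨ sum-cong bit ⟩
    sum (λ z → 𝟙 (p z ∧ dom ρ z) + 𝟙 (p x) * 𝟙 (⁅ x ⁆ z))  ≡⟨ sum-+ _ _ ⟩
    sum (λ z → 𝟙 (p z ∧ dom ρ z)) + sum (λ z → 𝟙 (p x) * 𝟙 (⁅ x ⁆ z))  ≡⟨ cong₂ _+_ (sym (count-sum (p ∩ dom ρ))) (sym (*-sum (𝟙 (p x)) _)) ⟩
    count (p ∩ dom ρ) + 𝟙 (p x) * sum (λ z → 𝟙 (⁅ x ⁆ z))  ≡⟨ cong (λ s → count (p ∩ dom ρ) + 𝟙 (p x) * s) (trans (sym (count-sum ⁅ x ⁆)) (count-≟ x)) ⟩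
    count (p ∩ dom ρ) + 𝟙 (p x) * 1                    ≡⟨ cong (count (p ∩ dom ρ) +_) (*-identityʳ _) ⟩
    count (p ∩ dom ρ) + 𝟙 (p x)                        ∎
    where
    bit : ∀ z → 𝟙 (p z ∧ dom (ρ [ x ≔ a ]) z) ≡ 𝟙 (p z ∧ dom ρ z) + 𝟙 (p x) * 𝟙 (⁅ x ⁆ z)
    bit z with x ≟ z
    bit z | no _ = sym (trans (cong (𝟙 (p z ∧ dom ρ z) +_) (*-zeroʳ (𝟙 (p x)))) (+-identityʳ _))
    bit z | yes refl rewrite e with p z
    ... | true  = refl
    ... | false = refl

  record PartialEmbedding (X : Fin n → Bool) (U : Fin N → Bool) (ρ : PartialMap) : Set where
    field
      injective : InjectivePM ρ
      domain    : ∀ {x v} → ρ x ≡ just v → X x ≡ true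
      range     : ∀ {x v} → ρ x ≡ just v → U v ≡ true

    dom⊑ : dom ρ ⊑ X
    dom⊑ x d = domain (proj₂ (dom-elim {ρ} d))

  open PartialEmbedding

  update-embedding : ∀ {X U ρ x a} → PartialEmbedding X U ρ → X x ≡ true → U a ≡ true → image ρ a ≡ false → PartialEmbedding X U (ρ [ x ≔ a ])
  update-embedding {X} {U} {ρ} {x} {a} pe Xx Ua fresh = record { injective = inj′ ; domain = dm ; range = rg }
    where
    inj′ : InjectivePM (ρ [ x ≔ a ])
    inj′ {y} {z} e f with update-elim {ρ} {x} e | update-elim {ρ} {x} f
    ... | inj₁ (p , q) | inj₁ (p′ , q′) = trans (sym p) p′
    ... | inj₁ (_ , refl) | inj₂ f′ = ⊥-elim (image-nothing {ρ} fresh f′)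
    ... | inj₂ e′ | inj₁ (_ , refl) = ⊥-elim (image-nothing {ρ} fresh e′)
    ... | inj₂ e′ | inj₂ f′ = injective pe e′ f′
    dm : ∀ {y v} → (ρ [ x ≔ a ]) y ≡ just v → X y ≡ true
    dm e with update-elim {ρ} {x} e
    ... | inj₁ (refl , _) = Xx
    ... | inj₂ e′ = domain pe e′
    rg : ∀ {y v} → (ρ [ x ≔ a ]) y ≡ just v → U v ≡ true
    rg e with update-elim {ρ} {x} e
    ... | inj₁ (_ , refl) = Ua
    ... | inj₂ e′ = range pe e′

  embedding-weaken : ∀ {X X′ U U′ ρ} → X ⊑ X′ → U ⊑ U′ → PartialEmbedding X U ρ → PartialEmbedding X′ U′ ρ
  embedding-weaken h k pe = record { injective = injective pe ; domain = λ e → h _ (domain pe e) ; range = λ e → k _ (range pe e) }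

  empty-embedding : ∀ {X U} → PartialEmbedding X U (λ _ → nothing)
  empty-embedding = record { injective = λ () ; domain = λ () ; range = λ () }

  extend-to : ∀ (X₁ : Fin n → Bool) {X U} (Inv : PartialMap → Set) → X₁ ⊑ X →
    (∀ ρ x → PartialEmbedding X U ρ → Inv ρ → X₁ x ≡ true → ρ x ≡ nothing →
      ∃ λ a → U a ≡ true × image ρ a ≡ false × Inv (ρ [ x ≔ a ])) →
    ∀ ρ → PartialEmbedding X U ρ → Inv ρ →
    ∃ λ ρ′ → PartialEmbedding X U ρ′ × Inv ρ′ × X₁ ⊑ dom ρ′
  extend-to X₁ {X} {U} Inv X₁⊑X step ρ₀ pe₀ inv₀ = loop (count (X₁ ∖ dom ρ₀)) ρ₀ ≤-refl pe₀ inv₀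
    where
    loop : ∀ k ρ → count (X₁ ∖ dom ρ) ≤ k → PartialEmbedding X U ρ → Inv ρ → ∃ λ ρ′ → PartialEmbedding X U ρ′ × Inv ρ′ × X₁ ⊑ dom ρ′
    loop k ρ size pe inv with bool-dec (anyB (X₁ ∖ dom ρ))
    ... | inj₂ e = ρ , pe , inv , λ x q → [ id , (λ f → ⊥-elim (true≢false (∧-intro q (not-intro f)) (anyB-false e x))) ]′ (bool-dec (dom ρ x))
    loop zero ρ size pe inv | inj₁ e = ⊥-elim (true≢false (proj₂ (anyB-elim e)) (count-zero size _))
    loop (suc k) ρ size pe inv | inj₁ e =
      let x , q = anyB-elim e
          none = dom-nothing {ρ} (not-elim (∧-right {X₁ x} q))
          a , Ua , fresh , inv′ = step ρ x pe inv (∧-left q) none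
      in loop k (ρ [ x ≔ a ]) (smaller x a q none) (update-embedding pe (X₁⊑X x (∧-left q)) Ua fresh) inv′
      where
      smaller : ∀ x a → (X₁ ∖ dom ρ) x ≡ true → ρ x ≡ nothing → count (X₁ ∖ dom (ρ [ x ≔ a ])) ≤ k
      smaller x a q none = ≤-pred (begin
        1 + count (X₁ ∖ dom (ρ [ x ≔ a ]))             ≡⟨ cong (_+ count (X₁ ∖ dom (ρ [ x ≔ a ]))) (count-≟ x) ⟨
        count ⁅ x ⁆ + count (X₁ ∖ dom (ρ [ x ≔ a ]))   ≤⟨ count-disjoint ⁅ x ⁆ _ (X₁ ∖ dom ρ) inX sub sep ⟩
        count (X₁ ∖ dom ρ)                             ≤⟨ size ⟩
        suc k                                          ∎)
        where
        inX : ⁅ x ⁆ ⊑ (X₁ ∖ dom ρ)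
        inX z e = subst (λ z → (X₁ ∖ dom ρ) z ≡ true) (does-elim (x ≟ z) e) q
        sub : (X₁ ∖ dom (ρ [ x ≔ a ])) ⊑ (X₁ ∖ dom ρ)
        sub z e = ∧-intro (∧-left e) (not-intro (¬true⇒false λ d → true≢false
          (dom-intro {ρ [ x ≔ a ]} {z} (trans (update-keeps {ρ} {x} {a} none d) (proj₂ (dom-elim {ρ} d))))
          (not-elim (∧-right {X₁ z} e))))
        sep : Disjoint ⁅ x ⁆ (X₁ ∖ dom (ρ [ x ≔ a ]))
        sep z e f with does-elim (x ≟ z) e
        ... | refl = true≢false (dom-intro {ρ [ x ≔ a ]} {x} (update-same {ρ})) (not-elim (∧-right {X₁ x} f))

module Candidates {n N : ℕ} (G : Graph n) (g : Fin N → Fin N → Bool) where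

  sees : Maybe (Fin N) → Fin N → Bool
  sees nothing  v = true
  sees (just a) v = g a v

  cand : PartialMap {n} {N} → Fin n → Fin N → Bool
  cand ρ y v = allB (λ x → not (adj G y x) ∨ sees (ρ x) v)

  cand-elim : ∀ {ρ y v x a} → cand ρ y v ≡ true → adj G y x ≡ true → ρ x ≡ just a → g a v ≡ true
  cand-elim {ρ} {y} {v} {x} {a} c e f with ∨-elim (allB-elim {p = λ x → not (adj G y x) ∨ sees (ρ x) v} c x)
  ... | inj₁ q = ⊥-elim (true≢false e (not-elim q))
  ... | inj₂ q = subst (λ m → sees m v ≡ true) f q

  cand-intro : ∀ {ρ y v} → (∀ x a → adj G y x ≡ true → ρ x ≡ just a → g a v ≡ true) → cand ρ y v ≡ true
  cand-intro {ρ} {y} {v} h = allB-intro λ x → go x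
    where
    go : ∀ x → not (adj G y x) ∨ sees (ρ x) v ≡ true
    go x with adj G y x in e | ρ x in f
    ... | false | _       = refl
    ... | true  | nothing = refl
    ... | true  | just a  = h x a e f

  cand-update : ∀ ρ x a y v → ρ x ≡ nothing → cand (ρ [ x ≔ a ]) y v ≡ cand ρ y v ∧ (not (adj G y x) ∨ g a v)
  cand-update ρ x a y v none = bool-ext
    (λ c → ∧-intro
      (cand-intro (λ z b e f → cand-elim {ρ [ x ≔ a ]} c e (trans (update-keeps {ρ = ρ} {x} {a} none (dom-intro {ρ = ρ} f)) f)))
      (case bool-dec (adj G y x) of λ
        { (inj₁ e) → ∨-introʳ {not (adj G y x)} (cand-elim {ρ [ x ≔ a ]} c e (update-same {ρ = ρ}))
        ; (inj₂ e) → ∨-introˡ (not-intro e) }))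
    (λ c → cand-intro λ z b e f → case update-elim {ρ = ρ} {x} f of λ
      { (inj₁ (refl , refl)) → [ (λ q → ⊥-elim (true≢false e (not-elim q))) , id ]′ (∨-elim (∧-right {cand ρ y v} c))
      ; (inj₂ f′) → cand-elim {ρ} (∧-left c) e f′ })

  cand-non-neighbour : ∀ ρ x a y v → ρ x ≡ nothing → adj G y x ≡ false → cand (ρ [ x ≔ a ]) y v ≡ cand ρ y v
  cand-non-neighbour ρ x a y v none e = trans (cand-update ρ x a y v none) (bool-ext ∧-left (λ c → ∧-intro c (∨-introˡ (not-intro e))))

  cand-neighbour : ∀ ρ x a y v → ρ x ≡ nothing → adj G y x ≡ true → cand (ρ [ x ≔ a ]) y v ≡ cand ρ y v ∧ g a v
  cand-neighbour ρ x a y v none e = trans (cand-update ρ x a y v none) (cong (λ b → cand ρ y v ∧ (not b ∨ g a v)) e)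

  placed : PartialMap {n} {N} → Fin n → ℕ
  placed ρ y = count (adj G y ∩ dom ρ)

  placed≤ : ∀ {d} → (∀ y → count (adj G y) ≤ d) → ∀ ρ y → placed ρ y ≤ d
  placed≤ deg ρ y = ≤-trans (count-mono (λ _ → ∧-left)) (deg y)

  placed-update : ∀ ρ x a y → ρ x ≡ nothing → placed (ρ [ x ≔ a ]) y ≡ placed ρ y + 𝟙 (adj G y x)
  placed-update ρ x a y none = count-dom-update ρ x a (adj G y) none

  placed< : ∀ ρ x y → ρ x ≡ nothing → adj G y x ≡ true → placed ρ y < count (adj G y)
  placed< ρ x y none e = begin
    suc (count (adj G y ∩ dom ρ))           ≡⟨ cong (_+ count (adj G y ∩ dom ρ)) (count-≟ x) ⟨
    count ⁅ x ⁆ + count (adj G y ∩ dom ρ)   ≤⟨ count-disjoint ⁅ x ⁆ (adj G y ∩ dom ρ) (adj G y) (λ z q → subst (λ z → adj G y z ≡ true) (does-elim (x ≟ z) q) e) (λ _ → ∧-left) sep ⟩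
    count (adj G y)                         ∎
    where
    sep : Disjoint ⁅ x ⁆ (adj G y ∩ dom ρ)
    sep z q f with does-elim (x ≟ z) q
    ... | refl = true≢false (∧-right {adj G y x} f) (nothing-dom {ρ = ρ} none)

module Covers (F : GraphSeq) {N : ℕ} (c : TwoColoring N) where

  record Copy (k : ℕ) (Z : Fin N → Bool) : Set where
    field
      copy   : MonoCopy F c
      size   : suc (index copy) ≡ k
      inside : ∀ x → Z (emb copy x) ≡ true

    vertices : Fin N → Bool
    vertices v = anyB (λ x → does (emb copy x ≟ v))

    vertices⊑ : vertices ⊑ Z
    vertices⊑ v e = let x , q = anyB-elim e in subst (λ v → Z v ≡ true) (does-elim (emb copy x ≟ v) q) (inside x)

    count-vertices : count vertices ≡ k
    count-vertices = trans (≤-antisym (≤-trans (count-image (λ _ → true) (emb copy)) (≤-reflexive (count-true _)))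
      (≤-trans (≤-reflexive (sym (count-true _))) (count-injective (λ _ → true) vertices (emb copy)
        (λ x _ → anyB-intro x (does-true (emb copy x ≟ emb copy x) refl)) (λ x y _ _ → MonoCopy.inj copy)))) size

    count-rest : ∀ Y → Z ⊑ Y → count Y ≡ k + count (Y ∖ vertices)
    count-rest Y h = trans (count-∖-⊑ Y vertices (λ i → h i ∘ vertices⊑ i)) (cong (_+ count (Y ∖ vertices)) count-vertices)

  open Copy public using (vertices; vertices⊑; count-vertices; count-rest)

  copy-weaken : ∀ {k Z Z′} → Z ⊑ Z′ → Copy k Z → Copy k Z′
  copy-weaken h P = record { copy = Copy.copy P ; size = Copy.size P ; inside = λ x → h _ (Copy.inside P x) }

  record Cover (m : ℕ) (Z : Fin N → Bool) : Set where
    field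
      number   : ℕ
      number≤  : number ≤ m
      parts    : Fin number → MonoCopy F c
      covers   : ∀ v → Z v ≡ true → ∃ λ p → ∃ λ x → emb (parts p) x ≡ v
      within   : ∀ p x → Z (emb (parts p) x) ≡ true
      disjoint : ∀ p q x y → emb (parts p) x ≡ emb (parts q) y → p ≡ q

  cover-empty : ∀ {m Z} → (∀ v → Z v ≡ false) → Cover m Z
  cover-empty none = record { number = 0 ; number≤ = z≤n ; parts = λ () ; covers = λ v e → ⊥-elim (true≢false e (none v))
    ; within = λ () ; disjoint = λ () }

  cover-weaken : ∀ {m m′ Z} → m ≤ m′ → Cover m Z → Cover m′ Z
  cover-weaken h C = record { number = number ; number≤ = ≤-trans number≤ h ; parts = parts ; covers = covers ; within = within ; disjoint = disjoint }
    where open Cover C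

  cover-resp : ∀ {m Z Z′} → Z ⊑ Z′ → Z′ ⊑ Z → Cover m Z → Cover m Z′
  cover-resp h h′ C = record { number = number ; number≤ = number≤ ; parts = parts ; covers = λ v e → covers v (h′ v e)
    ; within = λ p x → h _ (within p x) ; disjoint = disjoint }
    where open Cover C

  cover-add : ∀ {m k Z} (P : Copy k Z) → Cover m (Z ∖ vertices P) → Cover (suc m) Z
  cover-add {m} {k} {Z} P C = record
    { number = suc number ; number≤ = s≤s number≤ ; parts = parts′ ; covers = cov ; within = wth ; disjoint = dis }
    where
    open Cover C
    parts′ : Fin (suc number) → MonoCopy F c
    parts′ zero    = Copy.copy P
    parts′ (suc p) = parts p
    cov : ∀ v → Z v ≡ true → ∃ λ p → ∃ λ x → emb (parts′ p) x ≡ v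
    cov v e with bool-dec (vertices P v)
    ... | inj₁ f = let x , q = anyB-elim f in zero , x , does-elim (emb (Copy.copy P) x ≟ v) q
    ... | inj₂ f = let p , x , q = covers v (∧-intro e (not-intro f)) in suc p , x , q
    wth : ∀ p x → Z (emb (parts′ p) x) ≡ true
    wth zero    x = Copy.inside P x
    wth (suc p) x = ∧-left (within p x)
    clash : ∀ p x y → emb (Copy.copy P) x ≡ emb (parts p) y → ⊥
    clash p x y e = ∖-disjoint Z (vertices P) _ (within p y) (anyB-intro x (does-true (emb (Copy.copy P) x ≟ emb (parts p) y) e))
    dis : ∀ p q x y → emb (parts′ p) x ≡ emb (parts′ q) y → p ≡ q
    dis zero    zero    x y e = refl
    dis zero    (suc q) x y e = ⊥-elim (clash q x y e)
    dis (suc p) zero    x y e = ⊥-elim (clash p y x (sym e))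
    dis (suc p) (suc q) x y e = cong suc (disjoint p q x y e)

  partition : ∀ {m} → Cover m (λ _ → true) → PartitionableInto F c m
  partition C = number , number≤ , parts , (λ v → covers v refl) , disjoint
    where open Cover C

  single-copy : ∀ {Z v} → Z v ≡ true → Copy 1 Z
  single-copy {Z} {v} e = record
    { copy = record { index = 0 ; colour = true ; emb = λ _ → v ; inj = λ { {zero} {zero} _ → refl }
      ; mono = λ { zero zero a → ⊥-elim (true≢false a (irref (F 0) zero)) } }
    ; size = refl ; inside = λ _ → e }

  total-copy : ∀ {k Z} b (ρ : PartialMap {suc k} {N}) → (∀ x → ∃ λ v → ρ x ≡ just v) → InjectivePM ρ →
    (∀ {x v} → ρ x ≡ just v → Z v ≡ true) →
    (∀ {x y u v} → ρ x ≡ just u → ρ y ≡ just v → adj (F k) x y ≡ true → col c u v ≡ b) → Copy (suc k) Z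
  total-copy {k} b ρ tot inj ins edges = record
    { copy = record { index = k ; colour = b ; emb = λ x → proj₁ (tot x)
      ; inj = λ {x} {y} e → inj (proj₂ (tot x)) (trans (proj₂ (tot y)) (cong just (sym e)))
      ; mono = λ x y → edges (proj₂ (tot x)) (proj₂ (tot y)) }
    ; size = refl ; inside = λ x → ins (proj₂ (tot x)) }

  -- This relation may be reflexive, which is harmless because embeddings are injective.
  edge : Bool → Fin N → Fin N → Bool
  edge b u v = does (col c u v ≟ᵇ b)

  edge-sym : ∀ b u v → edge b u v ≡ edge b v u
  edge-sym b u v = cong (λ w → does (w ≟ᵇ b)) (colSym c u v)

  bipartite-copy : ∀ {k} b (X : Fin (suc k) → Bool) → (∀ i j → adj (F k) i j ≡ true → X i ≢ X j) →
    ∀ {U W Z} ρ → PartialEmbedding X U ρ → X ⊑ dom ρ → U ⊑ Z → W ⊑ Z → (∀ {x v} → ρ x ≡ just v → W v ≡ true → ⊥) →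
    Matching (not ∘ X) W (Candidates.cand (F k) (edge b) ρ) → Copy (suc k) Z
  bipartite-copy {k} b X bip {U} {W} {Z} ρ pe full UZ WZ sep M = total-copy b σ tot inj′ ins edges
    where
    module M = Matching M
    open PartialEmbedding pe
    σ : PartialMap
    σ x = if X x then ρ x else M.match x
    tot : ∀ x → ∃ λ v → σ x ≡ just v
    tot x with X x in e
    ... | true  = dom-elim {ρ = ρ} (full x e)
    ... | false = M.total x (not-intro e)
    inj′ : InjectivePM σ
    inj′ {x} {y} e f with X x | X y
    ... | true  | true  = injective e f
    ... | true  | false = ⊥-elim (sep e (proj₁ (proj₂ (M.sound f))))
    ... | false | true  = ⊥-elim (sep f (proj₁ (proj₂ (M.sound e))))
    ... | false | false = M.injective e f
    ins : ∀ {x v} → σ x ≡ just v → Z v ≡ true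
    ins {x} e with X x
    ... | true  = UZ _ (range e)
    ... | false = WZ _ (proj₁ (proj₂ (M.sound e)))
    edges : ∀ {x y u v} → σ x ≡ just u → σ y ≡ just v → adj (F k) x y ≡ true → col c u v ≡ b
    edges {x} {y} {u} {v} e f a with X x in ex | X y in ey
    ... | true  | true  = ⊥-elim (bip x y a (trans ex (sym ey)))
    ... | false | false = ⊥-elim (bip x y a (trans ex (sym ey)))
    ... | true  | false = does-elim (col c u v ≟ᵇ b)
      (Candidates.cand-elim (F k) (edge b) {ρ} (proj₂ (proj₂ (M.sound f))) (trans (adj-sym (F k) y x) a) e)
    ... | false | true  = trans (colSym c u v) (does-elim (col c v u ≟ᵇ b)
      (Candidates.cand-elim (F k) (edge b) {ρ} (proj₂ (proj₂ (M.sound e))) a f))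

-- Dependent random choice

-- Linear arithmetic by certificates: s is b − a − (r − l), written without subtraction so that the last premise is a semiring identity.
linear : ∀ {l r a b} s → l ≤ r → a + r + s ≡ b + l → a ≤ b
linear {l} {r} {a} {b} s h e = +-cancelʳ-≤ l a b (begin
  a + l      ≤⟨ +-monoʳ-≤ a h ⟩
  a + r      ≤⟨ m≤m+n (a + r) s ⟩
  a + r + s  ≡⟨ e ⟩
  b + l      ∎)

n<2^n : ∀ n → n < 2 ^ n
n<2^n zero    = s≤s z≤n
n<2^n (suc n) = begin
  suc (suc n)        ≤⟨ +-mono-≤ (≤-trans (s≤s z≤n) (n<2^n n)) (n<2^n n) ⟩
  2 ^ n + 2 ^ n      ≡⟨ cong (2 ^ n +_) (+-identityʳ _) ⟨
  2 ^ suc n          ∎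

2^-mono : ∀ {m n} → m ≤ n → 2 ^ m ≤ 2 ^ n
2^-mono = ^-monoʳ-≤ 2

2^-pos : ∀ n → 0 < 2 ^ n
2^-pos n = m^n>0 2 n

^-*-distrib : ∀ m n o → (m * n) ^ o ≡ m ^ o * n ^ o
^-*-distrib m n zero    = refl
^-*-distrib m n (suc o) = trans (cong (m * n *_) (^-*-distrib m n o)) (rearr m n (m ^ o) (n ^ o))
  where
  rearr : ∀ a b c d → a * b * (c * d) ≡ a * c * (b * d)
  rearr = solve-∀

count-not : ∀ {n} (p : Fin n → Bool) → count p + count (not ∘ p) ≡ n
count-not {n} p = trans (sym (count-∖-⊑ (λ _ → true) p (λ _ _ → refl))) (count-true n)

-- bad r A C counts the r-tuples of A (with repetition) having fewer than k common neighbours in C.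
module DependentChoice {N : ℕ} (g : Fin N → Fin N → Bool) (g-sym : ∀ u v → g u v ≡ g v u) (k : ℕ) where

  bad : ℕ → (Fin N → Bool) → (Fin N → Bool) → ℕ
  bad zero    A C = 𝟙 (suc (count C) ≤ᵇ k)
  bad (suc r) A C = sum (λ a → 𝟙 (A a) * bad r A (C ∩ g a))

  bad-antitone : ∀ r A {C C′} → C ⊑ C′ → bad r A C′ ≤ bad r A C
  bad-antitone zero    A {C} {C′} h = 𝟙-mono λ e → ≤ᵇ-true {suc (count C)} {k} (≤-trans (s≤s (count-mono h)) (≤ᵇ-elim {suc (count C′)} {k} e))
  bad-antitone (suc r) A h = sum-on-mono A _ _ λ a _ → bad-antitone r A λ v e → ∧-intro (h v (∧-left e)) (∧-right e)

  bad≤ : ∀ r A C → bad r A C ≤ count A ^ r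
  bad≤ zero    A C = 𝟙≤1 _
  bad≤ (suc r) A C = ≤-trans (sum-on-mono A _ (λ _ → count A ^ r) (λ a _ → bad≤ r A (C ∩ g a))) (≤-reflexive (sum-on-const A _))

  bad-all : ∀ r A C → count C < k → count A ^ r ≤ bad r A C
  bad-all zero    A C h = ≤-reflexive (cong 𝟙 (sym (≤ᵇ-true {suc (count C)} {k} h)))
  bad-all (suc r) A C h = ≤-trans (≤-reflexive (sym (sum-on-const A _)))
    (sum-on-mono A (λ _ → count A ^ r) _ (λ a _ → bad-all r A (C ∩ g a) (≤-trans (s≤s (count-mono {q = C} λ v → ∧-left)) h)))

  bad-sum : ∀ r A C → sum (λ u → 𝟙 (C u) * bad r (A ∩ g u) C) ≤ k * bad r A C
  bad-sum zero A C = ≤-trans (≤-reflexive (sum-on-const C _)) (bit _ refl)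
    where
    bit : ∀ b → (suc (count C) ≤ᵇ k) ≡ b → count C * 𝟙 b ≤ k * 𝟙 b
    bit false e = ≤-trans (≤-reflexive (*-zeroʳ (count C))) z≤n
    bit true  e = *-monoˡ-≤ 1 (<⇒≤ (≤ᵇ-elim {suc (count C)} {k} e))
  bad-sum (suc r) A C = begin
    sum (λ u → 𝟙 (C u) * sum (λ a → 𝟙 (A a ∧ g u a) * bad r (A ∩ g u) (C ∩ g a)))
      ≡⟨ sum-cong (λ u → *-sum (𝟙 (C u)) _) ⟩
    sum (λ u → sum (λ a → 𝟙 (C u) * (𝟙 (A a ∧ g u a) * bad r (A ∩ g u) (C ∩ g a))))
      ≡⟨ sum-swap _ ⟩
    sum (λ a → sum (λ u → 𝟙 (C u) * (𝟙 (A a ∧ g u a) * bad r (A ∩ g u) (C ∩ g a))))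
      ≡⟨ sum-cong (λ a → trans (sum-cong (λ u → shuffle a u)) (sym (*-sum (𝟙 (A a)) _))) ⟩
    sum (λ a → 𝟙 (A a) * sum (λ u → 𝟙 (C u ∧ g a u) * bad r (A ∩ g u) (C ∩ g a)))
      ≤⟨ sum-mono (λ a → *-monoʳ-≤ (𝟙 (A a)) (≤-trans (sum-mono (λ u → ≤-refl)) (bad-sum r A (C ∩ g a)))) ⟩
    sum (λ a → 𝟙 (A a) * (k * bad r A (C ∩ g a)))
      ≡⟨ sum-cong (λ a → x∙yz≈y∙xz (𝟙 (A a)) k _) ⟩
    sum (λ a → k * (𝟙 (A a) * bad r A (C ∩ g a)))
      ≡⟨ *-sum k _ ⟨
    k * bad (suc r) A C ∎
    where
    x∙yz≈y∙xz : ∀ x y z → x * (y * z) ≡ y * (x * z)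
    x∙yz≈y∙xz = solve-∀
    ring : ∀ c a e b → c * (a * e * b) ≡ a * (c * e * b)
    ring = solve-∀
    shuffle : ∀ a u → 𝟙 (C u) * (𝟙 (A a ∧ g u a) * bad r (A ∩ g u) (C ∩ g a)) ≡ 𝟙 (A a) * (𝟙 (C u ∧ g a u) * bad r (A ∩ g u) (C ∩ g a))
    shuffle a u rewrite 𝟙-∧ (A a) (g u a) | 𝟙-∧ (C u) (g a u) | g-sym u a = ring (𝟙 (C u)) (𝟙 (A a)) (𝟙 (g a u)) _

  module _ (S : Fin N → Bool) (L d′ : ℕ) (0<S : 0 < count S) (Lk≤s : L * k ≤ count S)
    (dense : count S * count S ≤ 2 * sum (λ a → 𝟙 (S a) * count (S ∩ g a))) where

    private
      s = count S
      d = suc d′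

    rich : Fin N → Bool
    rich a = S a ∧ (s ≤ᵇ 4 * count (S ∩ g a))

    count-rich : s ≤ 4 * count rich
    count-rich = *-cancelʳ-≤ s (4 * count rich) s {{>-nonZero 0<S}} (*-cancelˡ-≤ 2 (linear 0 (begin
      4 * (s * s)                                            ≤⟨ *-monoʳ-≤ 4 dense ⟩
      4 * (2 * sum (λ a → 𝟙 (S a) * count (S ∩ g a)))         ≡⟨ ring (sum (λ a → 𝟙 (S a) * count (S ∩ g a))) ⟩
      2 * (4 * sum (λ a → 𝟙 (S a) * count (S ∩ g a)))         ≤⟨ *-monoʳ-≤ 2 upper ⟩
      2 * (4 * count rich * s + s * s)                        ∎) (ring₂ (count rich) s)))
      where
      ring : ∀ x → 4 * (2 * x) ≡ 2 * (4 * x)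
      ring = solve-∀
      ring₂ : ∀ h s → 2 * (s * s) + 2 * (4 * h * s + s * s) + 0 ≡ 2 * (4 * h * s) + 4 * (s * s)
      ring₂ = solve-∀
      upper : 4 * sum (λ a → 𝟙 (S a) * count (S ∩ g a)) ≤ 4 * count rich * s + s * s
      upper = begin
        4 * sum (λ a → 𝟙 (S a) * count (S ∩ g a))      ≡⟨ *-sum 4 _ ⟩
        sum (λ a → 4 * (𝟙 (S a) * count (S ∩ g a)))    ≤⟨ sum-mono bit ⟩
        sum (λ a → 𝟙 (rich a) * (4 * s) + 𝟙 (S a) * s)  ≡⟨ sum-+ _ _ ⟩
        sum (λ a → 𝟙 (rich a) * (4 * s)) + sum (λ a → 𝟙 (S a) * s)  ≡⟨ cong₂ _+_ (sum-on-const rich (4 * s)) (sum-on-const S s) ⟩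
        count rich * (4 * s) + s * s                   ≡⟨ cong (_+ s * s) (ring₃ (count rich) s) ⟩
        4 * count rich * s + s * s                     ∎
        where
        ring₃ : ∀ h s → h * (4 * s) ≡ 4 * h * s
        ring₃ = solve-∀
        bit : ∀ a → 4 * (𝟙 (S a) * count (S ∩ g a)) ≤ 𝟙 (rich a) * (4 * s) + 𝟙 (S a) * s
        bit a with S a
        ... | false = z≤n
        ... | true with s ≤ᵇ 4 * count (S ∩ g a) in e
        ... | true = ≤-trans (*-monoʳ-≤ 4 (*-monoʳ-≤ 1 (count-mono {q = S} (λ _ → ∧-left)))) (≤-trans (≤-reflexive (ring₄ s)) (m≤m+n _ _))
          where
          ring₄ : ∀ s → 4 * (1 * s) ≡ 1 * (4 * s)
          ring₄ = solve-∀
        ... | false = ≤-trans (≤-reflexive (ring₅ (count (S ∩ g a)))) (≤-trans (<⇒≤ (≤ᵇ-false {s} e)) (≤-reflexive (sym (*-identityˡ s))))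
          where
          ring₅ : ∀ x → 4 * (1 * x) ≡ 4 * x
          ring₅ = solve-∀

    -- Dependent random choice, derandomised: the common neighbourhood A of u₁, …, uᵢ is shrunk one vertex u at a time so that
    -- 8 s^(d−1) 4^i |A| − L^i bad does not decrease; the second term loses a factor L on average, the first only a factor 4.
    drc-step : ∀ i A → A ⊑ rich → L ^ i * bad d A S + s ^ d ≤ 8 * s ^ d′ * 4 ^ i * count A →
      ∃ λ u → S u ≡ true × L ^ suc i * bad d (A ∩ g u) S + s ^ d ≤ 8 * s ^ d′ * 4 ^ suc i * count (A ∩ g u)
    drc-step i A A⊑ inv = averaging S
      (λ u → L ^ suc i * bad d (A ∩ g u) S + s ^ d) (λ u → 8 * s ^ d′ * 4 ^ suc i * count (A ∩ g u)) 0<S average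
      where
      I J : Fin N → ℕ
      I u = count (A ∩ g u)
      J u = bad d (A ∩ g u) S
      P = 8 * s ^ d′ * 4 ^ i
      ring₁ : ∀ x a b c → x * (a * b + c) ≡ a * (x * b) + x * c
      ring₁ = solve-∀
      ring₂ : ∀ l m k b c → l * m * (k * b) + c ≡ l * k * (m * b) + c
      ring₂ = solve-∀
      ring₃ : ∀ x p a → x * (p * a) ≡ p * (a * x)
      ring₃ = solve-∀
      ring₄ : ∀ t f x → 8 * t * f * (4 * x) ≡ 8 * t * (4 * f) * x
      ring₄ = solve-∀
      ring₅ : ∀ c p i → c * (p * i) ≡ p * (c * i)
      ring₅ = solve-∀
      double-count : count A * s ≤ 4 * sum (λ u → 𝟙 (S u) * I u)
      double-count = begin
        count A * s                                              ≡⟨ sum-on-const A s ⟨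
        sum (λ a → 𝟙 (A a) * s)                                  ≤⟨ sum-on-mono A _ _ (λ a Aa → ≤ᵇ-elim (∧-right {S a} (A⊑ a Aa))) ⟩
        sum (λ a → 𝟙 (A a) * (4 * count (S ∩ g a)))              ≡⟨ sum-cong (λ a → trans (x4 (𝟙 (A a)) _) (cong (4 *_) (trans (cong (𝟙 (A a) *_) (count-sum (S ∩ g a))) (*-sum (𝟙 (A a)) _)))) ⟩
        sum (λ a → 4 * sum (λ u → 𝟙 (A a) * 𝟙 (S u ∧ g a u)))    ≡⟨ *-sum 4 _ ⟨
        4 * sum (λ a → sum (λ u → 𝟙 (A a) * 𝟙 (S u ∧ g a u)))    ≡⟨ cong (4 *_) (sum-swap _) ⟩
        4 * sum (λ u → sum (λ a → 𝟙 (A a) * 𝟙 (S u ∧ g a u)))    ≡⟨ cong (4 *_) (sum-cong (λ u → trans (sum-cong (λ a → shuffle a u)) (trans (sym (*-sum (𝟙 (S u)) _)) (cong (𝟙 (S u) *_) (sym (count-sum (A ∩ g u))))))) ⟩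
        4 * sum (λ u → 𝟙 (S u) * I u)                            ∎
        where
        x4 : ∀ a x → a * (4 * x) ≡ 4 * (a * x)
        x4 = solve-∀
        swap : ∀ a c e → a * (c * e) ≡ c * (a * e)
        swap = solve-∀
        shuffle : ∀ a u → 𝟙 (A a) * 𝟙 (S u ∧ g a u) ≡ 𝟙 (S u) * 𝟙 (A a ∧ g u a)
        shuffle a u rewrite 𝟙-∧ (S u) (g a u) | 𝟙-∧ (A a) (g u a) | g-sym u a = swap (𝟙 (A a)) (𝟙 (S u)) (𝟙 (g a u))
      average : sum (λ u → 𝟙 (S u) * (L ^ suc i * J u + s ^ d)) ≤ sum (λ u → 𝟙 (S u) * (8 * s ^ d′ * 4 ^ suc i * I u))
      average = begin
        sum (λ u → 𝟙 (S u) * (L ^ suc i * J u + s ^ d))      ≡⟨ sum-cong (λ u → ring₁ (𝟙 (S u)) (L ^ suc i) (J u) (s ^ d)) ⟩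
        sum (λ u → L ^ suc i * (𝟙 (S u) * J u) + 𝟙 (S u) * s ^ d)  ≡⟨ sum-+ _ _ ⟩
        sum (λ u → L ^ suc i * (𝟙 (S u) * J u)) + sum (λ u → 𝟙 (S u) * s ^ d)  ≡⟨ cong₂ _+_ (sym (*-sum (L ^ suc i) _)) (sum-on-const S (s ^ d)) ⟩
        L ^ suc i * sum (λ u → 𝟙 (S u) * J u) + s * s ^ d    ≤⟨ +-monoˡ-≤ _ (*-monoʳ-≤ (L ^ suc i) (bad-sum d A S)) ⟩
        L ^ suc i * (k * bad d A S) + s * s ^ d              ≡⟨ ring₂ L (L ^ i) k (bad d A S) (s * s ^ d) ⟩
        L * k * (L ^ i * bad d A S) + s * s ^ d              ≤⟨ +-monoˡ-≤ _ (*-monoˡ-≤ (L ^ i * bad d A S) Lk≤s) ⟩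
        s * (L ^ i * bad d A S) + s * s ^ d                  ≡⟨ *-distribˡ-+ s (L ^ i * bad d A S) (s ^ d) ⟨
        s * (L ^ i * bad d A S + s ^ d)                      ≤⟨ *-monoʳ-≤ s inv ⟩
        s * (P * count A)                                    ≡⟨ ring₃ s P (count A) ⟩
        P * (count A * s)                                    ≤⟨ *-monoʳ-≤ P double-count ⟩
        P * (4 * sum (λ u → 𝟙 (S u) * I u))                  ≡⟨ ring₄ (s ^ d′) (4 ^ i) _ ⟩
        8 * s ^ d′ * 4 ^ suc i * sum (λ u → 𝟙 (S u) * I u)   ≡⟨ *-sum (8 * s ^ d′ * 4 ^ suc i) _ ⟩
        sum (λ u → 8 * s ^ d′ * 4 ^ suc i * (𝟙 (S u) * I u)) ≡⟨ sum-cong (λ u → ring₅ (8 * s ^ d′ * 4 ^ suc i) (𝟙 (S u)) (I u)) ⟩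
        sum (λ u → 𝟙 (S u) * (8 * s ^ d′ * 4 ^ suc i * I u)) ∎

    drc : ∀ i → ∃ λ A → A ⊑ rich × L ^ i * bad d A S + s ^ d ≤ 8 * s ^ d′ * 4 ^ i * count A
    drc zero = rich , (λ _ → id) , (begin
      1 * bad d rich S + s ^ d           ≤⟨ +-monoˡ-≤ (s ^ d) (≤-trans (≤-reflexive (*-identityˡ _)) (≤-trans (bad≤ d rich S) (^-monoˡ-≤ d (count-mono {q = S} (λ _ → ∧-left))))) ⟩
      s ^ d + s ^ d                      ≡⟨ ring (s ^ d′) s ⟩
      2 * s ^ d′ * s                     ≤⟨ *-monoʳ-≤ (2 * s ^ d′) count-rich ⟩
      2 * s ^ d′ * (4 * count rich)      ≡⟨ ring₂ (s ^ d′) (count rich) ⟩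
      8 * s ^ d′ * 1 * count rich        ∎)
      where
      ring : ∀ t s → s * t + s * t ≡ 2 * t * s
      ring = solve-∀
      ring₂ : ∀ t h → 2 * t * (4 * h) ≡ 8 * t * 1 * h
      ring₂ = solve-∀
    drc (suc i) = let A , A⊑ , inv = drc i ; u , _ , ineq = drc-step i A A⊑ inv in
      A ∩ g u , (λ a e → A⊑ a (∧-left e)) , ineq

  rich-set : ∀ (S : Fin N → Bool) d′ P L → let d = suc d′ in 0 < k → L * k ≤ count S → 8 * 4 ^ d ≡ P → 2 * d * P < L →
    count S * count S ≤ 2 * sum (λ a → 𝟙 (S a) * count (S ∩ g a)) →
    ∃ λ A → A ⊑ S × 2 * k ≤ count A × bad d A S * (2 * d) ^ d < count A ^ d
  rich-set S d′ P L 0<k Lk≤s P≡ 2dP<L dense = A , (λ a e → ∧-left (A⊑ a e)) , 2k≤α , few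
    where
    d = suc d′
    s = count S
    0<S : 0 < s
    0<S = ≤-trans (*-mono-≤ (≤-trans (s≤s z≤n) 2dP<L) 0<k) Lk≤s
    result = drc S L d′ 0<S Lk≤s dense d
    A = proj₁ result
    A⊑ = proj₁ (proj₂ result)
    α = count A
    regroup : ∀ t f a → 8 * t * f * a ≡ 8 * f * (a * t)
    regroup = solve-∀
    ineq : L ^ d * bad d A S + s ^ d ≤ P * (α * s ^ d′)
    ineq = ≤-trans (proj₂ (proj₂ result)) (≤-reflexive (trans (regroup (s ^ d′) (4 ^ d) α) (cong (_* (α * s ^ d′)) P≡)))
    instance
      s≢0 : NonZero s
      s≢0 = >-nonZero 0<S
      P≢0 : NonZero P
      P≢0 = subst NonZero P≡ (m*n≢0 8 (4 ^ d) {{_}} {{m^n≢0 4 d}})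
      s^d≢0 : NonZero (s ^ d′)
      s^d≢0 = m^n≢0 s d′
    s≤Pα : s ≤ P * α
    s≤Pα = *-cancelʳ-≤ s (P * α) (s ^ d′) (≤-trans (m≤n+m (s ^ d) (L ^ d * bad d A S)) (≤-trans ineq (≤-reflexive (sym (*-assoc P α (s ^ d′))))))
    2k≤α : 2 * k ≤ α
    2k≤α = *-cancelˡ-≤ P (begin
      P * (2 * k)       ≡⟨ ring P k ⟩
      2 * 1 * P * k     ≤⟨ *-monoˡ-≤ k (*-monoˡ-≤ P (*-monoʳ-≤ 2 (s≤s (z≤n {d′})))) ⟩
      2 * d * P * k     ≤⟨ *-monoˡ-≤ k (<⇒≤ 2dP<L) ⟩
      L * k             ≤⟨ Lk≤s ⟩
      s                 ≤⟨ s≤Pα ⟩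
      P * α             ∎)
      where
      ring : ∀ p k → p * (2 * k) ≡ 2 * 1 * p * k
      ring = solve-∀
    0<α : 0 < α
    0<α = ≤-trans 0<k (≤-trans (m≤n*m k 2) 2k≤α)
    few : bad d A S * (2 * d) ^ d < α ^ d
    few = *-cancelˡ-< (L ^ d) _ _ (begin-strict
      L ^ d * (bad d A S * (2 * d) ^ d)              ≡⟨ *-assoc (L ^ d) _ _ ⟨
      L ^ d * bad d A S * (2 * d) ^ d                ≤⟨ *-monoˡ-≤ ((2 * d) ^ d) (≤-trans (m≤m+n (L ^ d * bad d A S) (s ^ d)) ineq) ⟩
      P * (α * s ^ d′) * (2 * d) ^ d                 ≡⟨ cong (_* (2 * d) ^ d) (*-assoc P α (s ^ d′)) ⟨
      P * α * s ^ d′ * (2 * d) ^ d                   ≤⟨ *-monoˡ-≤ ((2 * d) ^ d) (*-monoʳ-≤ (P * α) (^-monoˡ-≤ d′ s≤Pα)) ⟩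
      (P * α) ^ d * (2 * d) ^ d                      ≡⟨ ^-*-distrib (P * α) (2 * d) d ⟨
      (P * α * (2 * d)) ^ d                          ≡⟨ cong (_^ d) (ring P α (2 * d)) ⟩
      (2 * d * P * α) ^ d                            <⟨ ^-monoˡ-< d (*-monoˡ-< α {{>-nonZero 0<α}} 2dP<L) ⟩
      (L * α) ^ d                                    ≡⟨ ^-*-distrib L α d ⟩
      L ^ d * α ^ d                                  ∎)
      where
      ring : ∀ p a c → p * a * c ≡ c * p * a
      ring = solve-∀

  rich-subset : ∀ (S : Fin N → Bool) d P L → 0 < d → 0 < k → L * k ≤ count S → 8 * 4 ^ d ≡ P → 2 * d * P < L →
    count S * count S ≤ 2 * sum (λ a → 𝟙 (S a) * count (S ∩ g a)) →
    ∃ λ A → A ⊑ S × 2 * k ≤ count A × bad d A S * (2 * d) ^ d < count A ^ d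
  rich-subset S (suc d′) P L _ = rich-set S d′ P L

ramsey-constant : ∀ d → 0 < d → 2 * d * (8 * 4 ^ d) < 2 ^ (d * 8)
ramsey-constant d 0<d = begin-strict
  2 * d * (8 * 4 ^ d)                        <⟨ *-monoˡ-< (8 * 4 ^ d) {{m*n≢0 8 (4 ^ d) {{_}} {{m^n≢0 4 d}}}} (*-monoʳ-< 2 (n<2^n d)) ⟩
  2 * 2 ^ d * (8 * 4 ^ d)                    ≡⟨ cong (λ x → 2 * 2 ^ d * (8 * x)) (^-*-assoc 2 2 d) ⟩
  2 * 2 ^ d * (8 * 2 ^ (2 * d))              ≡⟨ ring (2 ^ d) (2 ^ (2 * d)) ⟩
  2 ^ d * 2 ^ (2 * d) * 2 ^ 4                ≡⟨ cong (_* 2 ^ 4) (^-distribˡ-+-* 2 d (2 * d)) ⟨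
  2 ^ (d + 2 * d) * 2 ^ 4                    ≡⟨ ^-distribˡ-+-* 2 (d + 2 * d) 4 ⟨
  2 ^ (d + 2 * d + 4)                        ≤⟨ 2^-mono {d + 2 * d + 4} {d * 8} (linear d (*-monoʳ-≤ 4 0<d) (ring₂ d)) ⟩
  2 ^ (d * 8)                                ∎
  where
  ring : ∀ x y → 2 * x * (8 * y) ≡ x * y * 16
  ring = solve-∀
  ring₂ : ∀ d → d + 2 * d + 4 + 4 * d + d ≡ d * 8 + 4 * 1
  ring₂ = solve-∀

module Ramsey (F : GraphSeq) (bip : BipartiteSeq F) (d : ℕ) (0<d : 0 < d) (deg : ∀ k y → count (adj (F k) y) ≤ d)
  (L : ℕ) (L-large : 2 * d * (8 * 4 ^ d) < L) {N : ℕ} (c : TwoColoring N) where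

  open Covers F c

  module _ (b : Bool) (k′ : ℕ) (S A : Fin N → Bool) (A⊑S : A ⊑ S) where

    private
      k = suc k′
      G = F k′
      g = edge b
      α = count A

    open DependentChoice g (edge-sym b) k
    open Candidates G g
    open PartialEmbedding

    Good : ℕ → (Fin N → Bool) → Set
    Good r C = bad r A C * (2 * d) ^ r < α ^ r

    Promising : PartialMap → Set
    Promising ρ = ∀ y → Good (d ∸ placed ρ y) (S ∩ cand ρ y)

    good-mono : ∀ r {C C′} → C ⊑ C′ → Good r C → Good r C′
    good-mono r {C} {C′} h q = ≤-trans (s≤s (*-monoˡ-≤ ((2 * d) ^ r) (bad-antitone r A h))) q

    good-size : ∀ r C → Good r C → k ≤ count C
    good-size r C q = ≮⇒≥ λ lt → <-irrefl refl (begin-strict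
      α ^ r                        ≤⟨ bad-all r A C lt ⟩
      bad r A C                    ≤⟨ m≤m*n (bad r A C) ((2 * d) ^ r) {{m^n≢0 (2 * d) r {{>-nonZero (*-mono-< {0} {2} {0} {d} (s≤s z≤n) 0<d)}}}} ⟩
      bad r A C * (2 * d) ^ r      <⟨ q ⟩
      α ^ r                        ∎)

    spoils : PartialMap → Fin (suc k′) → Fin (suc k′) → Fin N → Bool
    spoils ρ x y a = A a ∧ (adj G x y ∧ (α ^ (d ∸ suc (placed ρ y)) ≤ᵇ bad (d ∸ suc (placed ρ y)) A ((S ∩ cand ρ y) ∩ g a) * (2 * d) ^ (d ∸ suc (placed ρ y))))

    module _ (ρ : PartialMap) (x y : Fin (suc k′)) (none : ρ x ≡ nothing) (inv : Promising ρ) where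

      private
        r = d ∸ suc (placed ρ y)
        C = S ∩ cand ρ y
        V = spoils ρ x y

      count-spoils : adj G x y ≡ true → count V * (2 * d) ≤ α
      count-spoils e = <⇒≤ (*-cancelʳ-< (α ^ r) _ α (begin-strict
        count V * (2 * d) * α ^ r          ≡⟨ ring₁ (count V) (2 * d) (α ^ r) ⟩
        count V * α ^ r * (2 * d)          ≤⟨ *-monoˡ-≤ (2 * d) (markov V (λ a → 𝟙 (A a) * bad r A (C ∩ g a) * (2 * d) ^ r) (α ^ r) bound) ⟩
        sum (λ a → 𝟙 (A a) * bad r A (C ∩ g a) * (2 * d) ^ r) * (2 * d)  ≡⟨ cong (_* (2 * d)) (sum-* ((2 * d) ^ r) (λ a → 𝟙 (A a) * bad r A (C ∩ g a))) ⟨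
        bad (suc r) A C * (2 * d) ^ r * (2 * d)  ≡⟨ ring₂ (bad (suc r) A C) ((2 * d) ^ r) (2 * d) ⟩
        bad (suc r) A C * (2 * d) ^ suc r  <⟨ subst (λ t → Good t C) (sym r+1) (inv y) ⟩
        α * α ^ r                          ∎))
        where
        r+1 : suc r ≡ d ∸ placed ρ y
        r+1 = sym (+-∸-assoc 1 {d} {suc (placed ρ y)} (≤-trans (placed< ρ x y none (trans (adj-sym G y x) e)) (deg k′ y)))
        ring₁ : ∀ v d a → v * d * a ≡ v * a * d
        ring₁ = solve-∀
        ring₂ : ∀ v a d → v * a * d ≡ v * (d * a)
        ring₂ = solve-∀
        bit : ∀ {b} x z → b ≡ true → x * z ≡ 𝟙 b * x * z
        bit x z refl = cong (_* z) (sym (*-identityˡ x))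
        bound : ∀ a → V a ≡ true → α ^ r ≤ 𝟙 (A a) * bad r A (C ∩ g a) * (2 * d) ^ r
        bound a q = ≤-trans (≤ᵇ-elim {α ^ r} (∧-right {adj G x y} (∧-right {A a} q))) (≤-reflexive (bit {A a} (bad r A (C ∩ g a)) ((2 * d) ^ r) (∧-left q)))

      count-spoils-all : count V * (2 * d) ≤ 𝟙 (adj G x y) * α
      count-spoils-all = case bool-dec (adj G x y) of λ
        { (inj₁ e) → ≤-trans (count-spoils e) (≤-reflexive (trans (sym (*-identityˡ α)) (cong (λ b → 𝟙 b * α) (sym e))))
        ; (inj₂ e) → ≤-trans (≤-reflexive (cong (_* (2 * d)) (count-none (λ a → ¬true⇒false (λ q → true≢false (∧-left (∧-right {A a} q)) e))))) z≤n }

      promising-step : ∀ a → A a ≡ true → V a ≡ false → Good (d ∸ placed (ρ [ x ≔ a ]) y) (S ∩ cand (ρ [ x ≔ a ]) y)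
      promising-step a Aa unspoilt = case bool-dec (adj G y x) of λ
        { (inj₂ e) → subst (λ t → Good (d ∸ t) (S ∩ cand (ρ [ x ≔ a ]) y))
            (sym (trans (placed-update ρ x a y none) (trans (cong (λ b → placed ρ y + 𝟙 b) e) (+-identityʳ _))))
            (good-mono (d ∸ placed ρ y) (λ v q → ∧-intro (∧-left q) (trans (cand-non-neighbour ρ x a y v none e) (∧-right {S v} q))) (inv y))
        ; (inj₁ e) → subst (λ t → Good (d ∸ t) (S ∩ cand (ρ [ x ≔ a ]) y))
            (sym (trans (placed-update ρ x a y none) (trans (cong (λ b → placed ρ y + 𝟙 b) e) (+-comm _ 1))))
            (good-mono r (λ v q → ∧-intro (∧-left (∧-left q)) (trans (cand-neighbour ρ x a y v none e) (∧-intro (∧-right {S v} (∧-left q)) (∧-right {S v ∧ cand ρ y v} q))))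
              (≰⇒> λ le → true≢false (∧-intro Aa (∧-intro (trans (adj-sym G x y) e) (≤ᵇ-true le))) unspoilt)) }

    extend : ∀ (X : Fin (suc k′) → Bool) → 2 * k ≤ α → ∀ ρ x → PartialEmbedding X A ρ → Promising ρ → X x ≡ true → ρ x ≡ nothing →
      ∃ λ a → A a ≡ true × image ρ a ≡ false × Promising (ρ [ x ≔ a ])
    extend X room ρ x pe inv Xx none = a , Aa , not-elim-∨ˡ , inv′
      where
      spoilt : Fin N → Bool
      spoilt a = anyB (λ y → spoils ρ x y a)
      few : 2 * count spoilt ≤ α
      few = *-cancelʳ-≤ _ α d {{>-nonZero 0<d}} (begin
        2 * count spoilt * d                             ≡⟨ ring (count spoilt) d ⟩
        count spoilt * (2 * d)                           ≤⟨ *-monoˡ-≤ (2 * d) (count-anyB (spoils ρ x)) ⟩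
        sum (λ y → count (spoils ρ x y)) * (2 * d)       ≡⟨ sum-* (2 * d) _ ⟩
        sum (λ y → count (spoils ρ x y) * (2 * d))       ≤⟨ sum-mono (λ y → count-spoils-all ρ x y none inv) ⟩
        sum (λ y → 𝟙 (adj G x y) * α)                    ≡⟨ sum-on-const (adj G x) α ⟩
        count (adj G x) * α                              ≤⟨ *-monoˡ-≤ α (deg k′ x) ⟩
        d * α                                            ≡⟨ *-comm d α ⟩
        α * d                                            ∎)
        where
        ring : ∀ s d → 2 * s * d ≡ s * (2 * d)
        ring = solve-∀
      used : suc (count (image ρ)) ≤ k
      used = begin
        suc (count (image ρ))            ≤⟨ s≤s (count-image≤dom ρ) ⟩
        1 + count (dom ρ)                ≡⟨ cong (_+ count (dom ρ)) (count-≟ x) ⟨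
        count ⁅ x ⁆ + count (dom ρ)      ≤⟨ count-disjoint ⁅ x ⁆ (dom ρ) (λ _ → true) (λ _ _ → refl) (λ _ _ → refl) sep ⟩
        count (λ _ → true)               ≡⟨ count-true k ⟩
        k                                ∎
        where
        sep : Disjoint ⁅ x ⁆ (dom ρ)
        sep z q f with does-elim (x ≟ z) q
        ... | refl = true≢false f (nothing-dom {ρ = ρ} none)
      fresh : ∃ λ a → A a ≡ true × (image ρ ∪ spoilt) a ≡ false
      fresh = pick-∖ A (image ρ ∪ spoilt) (*-cancelˡ-< 2 _ _ (begin-strict
        2 * count (image ρ ∪ spoilt)                 ≤⟨ *-monoʳ-≤ 2 (count-∪ (image ρ) spoilt) ⟩
        2 * (count (image ρ) + count spoilt)         ≡⟨ *-distribˡ-+ 2 (count (image ρ)) (count spoilt) ⟩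
        2 * count (image ρ) + 2 * count spoilt       <⟨ +-mono-<-≤ (*-monoʳ-< 2 used) few ⟩
        2 * k + α                                    ≤⟨ +-monoˡ-≤ α room ⟩
        α + α                                        ≡⟨ cong (α +_) (+-identityʳ α) ⟨
        2 * α                                        ∎))
      a = proj₁ fresh
      Aa = proj₁ (proj₂ fresh)
      not-elim-∨ˡ : image ρ a ≡ false
      not-elim-∨ˡ = ¬true⇒false λ q → true≢false (∨-introˡ q) (proj₂ (proj₂ fresh))
      unspoilt : ∀ y → spoils ρ x y a ≡ false
      unspoilt = anyB-false (¬true⇒false λ q → true≢false (∨-introʳ {image ρ a} q) (proj₂ (proj₂ fresh)))
      inv′ : Promising (ρ [ x ≔ a ])
      inv′ y = promising-step ρ x y none inv a Aa (unspoilt y)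

    nowhere : PartialMap {k} {N}
    nowhere _ = nothing

    promising-nowhere : bad d A S * (2 * d) ^ d < α ^ d → Promising nowhere
    promising-nowhere few y = subst (λ t → Good (d ∸ t) (S ∩ cand nowhere y))
      (sym (count-none {p = adj G y ∩ dom nowhere} (λ x → ¬true⇒false (λ q → true≢false (∧-right {adj G y x} q) refl))))
      (good-mono d (λ v q → ∧-intro q (cand-intro {nowhere} {y} {v} (λ _ _ _ ()))) few)

    complete : ∀ X ρ → dom ρ ⊑ X → Promising ρ → Matching (not ∘ X) (S ∖ image ρ) (cand ρ)
    complete X ρ dom⊑X inv = hall-greedy (not ∘ X) (S ∖ image ρ) (cand ρ) λ y _ → +-cancelˡ-≤ (count X) _ _ (begin
        count X + count (not ∘ X)                                     ≡⟨ count-not X ⟩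
        k                                                             ≤⟨ good-size (d ∸ placed ρ y) (S ∩ cand ρ y) (inv y) ⟩
        count (S ∩ cand ρ y)                                          ≤⟨ count-⊎ (image ρ) ((S ∖ image ρ) ∩ cand ρ y) (S ∩ cand ρ y) (split y) ⟩
        count (image ρ) + count ((S ∖ image ρ) ∩ cand ρ y)            ≤⟨ +-monoˡ-≤ _ (≤-trans (count-image≤dom ρ) (count-mono dom⊑X)) ⟩
        count X + count ((S ∖ image ρ) ∩ cand ρ y)                    ∎)
      where
      split : ∀ y v → (S ∩ cand ρ y) v ≡ true → image ρ v ≡ true ⊎ ((S ∖ image ρ) ∩ cand ρ y) v ≡ true
      split y v q = case bool-dec (image ρ v) of λ
        { (inj₁ i) → inj₁ i
        ; (inj₂ i) → inj₂ (∧-intro (∧-intro (∧-left q) (not-intro i)) (∧-right {S v} q)) }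

    embed : 2 * k ≤ α → bad d A S * (2 * d) ^ d < α ^ d → Copy k S
    embed room few =
      let X , bip-X = bip k′
          ρ , pe , inv , full = extend-to X {X} {A} Promising (λ _ → id) (extend X room) nowhere empty-embedding (promising-nowhere few)
      in bipartite-copy b X bip-X {U = A} {W = S ∖ image ρ} {Z = S} ρ pe full A⊑S (λ _ → ∧-left)
          (λ {x} {v} e q → image-nothing {ρ = ρ} (not-elim (∧-right {S v} q)) e) (complete X ρ (dom⊑ pe) inv)

  pairs : (Fin N → Bool) → Bool → ℕ
  pairs S b = sum (λ a → 𝟙 (S a) * count (S ∩ edge b a))

  edge-not : ∀ b u v → edge (not b) u v ≡ not (edge b u v)
  edge-not b u v with col c u v | b
  ... | true  | true  = refl
  ... | true  | false = refl
  ... | false | true  = refl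
  ... | false | false = refl

  count-edge-not : ∀ (S : Fin N → Bool) b u → count (S ∩ edge b u) + count (S ∩ edge (not b) u) ≡ count S
  count-edge-not S b u = sym (trans (count-split S (edge b u)) (cong (count (S ∩ edge b u) +_) (count-cong λ v → cong (S v ∧_) (sym (edge-not b u v)))))

  majority : ∀ S → ∃ λ b → count S * count S ≤ 2 * pairs S b
  majority S = case ≤-total (pairs S true) (pairs S false) of λ
    { (inj₁ h) → false , ≤-trans (≤-reflexive (sym both)) (≤-trans (+-monoˡ-≤ _ h) (≤-reflexive (cong (pairs S false +_) (sym (+-identityʳ _)))))
    ; (inj₂ h) → true , ≤-trans (≤-reflexive (sym both)) (≤-trans (+-monoʳ-≤ _ h) (≤-reflexive (cong (pairs S true +_) (sym (+-identityʳ _))))) }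
    where
    both : pairs S true + pairs S false ≡ count S * count S
    both = begin-equality
      pairs S true + pairs S false                                                          ≡⟨ sum-+ _ _ ⟨
      sum (λ a → 𝟙 (S a) * count (S ∩ edge true a) + 𝟙 (S a) * count (S ∩ edge false a))    ≡⟨ sum-cong (λ a → trans (sym (*-distribˡ-+ (𝟙 (S a)) _ _)) (cong (𝟙 (S a) *_) (count-edge-not S true a))) ⟩
      sum (λ a → 𝟙 (S a) * count S)                                                         ≡⟨ sum-on-const S (count S) ⟩
      count S * count S                                                                     ∎

  ramsey : ∀ k → 0 < k → ∀ S → L * k ≤ count S → Copy k S
  ramsey (suc k′) 0<k S large with majority S
  ... | b , dense with DependentChoice.rich-subset (edge b) (edge-sym b) (suc k′) S d _ L 0<d 0<k large refl L-large dense
  ... | A , A⊑S , room , few = embed b k′ S A A⊑S room few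

-- Greedy covering

quotient : ∀ m x → 0 < m → m ≤ x → ∃ λ k → 0 < k × k * m ≤ x × x < suc k * m
quotient m@(suc _) x _ m≤x = x / m , pos , ≤-trans (m≤n+m _ _) (≤-reflexive (sym (m≡m%n+[m/n]*n x m))) , below
  where
  below : x < suc (x / m) * m
  below = ≤-trans (s≤s (≤-reflexive (m≡m%n+[m/n]*n x m))) (+-monoˡ-≤ (x / m * m) (m%n<n x m))
  pos : 0 < x / m
  pos with x / m in e
  ... | suc _ = s≤s z≤n
  ... | zero  = ⊥-elim (<⇒≱ below (≤-trans (≤-reflexive (trans (cong (λ k → suc k * m) e) (*-identityˡ m))) m≤x))

module Removals (F : GraphSeq) {N : ℕ} (c : TwoColoring N) where

  open Covers F c

  record Removal (M : ℕ) (R E : Fin N → Bool) : Set where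
    field
      removed⊑ : E ⊑ R
      restore  : ∀ {Z m} → R ⊑ Z → Cover m (Z ∖ E) → Cover (M + m) Z

  open Removal public

  remove-copy : ∀ {k R} (P : Copy k R) → Removal 1 R (vertices P)
  remove-copy P = record { removed⊑ = vertices⊑ P ; restore = λ h C → cover-add (copy-weaken h P) C }

  remove-nothing : ∀ {R} → Removal 0 R (λ _ → false)
  remove-nothing = record { removed⊑ = λ _ () ; restore = λ _ → cover-resp (λ _ → ∧-left) (λ _ e → ∧-intro e refl) }

  removal-weaken : ∀ {M R R′ E} → R ⊑ R′ → Removal M R E → Removal M R′ E
  removal-weaken h r = record { removed⊑ = λ v e → h v (removed⊑ r v e) ; restore = λ h′ → restore r (λ v e → h′ v (h v e)) }

  removal-more : ∀ {M M′ R E} → M ≤ M′ → Removal M R E → Removal M′ R E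
  removal-more h r = record { removed⊑ = removed⊑ r ; restore = λ {Z} {m} h′ C → cover-weaken (+-monoˡ-≤ m h) (restore r h′ C) }

  remove-both : ∀ {M M′ R E E′} → Removal M R E → Removal M′ (R ∖ E) E′ → Removal (M + M′) R (E ∪ E′)
  remove-both {M} {M′} {R} {E} {E′} r r′ = record
    { removed⊑ = λ v e → [ removed⊑ r v , ∧-left ∘ removed⊑ r′ v ]′ (∨-elim e)
    ; restore = λ {Z} {m} h C → cover-weaken (≤-reflexive (sym (+-assoc M M′ m)))
        (restore r h (restore r′ (λ v e → ∧-intro (h v (∧-left e)) (∧-right {R v} e))
          (cover-resp (split {Z}) (join {Z}) C))) }
    where
    split : ∀ {Z} → (Z ∖ (E ∪ E′)) ⊑ ((Z ∖ E) ∖ E′)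
    split {Z} v e with Z v | E v | E′ v
    ... | true | false | false = refl
    join : ∀ {Z} → ((Z ∖ E) ∖ E′) ⊑ (Z ∖ (E ∪ E′))
    join {Z} v e with Z v | E v | E′ v
    ... | true | false | false = refl

  count-∖-∪ : ∀ (R E E′ : Fin N → Bool) → count (R ∖ (E ∪ E′)) ≡ count ((R ∖ E) ∖ E′)
  count-∖-∪ R E E′ = count-cong λ v → bit (R v) (E v) (E′ v)
    where
    bit : ∀ r e e′ → r ∧ not (e ∨ e′) ≡ (r ∧ not e) ∧ not e′
    bit false _     _ = refl
    bit true  false _ = refl
    bit true  true  _ = refl

  remove-singles : ∀ k R → count R ≤ k → Removal k R R
  remove-singles k R h with bool-dec (anyB R)
  ... | inj₂ e = record { removed⊑ = λ _ → id ; restore = λ {Z} {m} _ C → cover-weaken (m≤n+m m k) (cover-resp (λ _ → ∧-left) (λ v q → ∧-intro q (not-intro (anyB-false e v))) C) }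
  remove-singles zero R h | inj₁ e = ⊥-elim (true≢false (proj₂ (anyB-elim e)) (count-zero h _))
  remove-singles (suc k) R h | inj₁ e = record
    { removed⊑ = λ _ → id
    ; restore = λ h′ C → restore both h′ (cover-resp (λ v q → ∧-intro (∧-left q) (not-intro (¬true⇒false (λ q′ → true≢false (into v q′) (not-elim (∧-right {_ } q))))))
        (λ v q → ∧-intro (∧-left q) (not-intro (¬true⇒false λ q′ → true≢false (out v q′) (not-elim (∧-right {_} q))))) C) }
    where
    P = single-copy {R} (proj₂ (anyB-elim e))
    rest = remove-singles k (R ∖ vertices P) (≤-pred (≤-trans (≤-reflexive (sym (count-rest P R (λ _ → id)))) h))
    both = remove-both (remove-copy P) rest
    into : (vertices P ∪ (R ∖ vertices P)) ⊑ R
    into v q = [ vertices⊑ P v , ∧-left ]′ (∨-elim q)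
    out : R ⊑ (vertices P ∪ (R ∖ vertices P))
    out v q = [ ∨-introˡ , (λ f → ∨-introʳ {vertices P v} (∧-intro q (not-intro f))) ]′ (bool-dec (vertices P v))

module Shrinking (F : GraphSeq) (bip : BipartiteSeq F) (d : ℕ) (0<d : 0 < d) (deg : ∀ k y → count (adj (F k) y) ≤ d)
  (L : ℕ) (L-large : 2 * d * (8 * 4 ^ d) < L) {N : ℕ} (c : TwoColoring N) where

  open Covers F c
  open Removals F c
  open Ramsey F bip d 0<d deg L L-large c using (ramsey)

  private
    0<L : 0 < L
    0<L = ≤-trans (s≤s z≤n) L-large

  remove-fixed : ∀ R k → 0 < k → L * k * 2 ≤ count R → ∀ i →
    ∃ λ E → Removal i R E × (2 * count (R ∖ E) ≤ count R ⊎ i * k + count (R ∖ E) ≤ count R)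
  remove-fixed R k 0<k room zero = (λ _ → false) , remove-nothing , inj₂ (count-mono {p = R ∖ (λ _ → false)} {q = R} (λ _ → ∧-left))
  remove-fixed R k 0<k room (suc i) with remove-fixed R k 0<k room i
  ... | E , rem , inj₁ h = E , removal-more (n≤1+n i) rem , inj₁ h
  ... | E , rem , inj₂ h with 2 * count (R ∖ E) ≤? count R
  ... | yes small = E , removal-more (n≤1+n i) rem , inj₁ small
  ... | no large = E ∪ vertices P , removal-more (≤-reflexive (+-comm i 1)) (remove-both rem (remove-copy P)) , inj₂ (begin
      suc i * k + count (R ∖ (E ∪ vertices P))       ≡⟨ cong (suc i * k +_) (count-∖-∪ R E (vertices P)) ⟩
      k + i * k + count ((R ∖ E) ∖ vertices P)       ≡⟨ ring₁ k (i * k) _ ⟩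
      i * k + (k + count ((R ∖ E) ∖ vertices P))     ≡⟨ cong (i * k +_) (count-rest P (R ∖ E) (λ _ → id)) ⟨
      i * k + count (R ∖ E)                          ≤⟨ h ⟩
      count R                                        ∎)
    where
    ring₁ : ∀ a b c → a + b + c ≡ b + (a + c)
    ring₁ = solve-∀
    P : Copy k (R ∖ E)
    P = ramsey k 0<k (R ∖ E) (*-cancelˡ-≤ 2 (≤-trans (≤-reflexive (*-comm 2 (L * k))) (≤-trans room (<⇒≤ (≰⇒> large)))))

  halve : ∀ R → ∃ λ E → Removal (2 * L) R E × 2 * count (R ∖ E) ≤ count R
  halve R with 2 * L ≤? count R
  ... | no small = R , remove-singles (2 * L) R (<⇒≤ (≰⇒> small)) , ≤-trans (≤-reflexive (cong (2 *_) (count-none λ v → bit (R v)))) z≤n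
    where
    bit : ∀ b → b ∧ not b ≡ false
    bit true  = refl
    bit false = refl
  ... | yes large with quotient (2 * L) (count R) (*-mono-< {0} {2} {0} {L} (s≤s z≤n) 0<L) large
  ... | k , 0<k , k2L≤r , r<2Lk′ with remove-fixed R k 0<k (≤-trans (≤-reflexive (ring L k)) k2L≤r) (2 * L)
    where
    ring : ∀ l k → l * k * 2 ≡ k * (2 * l)
    ring = solve-∀
  ... | E , rem , inj₁ h = E , rem , h
  ... | E , rem , inj₂ h = E , rem , linear 0
      (+-mono-≤ (+-mono-≤ h h) (≤-trans (<⇒≤ r<2Lk′) (+-monoˡ-≤ _ (≤-trans (≤-reflexive (sym (*-identityˡ _))) (*-monoˡ-≤ (2 * L) 0<k)))))
      (ring₂ (count R) (2 * L) k (count (R ∖ E)))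
    where
    ring₂ : ∀ r l k x → 2 * x + (r + r + (k * l + k * l)) + 0 ≡ r + (l * k + x + (l * k + x) + r)
    ring₂ = solve-∀

  shrink : ∀ j R → ∃ λ E → Removal (j * (2 * L)) R E × 2 ^ j * count (R ∖ E) ≤ count R
  shrink zero R = (λ _ → false) , remove-nothing , ≤-trans (≤-reflexive (*-identityˡ _)) (count-mono {q = R} (λ _ → ∧-left))
  shrink (suc j) R with halve R
  ... | E , rem , h with shrink j (R ∖ E)
  ... | E′ , rem′ , h′ = E ∪ E′ , remove-both rem rem′ , (begin
    2 * 2 ^ j * count (R ∖ (E ∪ E′))       ≡⟨ cong (2 * 2 ^ j *_) (count-∖-∪ R E E′) ⟩
    2 * 2 ^ j * count ((R ∖ E) ∖ E′)       ≡⟨ *-assoc 2 (2 ^ j) _ ⟩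
    2 * (2 ^ j * count ((R ∖ E) ∖ E′))     ≤⟨ *-monoʳ-≤ 2 h′ ⟩
    2 * count (R ∖ E)                      ≤⟨ h ⟩
    count R                                ∎)

  cover-small : ∀ j Z → count Z < 2 ^ j → Cover (j * (2 * L)) Z
  cover-small j Z h with shrink j Z
  ... | E , rem , h′ = cover-weaken (≤-reflexive (+-identityʳ _)) (restore rem (λ _ → id) (cover-empty (count-zero
    (≤-pred (*-cancelˡ-< (2 ^ j) _ 1 (≤-trans (s≤s h′) (≤-trans h (≤-reflexive (sym (*-identityʳ _))))))))))

-- Exponential estimates and weighted sums

bernoulli-upper : ∀ m k r → k + r ≡ suc m → suc m ^ k * r ≤ m ^ k * suc m
bernoulli-upper m zero    r e = ≤-reflexive (cong (1 *_) e)
bernoulli-upper m (suc k) r e = begin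
  suc m * suc m ^ k * r          ≡⟨ ring₁ m (suc m ^ k) r ⟩
  suc m ^ k * (m * r + r)        ≤⟨ *-monoʳ-≤ (suc m ^ k) (+-monoʳ-≤ (m * r) r≤m) ⟩
  suc m ^ k * (m * r + m)        ≡⟨ ring₂ m (suc m ^ k) r ⟩
  m * (suc m ^ k * suc r)        ≤⟨ *-monoʳ-≤ m (bernoulli-upper m k (suc r) (trans (+-suc k r) e)) ⟩
  m * (m ^ k * suc m)            ≡⟨ *-assoc m (m ^ k) (suc m) ⟨
  m ^ suc k * suc m              ∎
  where
  r≤m : r ≤ m
  r≤m = ≤-trans (m≤n+m r k) (≤-reflexive (suc-injective e))
  ring₁ : ∀ m p r → (1 + m) * p * r ≡ p * (m * r + r)
  ring₁ = solve-∀
  ring₂ : ∀ m p r → p * (m * r + m) ≡ m * (p * (1 + r))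
  ring₂ = solve-∀

bernoulli-lower : ∀ m k → m ^ k * (m + k) ≤ m * suc m ^ k
bernoulli-lower m zero    = ≤-reflexive (trans (*-identityˡ _) (trans (+-identityʳ m) (sym (*-identityʳ m))))
bernoulli-lower m (suc k) = begin
  m * m ^ k * (m + suc k)                 ≡⟨ ring₁ m (m ^ k) k ⟩
  m * (m ^ k * (m + k)) + m * m ^ k       ≤⟨ +-mono-≤ (*-monoʳ-≤ m (bernoulli-lower m k)) (*-monoʳ-≤ m (^-monoˡ-≤ k (n≤1+n m))) ⟩
  m * (m * suc m ^ k) + m * suc m ^ k     ≡⟨ ring₂ m (suc m ^ k) ⟩
  m * (suc m * suc m ^ k)                 ∎
  where
  ring₁ : ∀ m p k → m * p * (m + (1 + k)) ≡ m * (p * (m + k)) + m * p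
  ring₁ = solve-∀
  ring₂ : ∀ m p → m * (m * p) + m * p ≡ m * ((1 + m) * p)
  ring₂ = solve-∀

growth-base : ∀ h → suc (2 * h) ^ h ≤ 2 * (2 * h) ^ h
growth-base h = *-cancelʳ-≤ _ _ (suc h) (begin
  suc (2 * h) ^ h * suc h           ≤⟨ bernoulli-upper (2 * h) h (suc h) (ring₁ h) ⟩
  (2 * h) ^ h * suc (2 * h)         ≤⟨ *-monoʳ-≤ ((2 * h) ^ h) (n≤1+n _) ⟩
  (2 * h) ^ h * suc (suc (2 * h))   ≡⟨ ring₂ ((2 * h) ^ h) h ⟩
  2 * (2 * h) ^ h * suc h           ∎)
  where
  ring₁ : ∀ h → h + (1 + h) ≡ 1 + 2 * h
  ring₁ = solve-∀
  ring₂ : ∀ p h → p * (2 + 2 * h) ≡ 2 * p * (1 + h)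
  ring₂ = solve-∀

growth : ∀ h τ c → 0 < h → c ≤ τ * h → suc (2 * h) ^ c ≤ 2 ^ τ * (2 * h) ^ c
growth h τ c 0<h c≤τh = *-cancelʳ-≤ _ _ (J ^ r) {{m^n≢0 J r {{>-nonZero (*-mono-< {0} {2} {0} {h} (s≤s z≤n) 0<h)}}}} (begin
  suc J ^ c * J ^ r              ≤⟨ *-monoʳ-≤ (suc J ^ c) (^-monoˡ-≤ r (n≤1+n J)) ⟩
  suc J ^ c * suc J ^ r          ≡⟨ ^-distribˡ-+-* (suc J) c r ⟨
  suc J ^ (c + r)                ≡⟨ cong (suc J ^_) (trans e (*-comm τ h)) ⟩
  suc J ^ (h * τ)                ≡⟨ ^-*-assoc (suc J) h τ ⟨
  (suc J ^ h) ^ τ                ≤⟨ ^-monoˡ-≤ τ (growth-base h) ⟩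
  (2 * J ^ h) ^ τ                ≡⟨ ^-*-distrib 2 (J ^ h) τ ⟩
  2 ^ τ * (J ^ h) ^ τ            ≡⟨ cong (2 ^ τ *_) (^-*-assoc J h τ) ⟩
  2 ^ τ * J ^ (h * τ)            ≡⟨ cong (λ x → 2 ^ τ * J ^ x) (trans (*-comm h τ) (sym e)) ⟩
  2 ^ τ * J ^ (c + r)            ≡⟨ cong (2 ^ τ *_) (^-distribˡ-+-* J c r) ⟩
  2 ^ τ * (J ^ c * J ^ r)        ≡⟨ *-assoc (2 ^ τ) (J ^ c) (J ^ r) ⟨
  2 ^ τ * J ^ c * J ^ r          ∎)
  where
  J = 2 * h
  r = τ * h ∸ c
  e : c + r ≡ τ * h
  e = m+[n∸m]≡n c≤τh

decay : ∀ q y → q ^ (suc q * y) * 2 ^ y ≤ suc q ^ (suc q * y)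
decay q y = begin
  q ^ (suc q * y) * 2 ^ y        ≡⟨ cong (_* 2 ^ y) (^-*-assoc q (suc q) y) ⟨
  (q ^ suc q) ^ y * 2 ^ y        ≡⟨ ^-*-distrib (q ^ suc q) 2 y ⟨
  (q ^ suc q * 2) ^ y            ≤⟨ ^-monoˡ-≤ y (base q) ⟩
  (suc q ^ suc q) ^ y            ≡⟨ ^-*-assoc (suc q) (suc q) y ⟩
  suc q ^ (suc q * y)            ∎
  where
  ring : ∀ p q → q * (p * 2) ≡ p * (q + q)
  ring = solve-∀
  base : ∀ q → q ^ suc q * 2 ≤ suc q ^ suc q
  base zero      = z≤n
  base q@(suc _) = *-cancelˡ-≤ q (begin
    q * (q ^ suc q * 2)        ≡⟨ ring (q ^ suc q) q ⟩
    q ^ suc q * (q + q)        ≤⟨ *-monoʳ-≤ (q ^ suc q) (+-monoʳ-≤ q (n≤1+n q)) ⟩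
    q ^ suc q * (q + suc q)    ≤⟨ bernoulli-lower q (suc q) ⟩
    q * suc q ^ suc q          ∎)

opaque
  sum-sets : ∀ n → (Vec Bool n → ℕ) → ℕ
  sum-sets zero    f = f []
  sum-sets (suc n) f = sum-sets n (f ∘ (true ∷_)) + sum-sets n (f ∘ (false ∷_))

  sum-sets-mono : ∀ n {f g : Vec Bool n → ℕ} → (∀ T → f T ≤ g T) → sum-sets n f ≤ sum-sets n g
  sum-sets-mono zero    h = h []
  sum-sets-mono (suc n) h = +-mono-≤ (sum-sets-mono n (h ∘ (true ∷_))) (sum-sets-mono n (h ∘ (false ∷_)))

  *-sum-sets : ∀ n c (f : Vec Bool n → ℕ) → c * sum-sets n f ≡ sum-sets n (λ T → c * f T)
  *-sum-sets zero    c f = refl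
  *-sum-sets (suc n) c f = trans (*-distribˡ-+ c _ _) (cong₂ _+_ (*-sum-sets n c _) (*-sum-sets n c _))

  sum-sum-sets : ∀ {m} n (f : Fin m → Vec Bool n → ℕ) → sum (λ a → sum-sets n (f a)) ≡ sum-sets n (λ T → sum (λ a → f a T))
  sum-sum-sets zero    f = refl
  sum-sum-sets (suc n) f = trans (sum-+ _ _) (cong₂ _+_ (sum-sum-sets n _) (sum-sum-sets n _))

  term≤sum-sets : ∀ n (f : Vec Bool n → ℕ) T → f T ≤ sum-sets n f
  term≤sum-sets zero    f [] = ≤-refl
  term≤sum-sets (suc n) f (true ∷ T)  = ≤-trans (term≤sum-sets n (f ∘ (true ∷_)) T) (m≤m+n _ _)
  term≤sum-sets (suc n) f (false ∷ T) = ≤-trans (term≤sum-sets n (f ∘ (false ∷_)) T) (m≤n+m _ _)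

module Weight (J : ℕ) where

  weight : ∀ {n} → (Fin n → Bool) → Vec Bool n → ℕ
  weight K []          = 1
  weight K (true ∷ T)  = 𝟙 (K zero) * J * weight (K ∘ suc) T
  weight K (false ∷ T) = weight (K ∘ suc) T

  opaque
    unfolding sum-sets

    weight-total : ∀ {n} (K : Fin n → Bool) → sum-sets n (weight K) ≡ suc J ^ count K
    weight-total {zero}  K = cong (suc J ^_) (sym (trans (count-sum K) (sum-zero _)))
    weight-total {suc n} K = begin-equality
      sum-sets n (λ T → 𝟙 (K zero) * J * weight (K ∘ suc) T) + sum-sets n (weight (K ∘ suc))
        ≡⟨ cong₂ _+_ (trans (sym (*-sum-sets n (𝟙 (K zero) * J) _)) (cong (𝟙 (K zero) * J *_) (weight-total (K ∘ suc)))) (weight-total (K ∘ suc)) ⟩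
      𝟙 (K zero) * J * suc J ^ count (K ∘ suc) + suc J ^ count (K ∘ suc)
        ≡⟨ head-case (K zero) ⟩
      suc J ^ (𝟙 (K zero) + count (K ∘ suc))
        ≡⟨ cong (suc J ^_) (count-suc K) ⟨
      suc J ^ count K ∎
      where
      ring : ∀ j p → 1 * j * p + p ≡ (1 + j) * p
      ring = solve-∀
      head-case : ∀ b → 𝟙 b * J * suc J ^ count (K ∘ suc) + suc J ^ count (K ∘ suc) ≡ suc J ^ (𝟙 b + count (K ∘ suc))
      head-case true  = ring J _
      head-case false = refl

  weight-subset : ∀ {n} (K : Fin n → Bool) T → lookup T ⊑ K → weight K T ≡ J ^ count (lookup T)
  weight-subset K [] h = cong (J ^_) (sym (trans (count-sum (lookup [])) (sum-zero _)))
  weight-subset K (true ∷ T) h = trans (cong₂ (λ b w → 𝟙 b * J * w) (h zero refl) (weight-subset (K ∘ suc) T (h ∘ suc)))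
    (trans (cong (_* J ^ count (lookup T)) (*-identityˡ J)) (cong (J ^_) (sym (count-suc (lookup (true ∷ T))))))
  weight-subset K (false ∷ T) h = trans (weight-subset (K ∘ suc) T (h ∘ suc)) (cong (J ^_) (sym (count-suc (lookup (false ∷ T)))))

  weight-support : ∀ {n} (K : Fin n → Bool) T → weight K T ≢ 0 → lookup T ⊑ K
  weight-support K (true ∷ T) h zero e with K zero
  ... | true  = refl
  ... | false = ⊥-elim (h refl)
  weight-support K (true ∷ T) h (suc i) e = weight-support (K ∘ suc) T (λ q → h (trans (cong (𝟙 (K zero) * J *_) q) (*-zeroʳ (𝟙 (K zero) * J)))) i e
  weight-support K (false ∷ T) h (suc i) e = weight-support (K ∘ suc) T h i e

product : ∀ {n} → (Fin n → ℕ) → ℕ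
product {zero}  f = 1
product {suc n} f = f zero * product (f ∘ suc)

product-cong : ∀ {n} {f g : Fin n → ℕ} → (∀ i → f i ≡ g i) → product f ≡ product g
product-cong {zero}  h = refl
product-cong {suc n} h = cong₂ _*_ (h zero) (product-cong (h ∘ suc))

product-except : ∀ {n} → (Fin n → ℕ) → Fin n → ℕ
product-except f zero    = product (f ∘ suc)
product-except f (suc i) = f zero * product-except (f ∘ suc) i

product-factor : ∀ {n} (f : Fin n → ℕ) i → product f ≡ f i * product-except f i
product-factor f zero    = refl
product-factor f (suc i) = trans (cong (f zero *_) (product-factor (f ∘ suc) i)) (swap (f zero) (f (suc i)) _)
  where
  swap : ∀ a b c → a * (b * c) ≡ b * (a * c)
  swap = solve-∀

product-except-cong : ∀ {n} {f g : Fin n → ℕ} i → (∀ j → i ≢ j → f j ≡ g j) → product-except f i ≡ product-except g i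
product-except-cong zero    h = product-cong (λ j → h (suc j) λ ())
product-except-cong (suc i) h = cong₂ _*_ (h zero λ ()) (product-except-cong i (λ j ne → h (suc j) (ne ∘ Fin-suc-injective)))

product-bound : ∀ {n} (p : Fin n → Bool) (f : Fin n → ℕ) c → (∀ i → f i ≤ (if p i then c else 1)) → product f ≤ c ^ count p
product-bound {zero}  p f c h = ≤-reflexive (cong (c ^_) (sym (trans (count-sum p) (sum-zero _))))
product-bound {suc n} p f c h = ≤-trans (*-mono-≤ (h zero) (product-bound (p ∘ suc) (f ∘ suc) c (h ∘ suc)))
  (≤-reflexive (trans (head-case (p zero)) (cong (c ^_) (sym (count-suc p)))))
  where
  head-case : ∀ b → (if b then c else 1) * c ^ count (p ∘ suc) ≡ c ^ (𝟙 b + count (p ∘ suc))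
  head-case true  = refl
  head-case false = *-identityˡ _

product-halves : ∀ {n} (p q : Fin n → Bool) c →
  product (λ i → if p i then (if q i then c else 2 * c) else 1) * 2 ^ count (p ∩ q) ≡ (2 * c) ^ count p
product-halves {zero}  p q c = trans (cong (λ k → 1 * 2 ^ k) (trans (count-sum (p ∩ q)) (sum-zero _))) (cong ((2 * c) ^_) (sym (trans (count-sum p) (sum-zero _))))
product-halves {suc n} p q c = begin-equality
  first * rest * 2 ^ count (p ∩ q)                                ≡⟨ cong (λ k → first * rest * 2 ^ k) (count-suc (p ∩ q)) ⟩
  first * rest * 2 ^ (𝟙 (p zero ∧ q zero) + count tail)           ≡⟨ cong (first * rest *_) (^-distribˡ-+-* 2 (𝟙 (p zero ∧ q zero)) (count tail)) ⟩
  first * rest * (2 ^ 𝟙 (p zero ∧ q zero) * 2 ^ count tail)       ≡⟨ ring first rest _ _ ⟩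
  first * 2 ^ 𝟙 (p zero ∧ q zero) * (rest * 2 ^ count tail)       ≡⟨ cong₂ _*_ (head-case (p zero) (q zero)) (product-halves (p ∘ suc) (q ∘ suc) c) ⟩
  (2 * c) ^ 𝟙 (p zero) * (2 * c) ^ count (p ∘ suc)                ≡⟨ ^-distribˡ-+-* (2 * c) (𝟙 (p zero)) _ ⟨
  (2 * c) ^ (𝟙 (p zero) + count (p ∘ suc))                        ≡⟨ cong ((2 * c) ^_) (count-suc p) ⟨
  (2 * c) ^ count p                                               ∎
  where
  first = if p zero then (if q zero then c else 2 * c) else 1
  rest = product (λ i → if p (suc i) then (if q (suc i) then c else 2 * c) else 1)
  tail = (p ∘ suc) ∩ (q ∘ suc)
  ring : ∀ a b x y → a * b * (x * y) ≡ a * x * (b * y)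
  ring = solve-∀
  head-case : ∀ a b → (if a then (if b then c else 2 * c) else 1) * 2 ^ 𝟙 (a ∧ b) ≡ (2 * c) ^ 𝟙 a
  head-case true  true  = trans (*-comm c 2) (sym (*-identityʳ _))
  head-case true  false = refl
  head-case false _     = refl

-- Potentials for the greedy embedding

if-false : ∀ {t} {x y : ℕ} → t ≡ false → (if t then x else y) ≡ y
if-false refl = refl

module Potentials {n N : ℕ} (G : Graph n) (g : Fin N → Fin N → Bool) (d : ℕ) (deg : ∀ y → count (adj G y) ≤ d)
  (U K₀ : Fin N → Bool) (D w tmin : ℕ) (0<D : 0 < D) (tmin-large : D ^ d * w ≤ tmin)
  (typical : ∀ T → T ⊑ K₀ → w ≤ count T → count (U ∩ (λ a → suc (count (T ∩ g a) * D) ≤ᵇ count T)) ≤ w) where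

  open Candidates G g
  open PartialEmbedding

  private
    PM : Set
    PM = PartialMap {n} {N}

  fails : (Fin N → Bool) → PM → Fin n → Bool
  fails T ρ y = not (count T ≤ᵇ count (T ∩ cand ρ y) * D ^ placed ρ y)

  fails-elim : ∀ T ρ y → fails T ρ y ≡ true → count (T ∩ cand ρ y) * D ^ placed ρ y < count T
  fails-elim T ρ y e = ≤ᵇ-false (not-elim e)

  survives : ∀ T ρ y → fails T ρ y ≡ false → count T ≤ count (T ∩ cand ρ y) * D ^ placed ρ y
  survives T ρ y e = ≤ᵇ-elim (bool-not e)
    where
    bool-not : ∀ {b} → not b ≡ false → b ≡ true
    bool-not {true} _ = refl

  fails-intro : ∀ T ρ y → count (T ∩ cand ρ y) * D ^ placed ρ y < count T → fails T ρ y ≡ true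
  fails-intro T ρ y h = not-intro (¬true⇒false λ e → <⇒≱ h (≤ᵇ-elim e))

  fails-non-neighbour : ∀ T ρ x a y → ρ x ≡ nothing → adj G y x ≡ false → fails T (ρ [ x ≔ a ]) y ≡ fails T ρ y
  fails-non-neighbour T ρ x a y none e = cong₂ (λ c p → not (count T ≤ᵇ c * D ^ p))
    (count-cong λ v → cong (T v ∧_) (cand-non-neighbour ρ x a y v none e))
    (trans (placed-update ρ x a y none) (trans (cong (λ b → placed ρ y + 𝟙 b) e) (+-identityʳ _)))

  crossing : (Fin N → Bool) → PM → Fin n → Fin n → Fin N → Bool
  crossing T ρ x y a = U a ∧ (adj G x y ∧ (not (fails T ρ y) ∧ fails T (ρ [ x ≔ a ]) y))

  module _ (T : Fin N → Bool) (T⊑ : T ⊑ K₀) (T-large : tmin ≤ count T) (ρ : PM) (x : Fin n) (none : ρ x ≡ nothing) where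

    crossing-neighbour : ∀ y → adj G y x ≡ true → fails T ρ y ≡ false → count (crossing T ρ x y) ≤ w
    crossing-neighbour y e ok = ≤-trans (count-mono low) (typical S S⊑ S-large)
      where
      S = T ∩ cand ρ y
      p = placed ρ y
      S⊑ : S ⊑ K₀
      S⊑ v q = T⊑ v (∧-left q)
      instance
        D≢0 : NonZero D
        D≢0 = >-nonZero 0<D
        D^d≢0 : NonZero (D ^ d)
        D^d≢0 = m^n≢0 D d
      S-large : w ≤ count S
      S-large = *-cancelˡ-≤ (D ^ d) (begin
        D ^ d * w            ≤⟨ tmin-large ⟩
        tmin                 ≤⟨ T-large ⟩
        count T              ≤⟨ survives T ρ y ok ⟩
        count S * D ^ p      ≤⟨ *-monoʳ-≤ (count S) (^-monoʳ-≤ D (placed≤ deg ρ y)) ⟩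
        count S * D ^ d      ≡⟨ *-comm (count S) (D ^ d) ⟩
        D ^ d * count S      ∎)
      low : crossing T ρ x y ⊑ (U ∩ (λ a → suc (count (S ∩ g a) * D) ≤ᵇ count S))
      low a q = ∧-intro (∧-left {U a} q) (≤ᵇ-true {suc (count (S ∩ g a) * D)} {count S} (≰⇒> {count S} {count (S ∩ g a) * D} λ le → <⇒≱
        (fails-elim T (ρ [ x ≔ a ]) y (∧-right {not (fails T ρ y)} (∧-right {adj G x y} (∧-right {U a} q))))
        (begin
          count T                        ≤⟨ survives T ρ y ok ⟩
          count S * D ^ p                ≤⟨ *-monoˡ-≤ (D ^ p) le ⟩
          count (S ∩ g a) * D * D ^ p    ≡⟨ *-assoc (count (S ∩ g a)) D (D ^ p) ⟩
          count (S ∩ g a) * D ^ suc p    ≡⟨ cong₂ (λ c q → c * D ^ q)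
              (count-cong λ v → trans (assoc (T v) (cand ρ y v) (g a v)) (cong (T v ∧_) (sym (cand-neighbour ρ x a y v none e))))
              (sym (trans (placed-update ρ x a y none) (trans (cong (λ b → p + 𝟙 b) e) (+-comm p 1)))) ⟩
          count (T ∩ cand (ρ [ x ≔ a ]) y) * D ^ placed (ρ [ x ≔ a ]) y  ∎)))
        where
        assoc : ∀ a b c → (a ∧ b) ∧ c ≡ a ∧ (b ∧ c)
        assoc true  b c = refl
        assoc false b c = refl

    count-crossing : ∀ y → count (crossing T ρ x y) ≤ 𝟙 (adj G x y) * w
    count-crossing y = case bool-dec (adj G x y) of λ
      { (inj₂ e) → ≤-trans (≤-reflexive (count-none λ a → ¬true⇒false λ q → true≢false (∧-left (∧-right {U a} q)) e)) z≤n
      ; (inj₁ e) → case bool-dec (fails T ρ y) of λ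
        { (inj₁ f) → ≤-trans (≤-reflexive (count-none λ a → ¬true⇒false λ q → true≢false f (not-elim (∧-left (∧-right {adj G x y} (∧-right {U a} q)))))) z≤n
        ; (inj₂ f) → ≤-trans (crossing-neighbour y (trans (adj-sym G y x) e) f)
            (≤-reflexive (trans (sym (*-identityˡ w)) (cong (λ b → 𝟙 b * w) (sym e)))) } }

    total-crossing : sum (λ y → count (crossing T ρ x y)) ≤ d * w
    total-crossing = begin
      sum (λ y → count (crossing T ρ x y))      ≤⟨ sum-mono count-crossing ⟩
      sum (λ y → 𝟙 (adj G x y) * w)             ≡⟨ sum-on-const (adj G x) w ⟩
      count (adj G x) * w                       ≤⟨ *-monoˡ-≤ w (deg x) ⟩
      d * w                                     ∎

    fails-step : ∀ a → U a ≡ true → ∀ y → fails T (ρ [ x ≔ a ]) y ≡ true → fails T ρ y ≡ true ⊎ crossing T ρ x y a ≡ true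
    fails-step a Ua y e = case bool-dec (adj G y x) of λ
      { (inj₂ f) → inj₁ (trans (sym (fails-non-neighbour T ρ x a y none f)) e)
      ; (inj₁ f) → case bool-dec (fails T ρ y) of λ
        { (inj₁ h) → inj₁ h
        ; (inj₂ h) → inj₂ (∧-intro Ua (∧-intro (trans (adj-sym G x y) f) (∧-intro (not-intro h) e))) } }

    module _ (K : ℕ) (0<K : 0 < K) where

      power-step : ∀ a → U a ≡ true → K ^ count (fails T (ρ [ x ≔ a ])) ≤ K ^ count (fails T ρ) * (1 + K ^ d * count (λ y → crossing T ρ x y a))
      power-step a Ua = begin
        K ^ count (fails T (ρ [ x ≔ a ]))                      ≤⟨ ^-monoʳ-≤ K {{>-nonZero 0<K}} (count-⊎ (fails T ρ) (λ y → crossing T ρ x y a) _ (fails-step a Ua)) ⟩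
        K ^ (count (fails T ρ) + c)                            ≡⟨ ^-distribˡ-+-* K (count (fails T ρ)) c ⟩
        K ^ count (fails T ρ) * K ^ c                          ≤⟨ *-monoʳ-≤ (K ^ count (fails T ρ)) (small c c≤d) ⟩
        K ^ count (fails T ρ) * (1 + K ^ d * c)                ∎
        where
        c = count (λ y → crossing T ρ x y a)
        c≤d : c ≤ d
        c≤d = ≤-trans (count-mono λ y q → ∧-left (∧-right {U a} q)) (deg x)
        small : ∀ c → c ≤ d → K ^ c ≤ 1 + K ^ d * c
        small zero    _ = s≤s z≤n
        small (suc c) h = ≤-trans (^-monoʳ-≤ K {{>-nonZero 0<K}} h) (≤-trans (m≤m*n (K ^ d) (suc c)) (n≤1+n _))

      power-sum : ∀ av → av ⊑ U →
        sum (λ a → 𝟙 (av a) * K ^ count (fails T (ρ [ x ≔ a ]))) ≤ (count av + K ^ d * (d * w)) * K ^ count (fails T ρ)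
      power-sum av av⊑ = begin
        sum (λ a → 𝟙 (av a) * K ^ count (fails T (ρ [ x ≔ a ])))     ≤⟨ sum-mono pointwise ⟩
        sum (λ a → (𝟙 (av a) + K ^ d * c a) * P)                     ≡⟨ sum-* P _ ⟨
        sum (λ a → 𝟙 (av a) + K ^ d * c a) * P                       ≡⟨ cong (_* P) (trans (sum-+ _ _) (cong₂ _+_ (sym (count-sum av)) (sym (*-sum (K ^ d) c)))) ⟩
        (count av + K ^ d * sum c) * P                               ≤⟨ *-monoˡ-≤ P (+-monoʳ-≤ (count av) (*-monoʳ-≤ (K ^ d) sum-c)) ⟩
        (count av + K ^ d * (d * w)) * P                             ∎
        where
        P = K ^ count (fails T ρ)
        c : Fin N → ℕ
        c a = count (λ y → crossing T ρ x y a)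
        sum-c : sum c ≤ d * w
        sum-c = begin
          sum c                                          ≡⟨ sum-cong (λ a → count-sum (λ y → crossing T ρ x y a)) ⟩
          sum (λ a → sum (λ y → 𝟙 (crossing T ρ x y a)))  ≡⟨ sum-swap (λ a y → 𝟙 (crossing T ρ x y a)) ⟩
          sum (λ y → sum (λ a → 𝟙 (crossing T ρ x y a)))  ≡⟨ sum-cong (λ y → count-sum (crossing T ρ x y)) ⟨
          sum (λ y → count (crossing T ρ x y))           ≤⟨ total-crossing ⟩
          d * w                                          ∎
        ring : ∀ p k c → 1 * (p * (1 + k * c)) ≡ (1 + k * c) * p
        ring = solve-∀
        pointwise : ∀ a → 𝟙 (av a) * K ^ count (fails T (ρ [ x ≔ a ])) ≤ (𝟙 (av a) + K ^ d * c a) * P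
        pointwise a = case bool-dec (av a) of λ
          { (inj₂ e) → ≤-trans (≤-reflexive (cong (λ b → 𝟙 b * K ^ count (fails T (ρ [ x ≔ a ]))) e)) z≤n
          ; (inj₁ e) → subst (λ b → 𝟙 b * K ^ count (fails T (ρ [ x ≔ a ])) ≤ (𝟙 b + K ^ d * c a) * P) (sym e)
              (≤-trans (*-monoʳ-≤ 1 (power-step a (av⊑ a e))) (≤-reflexive (ring P (K ^ d) (c a)))) }

  -- The weights J^|T| add up to (1 + J)^|K₀|, so as long as this potential hardly grows, no T can have |T| + 2 · #(failing y)
  -- much larger than |K₀|: this is Hall's condition with room to spare.
  module SetPotential (J : ℕ) (0<J : 0 < J) where

    open Weight J

    K : ℕ
    K = J * J

    0<K : 0 < K
    0<K = *-mono-< {0} {J} {0} {J} 0<J 0<J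

    large-weight : Vec Bool N → ℕ
    large-weight T = 𝟙 (tmin ≤ᵇ count (lookup T)) * weight K₀ T

    Φ : PM → ℕ
    Φ ρ = sum-sets N (λ T → large-weight T * K ^ count (fails (lookup T) ρ))

    Φ-step : ∀ ρ x → ρ x ≡ nothing → ∀ av → av ⊑ U →
      sum (λ a → 𝟙 (av a) * Φ (ρ [ x ≔ a ])) ≤ (count av + K ^ d * (d * w)) * Φ ρ
    Φ-step ρ x none av av⊑ = begin
      sum (λ a → 𝟙 (av a) * Φ (ρ [ x ≔ a ]))
        ≡⟨ sum-cong (λ a → *-sum-sets N (𝟙 (av a)) _) ⟩
      sum (λ a → sum-sets N (λ T → 𝟙 (av a) * (large-weight T * K ^ count (fails (lookup T) (ρ [ x ≔ a ])))))
        ≡⟨ sum-sum-sets N _ ⟩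
      sum-sets N (λ T → sum (λ a → 𝟙 (av a) * (large-weight T * K ^ count (fails (lookup T) (ρ [ x ≔ a ])))))
        ≤⟨ sum-sets-mono N each ⟩
      sum-sets N (λ T → (count av + K ^ d * (d * w)) * (large-weight T * K ^ count (fails (lookup T) ρ)))
        ≡⟨ *-sum-sets N (count av + K ^ d * (d * w)) _ ⟨
      (count av + K ^ d * (d * w)) * Φ ρ ∎
      where
      swap : ∀ a b c → a * (b * c) ≡ b * (a * c)
      swap = solve-∀
      each : ∀ T → sum (λ a → 𝟙 (av a) * (large-weight T * K ^ count (fails (lookup T) (ρ [ x ≔ a ]))))
        ≤ (count av + K ^ d * (d * w)) * (large-weight T * K ^ count (fails (lookup T) ρ))
      each T = begin
        sum (λ a → 𝟙 (av a) * (large-weight T * K ^ count (fails (lookup T) (ρ [ x ≔ a ]))))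
          ≡⟨ trans (sum-cong (λ a → swap (𝟙 (av a)) (large-weight T) _)) (sym (*-sum (large-weight T) _)) ⟩
        large-weight T * sum (λ a → 𝟙 (av a) * K ^ count (fails (lookup T) (ρ [ x ≔ a ])))
          ≤⟨ supported (bool-dec (tmin ≤ᵇ count (lookup T))) (weight K₀ T ≟ℕ 0) ⟩
        large-weight T * ((count av + K ^ d * (d * w)) * K ^ count (fails (lookup T) ρ))
          ≡⟨ swap (large-weight T) (count av + K ^ d * (d * w)) _ ⟩
        (count av + K ^ d * (d * w)) * (large-weight T * K ^ count (fails (lookup T) ρ)) ∎
        where
        open import Data.Nat.Properties using () renaming (_≟_ to _≟ℕ_)
        vanish : ∀ {x y} → large-weight T ≡ 0 → large-weight T * x ≤ y
        vanish {x} e = ≤-trans (≤-reflexive (cong (_* x) e)) z≤n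
        supported : _ → Dec (weight K₀ T ≡ 0) →
          large-weight T * sum (λ a → 𝟙 (av a) * K ^ count (fails (lookup T) (ρ [ x ≔ a ])))
          ≤ large-weight T * ((count av + K ^ d * (d * w)) * K ^ count (fails (lookup T) ρ))
        supported (inj₂ e) _       = vanish (cong (λ b → 𝟙 b * weight K₀ T) e)
        supported (inj₁ e) (yes z) = vanish (trans (cong (𝟙 (tmin ≤ᵇ count (lookup T)) *_) z) (*-zeroʳ (𝟙 (tmin ≤ᵇ count (lookup T)))))
        supported (inj₁ e) (no nz) = *-monoʳ-≤ (large-weight T)
          (power-sum (lookup T) (weight-support K₀ T nz) (≤ᵇ-elim {tmin} e) ρ x none K 0<K av av⊑)

    Φ-initial : ∀ ρ → (∀ T y → fails T ρ y ≡ false) → Φ ρ ≤ suc J ^ count K₀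
    Φ-initial ρ none = ≤-trans (sum-sets-mono N λ T → begin
        large-weight T * K ^ count (fails (lookup T) ρ)    ≡⟨ cong (λ k → large-weight T * K ^ k) (count-none (none (lookup T))) ⟩
        large-weight T * 1                                 ≡⟨ *-identityʳ _ ⟩
        𝟙 (tmin ≤ᵇ count (lookup T)) * weight K₀ T         ≤⟨ *-monoˡ-≤ (weight K₀ T) (𝟙≤1 (tmin ≤ᵇ count (lookup T))) ⟩
        1 * weight K₀ T                                    ≡⟨ *-identityˡ _ ⟩
        weight K₀ T                                        ∎) (≤-reflexive (weight-total K₀))

    Φ-term : ∀ ρ T → T ⊑ K₀ → tmin ≤ count T → J ^ (count T + 2 * count (fails T ρ)) ≤ Φ ρ
    Φ-term ρ T T⊑ large = begin
      J ^ (count T + 2 * z)                             ≡⟨ ^-distribˡ-+-* J (count T) (2 * z) ⟩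
      J ^ count T * J ^ (2 * z)                         ≡⟨ cong (J ^ count T *_) (trans (sym (^-*-assoc J 2 z)) (cong (λ k → (J * k) ^ z) (*-identityʳ J))) ⟩
      J ^ count T * K ^ z                               ≡⟨ cong₂ (λ a b → a * K ^ b) (sym wt) (count-cong λ y → sym (same-fails y)) ⟩
      large-weight V * K ^ count (fails (lookup V) ρ)   ≤⟨ term≤sum-sets N (λ T → large-weight T * K ^ count (fails (lookup T) ρ)) V ⟩
      Φ ρ                                               ∎
      where
      z = count (fails T ρ)
      V = tabulate T
      same : ∀ v → lookup V v ≡ T v
      same = lookup∘tabulate T
      same-fails : ∀ y → fails (lookup V) ρ y ≡ fails T ρ y
      same-fails y = cong₂ (λ a b → not (a ≤ᵇ b * D ^ placed ρ y)) (count-cong same) (count-cong λ v → cong (_∧ cand ρ y v) (same v))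
      wt : large-weight V ≡ J ^ count T
      wt = trans (cong (λ b → 𝟙 b * weight K₀ V) (≤ᵇ-true (≤-trans large (≤-reflexive (count-cong λ v → sym (same v))))))
        (trans (*-identityˡ _) (trans (weight-subset K₀ V (λ v e → T⊑ v (trans (sym (same v)) e))) (cong (J ^_) (count-cong same))))

  -- The factor of y bounds (up to the scale Q) the expected value of (1/2)^[b is a candidate for y] when the neighbours of y not yet
  -- placed hit the neighbourhood of b with probability 1/(2D) each; so a small product means that b is a candidate for many y in Des.
  module PointPotential (Des : Fin n → Bool) (separated : ∀ {y y′ x} → Des y ≡ true → Des y′ ≡ true → adj G y x ≡ true → adj G y′ x ≡ true → y ≡ y′) where

    Q : ℕ
    Q = 2 * (2 * D) ^ d

    level : PM → Fin n → ℕ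
    level ρ y = (d ∸ count (adj G y)) + placed ρ y

    factor : Fin N → PM → Fin n → ℕ
    factor b ρ y = if Des y then (if cand ρ y b then Q ∸ (2 * D) ^ level ρ y else Q) else 1

    Pot : Fin N → PM → ℕ
    Pot b ρ = product (factor b ρ)

    private
      instance
        2D≢0 : NonZero (2 * D)
        2D≢0 = m*n≢0 2 D {{_}} {{>-nonZero 0<D}}

    level-full : ∀ ρ y → adj G y ⊑ dom ρ → level ρ y ≡ d
    level-full ρ y h = trans (cong ((d ∸ count (adj G y)) +_) (count-cong λ x → bool-ext ∧-left (λ e → ∧-intro e (h x e)))) (m∸n+n≡m (deg y))

    power≤Q : ∀ e → e ≤ d → (2 * D) ^ e ≤ Q
    power≤Q e h = ≤-trans (^-monoʳ-≤ (2 * D) h) (m≤n*m ((2 * D) ^ d) 2)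

    factor-other : ∀ b ρ x a y → ρ x ≡ nothing → (Des y ≡ true → adj G y x ≡ false) → factor b (ρ [ x ≔ a ]) y ≡ factor b ρ y
    factor-other b ρ x a y none h = case bool-dec (Des y) of λ
      { (inj₂ e) → trans (if-false e) (sym (if-false e))
      ; (inj₁ e) → cong₂ (λ c l → if Des y then (if c then Q ∸ (2 * D) ^ l else Q) else 1)
          (cand-non-neighbour ρ x a y b none (h e))
          (cong ((d ∸ count (adj G y)) +_) (trans (placed-update ρ x a y none) (trans (cong (λ t → placed ρ y + 𝟙 t) (h e)) (+-identityʳ _)))) }

    module _ (b : Fin N) (ρ : PM) (x y : Fin n) (none : ρ x ≡ nothing) (Dy : Des y ≡ true) (yx : adj G y x ≡ true)
      (av : Fin N → Bool) (enough : count av ≤ count (av ∩ (λ a → g a b)) * (2 * D)) where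

      private
        e = level ρ y
        e<d : suc e ≤ d
        e<d = begin
          suc ((d ∸ count (adj G y)) + placed ρ y)     ≡⟨ +-suc (d ∸ count (adj G y)) (placed ρ y) ⟨
          (d ∸ count (adj G y)) + suc (placed ρ y)     ≤⟨ +-monoʳ-≤ (d ∸ count (adj G y)) (placed< ρ x y none yx) ⟩
          (d ∸ count (adj G y)) + count (adj G y)      ≡⟨ m∸n+n≡m (deg y) ⟩
          d                                            ∎
        z = (2 * D) ^ e
        z′ = (2 * D) ^ suc e
        new : Fin N → ℕ
        new a = if g a b then Q ∸ z′ else Q
        level-new : ∀ a → level (ρ [ x ≔ a ]) y ≡ suc e
        level-new a = trans (cong ((d ∸ count (adj G y)) +_) (trans (placed-update ρ x a y none) (trans (cong (λ t → placed ρ y + 𝟙 t) yx) (+-comm _ 1))))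
          (+-suc (d ∸ count (adj G y)) (placed ρ y))

      factor-average : sum (λ a → 𝟙 (av a) * factor b (ρ [ x ≔ a ]) y) ≤ count av * factor b ρ y
      factor-average = case bool-dec (cand ρ y b) of λ
        { (inj₂ c) → ≤-reflexive (trans (sum-cong λ a → cong (𝟙 (av a) *_) (dead a c)) (trans (sum-on-const av Q) (cong (count av *_) (sym (dead-old c)))))
        ; (inj₁ c) → +-cancelʳ-≤ (count av * z) _ _ (begin
            sum (λ a → 𝟙 (av a) * factor b (ρ [ x ≔ a ]) y) + count av * z
              ≤⟨ +-mono-≤ (≤-reflexive (sum-cong λ a → cong (𝟙 (av a) *_) (alive a c))) (≤-trans (*-monoˡ-≤ z enough) (≤-reflexive (*-assoc (count (av ∩ (λ a → g a b))) (2 * D) z))) ⟩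
            sum (λ a → 𝟙 (av a) * new a) + count (av ∩ (λ a → g a b)) * z′
              ≡⟨ cong (sum (λ a → 𝟙 (av a) * new a) +_) (trans (sym (sum-on-const (av ∩ (λ a → g a b)) z′)) (sum-cong λ a → trans (cong (_* z′) (𝟙-∧ (av a) (g a b))) (*-assoc (𝟙 (av a)) (𝟙 (g a b)) z′))) ⟩
            sum (λ a → 𝟙 (av a) * new a) + sum (λ a → 𝟙 (av a) * (𝟙 (g a b) * z′))
              ≡⟨ sum-+ _ _ ⟨
            sum (λ a → 𝟙 (av a) * new a + 𝟙 (av a) * (𝟙 (g a b) * z′))
              ≡⟨ sum-cong (λ a → trans (sym (*-distribˡ-+ (𝟙 (av a)) _ _)) (cong (𝟙 (av a) *_) (restore-Q (g a b)))) ⟩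
            sum (λ a → 𝟙 (av a) * Q)
              ≡⟨ sum-on-const av Q ⟩
            count av * Q
              ≡⟨ cong (count av *_) (trans (cong (_+ z) (alive-old c)) (m∸n+n≡m (power≤Q e (<⇒≤ e<d)))) ⟨
            count av * (factor b ρ y + z)
              ≡⟨ *-distribˡ-+ (count av) (factor b ρ y) z ⟩
            count av * factor b ρ y + count av * z ∎) }
        where
        unfold : ∀ ρ′ → factor b ρ′ y ≡ (if cand ρ′ y b then Q ∸ (2 * D) ^ level ρ′ y else Q)
        unfold ρ′ = cong (λ t → if t then (if cand ρ′ y b then Q ∸ (2 * D) ^ level ρ′ y else Q) else 1) Dy
        dead-old : cand ρ y b ≡ false → factor b ρ y ≡ Q
        dead-old c = trans (unfold ρ) (cong (λ t → if t then Q ∸ (2 * D) ^ level ρ y else Q) c)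
        alive-old : cand ρ y b ≡ true → factor b ρ y ≡ Q ∸ z
        alive-old c = trans (unfold ρ) (cong (λ t → if t then Q ∸ (2 * D) ^ level ρ y else Q) c)
        new-cand : ∀ a t → cand ρ y b ≡ t → cand (ρ [ x ≔ a ]) y b ≡ t ∧ g a b
        new-cand a t c = trans (cand-neighbour ρ x a y b none yx) (cong (_∧ g a b) c)
        dead : ∀ a → cand ρ y b ≡ false → factor b (ρ [ x ≔ a ]) y ≡ Q
        dead a c = trans (unfold (ρ [ x ≔ a ])) (cong (λ t → if t then Q ∸ (2 * D) ^ level (ρ [ x ≔ a ]) y else Q) (new-cand a false c))
        alive : ∀ a → cand ρ y b ≡ true → factor b (ρ [ x ≔ a ]) y ≡ new a
        alive a c = trans (unfold (ρ [ x ≔ a ])) (cong₂ (λ t l → if t then Q ∸ (2 * D) ^ l else Q) (new-cand a true c) (level-new a))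
        restore-Q : ∀ t → (if t then Q ∸ z′ else Q) + 𝟙 t * z′ ≡ Q
        restore-Q true  = trans (cong ((Q ∸ z′) +_) (*-identityˡ z′)) (m∸n+n≡m (power≤Q (suc e) e<d))
        restore-Q false = +-identityʳ Q

    Pot-step : ∀ b ρ x → ρ x ≡ nothing → ∀ av →
      ((∃ λ y → Des y ≡ true × adj G y x ≡ true) → count av ≤ count (av ∩ (λ a → g a b)) * (2 * D)) →
      sum (λ a → 𝟙 (av a) * Pot b (ρ [ x ≔ a ])) ≤ count av * Pot b ρ
    Pot-step b ρ x none av enough = case bool-dec (anyB (λ y → Des y ∧ adj G y x)) of λ
      { (inj₂ e) → ≤-reflexive (trans (sum-cong λ a → cong (𝟙 (av a) *_) (product-cong λ y →
            factor-other b ρ x a y none (λ Dy → ¬true⇒false λ yx → true≢false (∧-intro Dy yx) (anyB-false e y)))) (sum-on-const av (Pot b ρ)))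
      ; (inj₁ e) → neighbour (anyB-elim e) }
      where
      neighbour : (∃ λ y → Des y ∧ adj G y x ≡ true) → sum (λ a → 𝟙 (av a) * Pot b (ρ [ x ≔ a ])) ≤ count av * Pot b ρ
      neighbour (y , q) = begin
        sum (λ a → 𝟙 (av a) * Pot b (ρ [ x ≔ a ]))                         ≡⟨ sum-cong (λ a → trans (cong (𝟙 (av a) *_) (split a)) (sym (*-assoc (𝟙 (av a)) _ R))) ⟩
        sum (λ a → 𝟙 (av a) * factor b (ρ [ x ≔ a ]) y * R)                ≡⟨ sum-* R _ ⟨
        sum (λ a → 𝟙 (av a) * factor b (ρ [ x ≔ a ]) y) * R                ≤⟨ *-monoˡ-≤ R (factor-average b ρ x y none Dy yx av (enough (y , Dy , yx))) ⟩
        count av * factor b ρ y * R                                        ≡⟨ *-assoc (count av) _ R ⟩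
        count av * (factor b ρ y * R)                                      ≡⟨ cong (count av *_) (product-factor (factor b ρ) y) ⟨
        count av * Pot b ρ                                                 ∎
        where
        Dy = ∧-left {Des y} q
        yx = ∧-right {Des y} q
        R = product-except (factor b ρ) y
        split : ∀ a → Pot b (ρ [ x ≔ a ]) ≡ factor b (ρ [ x ≔ a ]) y * R
        split a = trans (product-factor (factor b (ρ [ x ≔ a ])) y) (cong (factor b (ρ [ x ≔ a ]) y *_)
          (product-except-cong y λ j ne → factor-other b ρ x a j none λ Dj → ¬true⇒false λ jx → ne (separated Dy Dj yx jx)))

    Pot-initial : ∀ b ρ → (∀ y → cand ρ y b ≡ true) → Pot b ρ ≤ (Q ∸ 1) ^ count Des
    Pot-initial b ρ all = product-bound Des (factor b ρ) (Q ∸ 1) bound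
      where
      bound : ∀ y → factor b ρ y ≤ (if Des y then Q ∸ 1 else 1)
      bound y with Des y | cand ρ y b | all y
      ... | false | _    | _    = ≤-refl
      ... | true  | true | refl = ∸-monoʳ-≤ Q (m^n>0 (2 * D) (level ρ y))

    Pot-final : ∀ b ρ → (∀ y → Des y ≡ true → adj G y ⊑ dom ρ) → Pot b ρ * 2 ^ count (Des ∩ (λ y → cand ρ y b)) ≡ Q ^ count Des
    Pot-final b ρ full = trans (cong (_* 2 ^ count (Des ∩ (λ y → cand ρ y b))) (product-cong λ y → value y)) (product-halves Des (λ y → cand ρ y b) ((2 * D) ^ d))
      where
      half : Q ∸ (2 * D) ^ d ≡ (2 * D) ^ d
      half = trans (cong (λ t → (2 * D) ^ d + t ∸ (2 * D) ^ d) (+-identityʳ ((2 * D) ^ d))) (m+n∸n≡m ((2 * D) ^ d) ((2 * D) ^ d))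
      value : ∀ y → factor b ρ y ≡ (if Des y then (if cand ρ y b then (2 * D) ^ d else Q) else 1)
      value y = case bool-dec (Des y) of λ
        { (inj₂ e) → trans (if-false e) (sym (if-false e))
        ; (inj₁ e) → cong (λ v → if Des y then (if cand ρ y b then v else Q) else 1) (trans (cong (λ l → Q ∸ (2 * D) ^ l) (level-full ρ y (full y e))) half) }

-- Spanning embeddings with one flexible side

2^-cancel : ∀ {m n} → 2 ^ m ≤ 2 ^ n → m ≤ n
2^-cancel {m} {n} h = ≮⇒≥ λ lt → <⇒≱ (^-monoʳ-< 2 (s≤s (s≤s z≤n)) lt) h

module OneSided {n N : ℕ} (G : Graph n) (g : Fin N → Fin N → Bool) (d : ℕ) (deg : ∀ y → count (adj G y) ≤ d)
  (U K₀ : Fin N → Bool) (D w tmin : ℕ) (0<D : 0 < D) (0<tmin : 0 < tmin) (tmin-large : D ^ d * w ≤ tmin)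
  (typical : ∀ T → T ⊑ K₀ → w ≤ count T → count (U ∩ (λ a → suc (count (T ∩ g a) * D) ≤ᵇ count T)) ≤ w)
  (X : Fin n → Bool) (bip : ∀ i j → adj G i j ≡ true → X i ≢ X j)
  (B : Fin N → Bool) (min-degree : ∀ b → B b ≡ true → count U ≤ count (U ∩ (λ a → g a b)) * D)
  (Des : Fin n → Bool) (Des⊑ : Des ⊑ not ∘ X)
  (separated : ∀ {y y′ x} → Des y ≡ true → Des y′ ≡ true → adj G y x ≡ true → adj G y′ x ≡ true → y ≡ y′)
  (J τ y₀ s₀ s₁ z₂ lb : ℕ) (2≤J : 2 ≤ J) (grow : ∀ c → c ≤ n → suc J ^ c ≤ 2 ^ τ * J ^ c)
  (K₀-large : tmin ≤ count K₀) (K₀≤n : count K₀ ≤ n)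
  (count-Des : count Des ≡ 2 * (2 * D) ^ d * y₀) (y₀-large : s₀ + (τ + 1 + lb) ≤ y₀) (B-small : count B ≤ 2 ^ lb)
  (room : count X + d * w + J * ((J * J) ^ d * (d * w)) ≤ suc (count U))
  (room-Des : (d * count Des + d * w) * (2 * D) ≤ count U)
  (s₀-large : z₂ + tmin ≤ s₀) (s₁-large : z₂ + (τ + 1 + τ) ≤ s₁) (K₀-share : s₁ * D ^ d ≤ count K₀)
  where

  open Candidates G g
  open PartialEmbedding
  open Potentials G g d deg U K₀ D w tmin 0<D tmin-large typical
  private
    0<J : 0 < J
    0<J = ≤-trans (s≤s z≤n) 2≤J
    instance
      J≢0 : NonZero J
      J≢0 = >-nonZero 0<J
  open SetPotential J 0<J
  open PointPotential Des separated

  private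
    PM : Set
    PM = PartialMap {n} {N}

    Φ₀ Ψ₀ e : ℕ
    Φ₀ = suc J ^ count K₀
    Ψ₀ = 2 ^ lb * (Q ∸ 1) ^ count Des
    e = K ^ d * (d * w)

    1<Q : 1 < Q
    1<Q = *-monoʳ-≤ 2 (m^n>0 (2 * D) {{m*n≢0 2 D {{_}} {{>-nonZero 0<D}}}} d)

    0<Φ₀ : 0 < Φ₀
    0<Φ₀ = m^n>0 (suc J) (count K₀)

    0<Ψ₀ : 0 < Ψ₀
    0<Ψ₀ = *-mono-< {0} {2 ^ lb} {0} (2^-pos lb) (m^n>0 (Q ∸ 1) {{>-nonZero (∸-monoˡ-≤ 1 1<Q)}} (count Des))

  Ψ Ω : PM → ℕ
  Ψ ρ = sum (λ b → 𝟙 (B b) * Pot b ρ)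
  Ω ρ = Ψ₀ * Φ ρ + Φ₀ * Ψ ρ

  blocked : PM → Fin n → Fin N → Bool
  blocked ρ x a = image ρ a ∨ anyB (λ y → crossing K₀ ρ x y a)

  count-blocked : ∀ ρ x → ρ x ≡ nothing → count (blocked ρ x) ≤ count (dom ρ) + d * w
  count-blocked ρ x none = ≤-trans (count-∪ (image ρ) (λ a → anyB (λ y → crossing K₀ ρ x y a)))
    (+-mono-≤ (count-image≤dom ρ) (≤-trans (count-anyB (crossing K₀ ρ x)) (total-crossing K₀ (λ _ → id) K₀-large ρ x none)))

  Ψ-step : ∀ ρ x → ρ x ≡ nothing → ∀ av →
    (∀ b → B b ≡ true → (∃ λ y → Des y ≡ true × adj G y x ≡ true) → count av ≤ count (av ∩ (λ a → g a b)) * (2 * D)) →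
    sum (λ a → 𝟙 (av a) * Ψ (ρ [ x ≔ a ])) ≤ count av * Ψ ρ
  Ψ-step ρ x none av enough = begin
    sum (λ a → 𝟙 (av a) * Ψ (ρ [ x ≔ a ]))                                  ≡⟨ sum-cong (λ a → *-sum (𝟙 (av a)) _) ⟩
    sum (λ a → sum (λ b → 𝟙 (av a) * (𝟙 (B b) * Pot b (ρ [ x ≔ a ]))))      ≡⟨ sum-swap _ ⟩
    sum (λ b → sum (λ a → 𝟙 (av a) * (𝟙 (B b) * Pot b (ρ [ x ≔ a ]))))      ≡⟨ sum-cong (λ b → trans (sum-cong (λ a → swap (𝟙 (av a)) (𝟙 (B b)) _)) (sym (*-sum (𝟙 (B b)) _))) ⟩
    sum (λ b → 𝟙 (B b) * sum (λ a → 𝟙 (av a) * Pot b (ρ [ x ≔ a ])))        ≤⟨ sum-on-mono B _ _ (λ b Bb → Pot-step b ρ x none av (enough b Bb)) ⟩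
    sum (λ b → 𝟙 (B b) * (count av * Pot b ρ))                              ≡⟨ trans (sum-cong (λ b → swap (𝟙 (B b)) (count av) _)) (sym (*-sum (count av) _)) ⟩
    count av * Ψ ρ                                                          ∎
    where
    swap : ∀ a b c → a * (b * c) ≡ b * (a * c)
    swap = solve-∀

  Ω-step : ∀ ρ x → ρ x ≡ nothing → ∀ av → av ⊑ U →
    (∀ b → B b ≡ true → (∃ λ y → Des y ≡ true × adj G y x ≡ true) → count av ≤ count (av ∩ (λ a → g a b)) * (2 * D)) →
    sum (λ a → 𝟙 (av a) * Ω (ρ [ x ≔ a ])) ≤ (count av + e) * Ω ρ
  Ω-step ρ x none av av⊑ enough = begin
    sum (λ a → 𝟙 (av a) * (Ψ₀ * Φ′ a + Φ₀ * Ψ′ a))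
      ≡⟨ trans (sum-cong λ a → ring₁ (𝟙 (av a)) Ψ₀ (Φ′ a) Φ₀ (Ψ′ a)) (sum-+ _ _) ⟩
    sum (λ a → Ψ₀ * (𝟙 (av a) * Φ′ a)) + sum (λ a → Φ₀ * (𝟙 (av a) * Ψ′ a))
      ≡⟨ cong₂ _+_ (*-sum Ψ₀ _) (*-sum Φ₀ _) ⟨
    Ψ₀ * sum (λ a → 𝟙 (av a) * Φ′ a) + Φ₀ * sum (λ a → 𝟙 (av a) * Ψ′ a)
      ≤⟨ +-mono-≤ (*-monoʳ-≤ Ψ₀ (Φ-step ρ x none av av⊑)) (*-monoʳ-≤ Φ₀ (≤-trans (Ψ-step ρ x none av enough) (*-monoˡ-≤ (Ψ ρ) (m≤m+n (count av) e)))) ⟩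
    Ψ₀ * ((count av + e) * Φ ρ) + Φ₀ * ((count av + e) * Ψ ρ)
      ≡⟨ ring₂ Ψ₀ (count av + e) (Φ ρ) Φ₀ (Ψ ρ) ⟩
    (count av + e) * Ω ρ ∎
    where
    Φ′ Ψ′ : Fin N → ℕ
    Φ′ a = Φ (ρ [ x ≔ a ])
    Ψ′ a = Ψ (ρ [ x ≔ a ])
    ring₁ : ∀ t p f q s → t * (p * f + q * s) ≡ p * (t * f) + q * (t * s)
    ring₁ = solve-∀
    ring₂ : ∀ p v f q s → p * (v * f) + q * (v * s) ≡ v * (p * f + q * s)
    ring₂ = solve-∀

  Hard : PM → Set
  Hard ρ = ∀ y → fails K₀ ρ y ≡ false

  module _ (ρ : PM) (x : Fin n) (none : ρ x ≡ nothing) (hard : Hard ρ)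
    (space : count (dom ρ) + d * w + J * e ≤ count U)
    (space-Des : (∃ λ y → Des y ≡ true × adj G y x ≡ true) → (count (dom ρ) + d * w) * (2 * D) ≤ count U) where

    private
      av : Fin N → Bool
      av = U ∖ blocked ρ x
      v = count av
      c = count (blocked ρ x)

    available-large : J * e ≤ v
    available-large = +-cancelˡ-≤ (count (dom ρ) + d * w) _ _ (begin
      count (dom ρ) + d * w + J * e        ≤⟨ space ⟩
      count U                              ≤⟨ count≤count-∖ U (blocked ρ x) ⟩
      c + v                                ≤⟨ +-monoˡ-≤ v (count-blocked ρ x none) ⟩
      count (dom ρ) + d * w + v            ∎)

    available-degree : ∀ b → B b ≡ true → (∃ λ y → Des y ≡ true × adj G y x ≡ true) → v ≤ count (av ∩ (λ a → g a b)) * (2 * D)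
    available-degree b Bb near = ≤-trans (count-mono {q = U} (λ _ → ∧-left)) (linear 0
      (+-mono-≤ (+-mono-≤ deg-b deg-b) (≤-trans (*-monoˡ-≤ (2 * D) (count-blocked ρ x none)) (space-Des near)))
      (ring (count U) c m D))
      where
      m = count (av ∩ (λ a → g a b))
      deg-b : count U ≤ (c + m) * D
      deg-b = ≤-trans (min-degree b Bb) (*-monoˡ-≤ D (≤-trans (count≤count-∖ (U ∩ (λ a → g a b)) (blocked ρ x))
        (+-monoʳ-≤ c (count-mono λ a q → ∧-intro (∧-intro (∧-left (∧-left q)) (∧-right {U a ∧ g a b} q)) (∧-right {U a} (∧-left q))))))
      ring : ∀ u c m D → u + ((c + m) * D + (c + m) * D + u) + 0 ≡ m * (2 * D) + (u + u + c * (2 * D))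
      ring = solve-∀

    place : 0 < J * e → ∃ λ a → U a ≡ true × image ρ a ≡ false × Hard (ρ [ x ≔ a ]) × J * Ω (ρ [ x ≔ a ]) ≤ suc J * Ω ρ
    place 0<Je with averaging av (λ a → v * Ω (ρ [ x ≔ a ])) (λ _ → (v + e) * Ω ρ) (≤-trans 0<Je available-large)
        (begin
          sum (λ a → 𝟙 (av a) * (v * Ω (ρ [ x ≔ a ])))    ≡⟨ trans (sum-cong λ a → swap (𝟙 (av a)) v _) (sym (*-sum v _)) ⟩
          v * sum (λ a → 𝟙 (av a) * Ω (ρ [ x ≔ a ]))      ≤⟨ *-monoʳ-≤ v (Ω-step ρ x none av (λ _ → ∧-left) available-degree) ⟩
          v * ((v + e) * Ω ρ)                              ≡⟨ sum-on-const av _ ⟨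
          sum (λ a → 𝟙 (av a) * ((v + e) * Ω ρ))           ∎)
      where
      swap : ∀ a b c → a * (b * c) ≡ b * (a * c)
      swap = solve-∀
    ... | a , ava , ineq = a , ∧-left ava , fresh , hard′ , bound
      where
      unblocked : blocked ρ x a ≡ false
      unblocked = not-elim (∧-right {U a} ava)
      fresh : image ρ a ≡ false
      fresh = ¬true⇒false λ q → true≢false (∨-introˡ q) unblocked
      hard′ : Hard (ρ [ x ≔ a ])
      hard′ y = ¬true⇒false λ q → case fails-step K₀ (λ _ → id) K₀-large ρ x none a (∧-left ava) y q of λ
        { (inj₁ f) → true≢false f (hard y)
        ; (inj₂ f) → true≢false (∨-introʳ {image ρ a} (anyB-intro y f)) unblocked }
      ring₁ : ∀ v j o → v * (j * o) ≡ j * (v * o)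
      ring₁ = solve-∀
      ring₂ : ∀ j v e o → j * ((v + e) * o) ≡ (j * v + j * e) * o
      ring₂ = solve-∀
      ring₃ : ∀ j v o → (j * v + v) * o ≡ v * ((1 + j) * o)
      ring₃ = solve-∀
      bound : J * Ω (ρ [ x ≔ a ]) ≤ suc J * Ω ρ
      bound = *-cancelˡ-≤ v {{>-nonZero (≤-trans 0<Je available-large)}} (begin
        v * (J * Ω (ρ [ x ≔ a ]))     ≡⟨ ring₁ v J _ ⟩
        J * (v * Ω (ρ [ x ≔ a ]))     ≤⟨ *-monoʳ-≤ J ineq ⟩
        J * ((v + e) * Ω ρ)           ≡⟨ ring₂ J v e (Ω ρ) ⟩
        (J * v + J * e) * Ω ρ         ≤⟨ *-monoˡ-≤ (Ω ρ) (+-monoʳ-≤ (J * v) available-large) ⟩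
        (J * v + v) * Ω ρ             ≡⟨ ring₃ J v (Ω ρ) ⟩
        v * (suc J * Ω ρ)             ∎)

  Controlled : PM → Set
  Controlled ρ = Hard ρ × J ^ count (dom ρ) * Ω ρ ≤ suc J ^ count (dom ρ) * (2 * (Φ₀ * Ψ₀))

  count-dom-suc : ∀ (ρ : PM) x a → ρ x ≡ nothing → count (dom (ρ [ x ≔ a ])) ≡ suc (count (dom ρ))
  count-dom-suc ρ x a none = trans (count-dom-update ρ x a (λ _ → true) none) (+-comm (count (dom ρ)) 1)

  controlled-step : ∀ ρ x a → ρ x ≡ nothing → Controlled ρ → Hard (ρ [ x ≔ a ]) → J * Ω (ρ [ x ≔ a ]) ≤ suc J * Ω ρ → Controlled (ρ [ x ≔ a ])
  controlled-step ρ x a none (_ , bound) hard step = hard , subst (λ k → J ^ k * Ω (ρ [ x ≔ a ]) ≤ suc J ^ k * (2 * (Φ₀ * Ψ₀))) (sym (count-dom-suc ρ x a none)) (begin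
    J * J ^ c * Ω (ρ [ x ≔ a ])                     ≡⟨ ring₁ J (J ^ c) _ ⟩
    J ^ c * (J * Ω (ρ [ x ≔ a ]))                   ≤⟨ *-monoʳ-≤ (J ^ c) step ⟩
    J ^ c * (suc J * Ω ρ)                           ≡⟨ ring₂ (J ^ c) (suc J) (Ω ρ) ⟩
    suc J * (J ^ c * Ω ρ)                           ≤⟨ *-monoʳ-≤ (suc J) bound ⟩
    suc J * (suc J ^ c * (2 * (Φ₀ * Ψ₀)))           ≡⟨ *-assoc (suc J) (suc J ^ c) _ ⟨
    suc J ^ suc c * (2 * (Φ₀ * Ψ₀))                 ∎)
    where
    c = count (dom ρ)
    ring₁ : ∀ j p o → j * p * o ≡ p * (j * o)
    ring₁ = solve-∀
    ring₂ : ∀ p j o → p * (j * o) ≡ j * (p * o)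
    ring₂ = solve-∀

  private
    nowhere : PM
    nowhere _ = nothing

    cand-nowhere : ∀ y v → cand nowhere y v ≡ true
    cand-nowhere y v = cand-intro {nowhere} {y} {v} (λ _ _ _ ())

    placed-nowhere : ∀ y → placed nowhere y ≡ 0
    placed-nowhere y = count-none {p = adj G y ∩ dom nowhere} λ x → ¬true⇒false λ q → true≢false (∧-right {adj G y x} q) refl

    no-failures : ∀ T y → fails T nowhere y ≡ false
    no-failures T y = ¬true⇒false λ q → <-irrefl refl (begin-strict
      count (T ∩ cand nowhere y) * D ^ placed nowhere y      <⟨ fails-elim T nowhere y q ⟩
      count T                                                ≤⟨ count-mono (λ v t → ∧-intro t (cand-nowhere y v)) ⟩
      count (T ∩ cand nowhere y)                             ≡⟨ *-identityʳ _ ⟨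
      count (T ∩ cand nowhere y) * 1                         ≡⟨ cong (λ p → count (T ∩ cand nowhere y) * D ^ p) (placed-nowhere y) ⟨
      count (T ∩ cand nowhere y) * D ^ placed nowhere y      ∎)

    controlled-nowhere : Controlled nowhere
    controlled-nowhere = no-failures K₀ , subst (λ k → J ^ k * Ω nowhere ≤ suc J ^ k * (2 * (Φ₀ * Ψ₀))) (sym (count-none {n} (λ _ → refl))) (*-monoʳ-≤ 1 (begin
      Ψ₀ * Φ nowhere + Φ₀ * Ψ nowhere     ≤⟨ +-mono-≤ (*-monoʳ-≤ Ψ₀ (Φ-initial nowhere no-failures)) (*-monoʳ-≤ Φ₀ Ψ-initial) ⟩
      Ψ₀ * Φ₀ + Φ₀ * Ψ₀                   ≡⟨ ring Ψ₀ Φ₀ ⟩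
      2 * (Φ₀ * Ψ₀)                       ∎))
      where
      ring : ∀ a b → a * b + b * a ≡ 2 * (b * a)
      ring = solve-∀
      Ψ-initial : Ψ nowhere ≤ Ψ₀
      Ψ-initial = begin
        Ψ nowhere                                          ≤⟨ sum-on-mono B _ _ (λ b _ → Pot-initial b nowhere (λ y → cand-nowhere y b)) ⟩
        sum (λ b → 𝟙 (B b) * (Q ∸ 1) ^ count Des)          ≡⟨ sum-on-const B _ ⟩
        count B * (Q ∸ 1) ^ count Des                      ≤⟨ *-monoˡ-≤ _ B-small ⟩
        Ψ₀                                                 ∎

  X-neighbour : ∀ {y x} → X y ≡ false → adj G y x ≡ true → X x ≡ true
  X-neighbour {y} {x} e f = case bool-dec (X x) of λ
    { (inj₁ q) → q ; (inj₂ q) → ⊥-elim (bip y x f (trans e (sym q))) }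

  X₁ : Fin n → Bool
  X₁ x = anyB (λ y → Des y ∧ adj G y x)

  X₁⊑X : X₁ ⊑ X
  X₁⊑X x q = let y , r = anyB-elim q in X-neighbour (not-elim (Des⊑ y (∧-left r))) (∧-right {Des y} r)

  count-X₁ : count X₁ ≤ d * count Des
  count-X₁ = begin
    count X₁                                     ≤⟨ count-anyB (λ y x → Des y ∧ adj G y x) ⟩
    sum (λ y → count (λ x → Des y ∧ adj G y x))  ≤⟨ sum-mono row ⟩
    sum (λ y → 𝟙 (Des y) * d)                    ≡⟨ sum-on-const Des d ⟩
    count Des * d                                ≡⟨ *-comm (count Des) d ⟩
    d * count Des                                ∎
    where
    row : ∀ y → count (λ x → Des y ∧ adj G y x) ≤ 𝟙 (Des y) * d
    row y with Des y
    ... | true  = ≤-trans (deg y) (≤-reflexive (sym (*-identityˡ d)))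
    ... | false = ≤-reflexive (count-none {n} (λ _ → refl))

  dom-room : ∀ ρ x → PartialEmbedding X U ρ → X x ≡ true → ρ x ≡ nothing → count (dom ρ) + d * w + J * e ≤ count U
  dom-room ρ x pe Xx none = ≤-pred (≤-trans (+-monoˡ-≤ (J * e) (+-monoˡ-≤ (d * w) (begin
    suc (count (dom ρ))             ≡⟨ cong (_+ count (dom ρ)) (count-≟ x) ⟨
    count ⁅ x ⁆ + count (dom ρ)     ≤⟨ count-disjoint ⁅ x ⁆ (dom ρ) X (λ z q → subst (λ z → X z ≡ true) (does-elim (x ≟ z) q) Xx) (dom⊑ pe) sep ⟩
    count X                         ∎))) room)
    where
    sep : Disjoint ⁅ x ⁆ (dom ρ)
    sep z q f with does-elim (x ≟ z) q
    ... | refl = true≢false f (nothing-dom {ρ = ρ} none)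

  Embedded : PM → Set
  Embedded ρ = PartialEmbedding X U ρ × Controlled ρ × X ⊑ dom ρ

  -- The neighbours of Des are placed first, while every vertex of B still has most of its neighbours in U available.
  embedding : 0 < J * e → ∃ Embedded
  embedding 0<Je =
    let ρ₁ , pe₁ , inv₁ , full₁ = extend-to X₁ {X₁} {U} Controlled (λ _ → id) step₁ nowhere empty-embedding controlled-nowhere
        ρ₂ , pe₂ , (inv₂ , _) , full₂ = extend-to X {X} {U} (λ ρ → Controlled ρ × X₁ ⊑ dom ρ) (λ _ → id) step₂ ρ₁ (embedding-weaken X₁⊑X (λ _ → id) pe₁) (inv₁ , full₁)
    in ρ₂ , pe₂ , inv₂ , full₂
    where
    step₁ : ∀ ρ x → PartialEmbedding X₁ U ρ → Controlled ρ → X₁ x ≡ true → ρ x ≡ nothing →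
      ∃ λ a → U a ≡ true × image ρ a ≡ false × Controlled (ρ [ x ≔ a ])
    step₁ ρ x pe inv X₁x none =
      let a , Ua , fresh , hard , bound = place ρ x none (proj₁ inv) (dom-room ρ x (embedding-weaken X₁⊑X (λ _ → id) pe) (X₁⊑X x X₁x) none)
            (λ _ → ≤-trans (*-monoˡ-≤ (2 * D) (+-monoˡ-≤ (d * w) (≤-trans (count-mono (dom⊑ pe)) count-X₁))) room-Des) 0<Je
      in a , Ua , fresh , controlled-step ρ x a none inv hard bound
    step₂ : ∀ ρ x → PartialEmbedding X U ρ → Controlled ρ × X₁ ⊑ dom ρ → X x ≡ true → ρ x ≡ nothing →
      ∃ λ a → U a ≡ true × image ρ a ≡ false × Controlled (ρ [ x ≔ a ]) × X₁ ⊑ dom (ρ [ x ≔ a ])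
    step₂ ρ x pe (inv , full₁) Xx none =
      let a , Ua , fresh , hard , bound = place ρ x none (proj₁ inv) (dom-room ρ x pe Xx none)
            (λ { (y , Dy , yx) → ⊥-elim (true≢false (full₁ x (anyB-intro y (∧-intro Dy yx))) (nothing-dom {ρ = ρ} none)) }) 0<Je
      in a , Ua , fresh , controlled-step ρ x a none inv hard bound ,
         λ z q → dom-intro {ρ = ρ [ x ≔ a ]} (trans (update-keeps {ρ = ρ} {x} {a} none (full₁ z q)) (proj₂ (dom-elim {ρ = ρ} (full₁ z q))))

  module _ (ρ : PM) (emb : Embedded ρ) where

    private
      hard = proj₁ (proj₁ (proj₂ emb))
      full = proj₂ (proj₂ emb)

    Ω-bound : Ω ρ ≤ 2 ^ τ * (2 * (Φ₀ * Ψ₀))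
    Ω-bound = *-cancelˡ-≤ (J ^ c) {{m^n≢0 J c}} (begin
      J ^ c * Ω ρ                            ≤⟨ proj₂ (proj₁ (proj₂ emb)) ⟩
      suc J ^ c * (2 * (Φ₀ * Ψ₀))            ≤⟨ *-monoˡ-≤ _ (grow c (count≤n (dom ρ))) ⟩
      2 ^ τ * J ^ c * (2 * (Φ₀ * Ψ₀))        ≡⟨ ring (2 ^ τ) (J ^ c) _ ⟩
      J ^ c * (2 ^ τ * (2 * (Φ₀ * Ψ₀)))      ∎)
      where
      c = count (dom ρ)
      ring : ∀ a b x → a * b * x ≡ b * (a * x)
      ring = solve-∀

    few-fail : ∀ T → T ⊑ K₀ → tmin ≤ count T → count T + 2 * count (fails T ρ) ≤ count K₀ + (τ + 1 + τ)
    few-fail T T⊑ large = ≮⇒≥ λ lt → <⇒≱ (^-monoʳ-< J 2≤J lt) (*-cancelˡ-≤ Ψ₀ {{>-nonZero 0<Ψ₀}} (begin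
      Ψ₀ * J ^ (count T + 2 * count (fails T ρ))     ≤⟨ *-monoʳ-≤ Ψ₀ (Φ-term ρ T T⊑ large) ⟩
      Ψ₀ * Φ ρ                                       ≤⟨ ≤-trans (m≤m+n _ _) Ω-bound ⟩
      2 ^ τ * (2 * (Φ₀ * Ψ₀))                        ≤⟨ *-monoʳ-≤ (2 ^ τ) (*-monoʳ-≤ 2 (*-monoˡ-≤ Ψ₀ (grow (count K₀) K₀≤n))) ⟩
      2 ^ τ * (2 * (2 ^ τ * J ^ r * Ψ₀))             ≡⟨ ring (2 ^ τ) (J ^ r) Ψ₀ ⟩
      Ψ₀ * (J ^ r * (2 ^ τ * 2 * 2 ^ τ))             ≡⟨ cong (λ t → Ψ₀ * (J ^ r * t)) (trans (^-distribˡ-+-* 2 (τ + 1) τ) (cong (_* 2 ^ τ) (^-distribˡ-+-* 2 τ 1))) ⟨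
      Ψ₀ * (J ^ r * 2 ^ (τ + 1 + τ))                 ≤⟨ *-monoʳ-≤ Ψ₀ (*-monoʳ-≤ (J ^ r) (^-monoˡ-≤ (τ + 1 + τ) 2≤J)) ⟩
      Ψ₀ * (J ^ r * J ^ (τ + 1 + τ))                 ≡⟨ cong (Ψ₀ *_) (^-distribˡ-+-* J r (τ + 1 + τ)) ⟨
      Ψ₀ * J ^ (r + (τ + 1 + τ))                     ∎))
      where
      r = count K₀
      ring : ∀ t j p → t * (2 * (t * j * p)) ≡ p * (j * (t * 2 * t))
      ring = solve-∀

    many-candidates : ∀ b → B b ≡ true → s₀ ≤ count (Des ∩ (λ y → cand ρ y b))
    many-candidates b Bb = +-cancelʳ-≤ (τ + 1 + lb) _ _ (≤-trans y₀-large (2^-cancel (*-cancelˡ-≤ (Φ₀ * Q ^ M) {{>-nonZero positive}} (begin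
      Φ₀ * Q ^ M * 2 ^ y₀                                          ≡⟨ ring₁ Φ₀ (Q ^ M) (2 ^ y₀) ⟩
      Φ₀ * 2 ^ y₀ * Q ^ M                                          ≡⟨ cong (Φ₀ * 2 ^ y₀ *_) (Pot-final b ρ (λ y Dy x a → full x (X-neighbour (not-elim (Des⊑ y Dy)) a))) ⟨
      Φ₀ * 2 ^ y₀ * (Pot b ρ * 2 ^ m)                              ≡⟨ ring₂ Φ₀ (2 ^ y₀) (Pot b ρ) (2 ^ m) ⟩
      Φ₀ * Pot b ρ * (2 ^ y₀ * 2 ^ m)                              ≤⟨ *-monoˡ-≤ (2 ^ y₀ * 2 ^ m) (≤-trans (*-monoʳ-≤ Φ₀ Pot≤Ψ) (≤-trans (m≤n+m _ _) Ω-bound)) ⟩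
      2 ^ τ * (2 * (Φ₀ * Ψ₀)) * (2 ^ y₀ * 2 ^ m)                   ≡⟨ ring₃ (2 ^ τ) Φ₀ (2 ^ lb) ((Q ∸ 1) ^ M) (2 ^ y₀) (2 ^ m) ⟩
      Φ₀ * ((Q ∸ 1) ^ M * 2 ^ y₀) * (2 ^ m * (2 ^ τ * 2 * 2 ^ lb))  ≤⟨ *-monoˡ-≤ (2 ^ m * (2 ^ τ * 2 * 2 ^ lb)) (*-monoʳ-≤ Φ₀ decays) ⟩
      Φ₀ * Q ^ M * (2 ^ m * (2 ^ τ * 2 * 2 ^ lb))                  ≡⟨ cong (λ t → Φ₀ * Q ^ M * t) (trans (^-distribˡ-+-* 2 m (τ + 1 + lb)) (cong (2 ^ m *_) (trans (^-distribˡ-+-* 2 (τ + 1) lb) (cong (_* 2 ^ lb) (^-distribˡ-+-* 2 τ 1))))) ⟨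
      Φ₀ * Q ^ M * 2 ^ (m + (τ + 1 + lb))                          ∎))))
      where
      M = count Des
      m = count (Des ∩ (λ y → cand ρ y b))
      positive : 0 < Φ₀ * Q ^ M
      positive = *-mono-< {0} {Φ₀} {0} 0<Φ₀ (m^n>0 Q {{>-nonZero (<⇒≤ 1<Q)}} M)
      ring₁ : ∀ f q y → f * q * y ≡ f * y * q
      ring₁ = solve-∀
      ring₂ : ∀ f y p m → f * y * (p * m) ≡ f * p * (y * m)
      ring₂ = solve-∀
      ring₃ : ∀ t f l q y m → t * (2 * (f * (l * q))) * (y * m) ≡ f * (q * y) * (m * (t * 2 * l))
      ring₃ = solve-∀
      Pot≤Ψ : Pot b ρ ≤ Ψ ρ
      Pot≤Ψ = ≤-trans (≤-reflexive (trans (sym (*-identityˡ _)) (cong (λ t → 𝟙 t * Pot b ρ) (sym Bb)))) (term≤sum (λ b → 𝟙 (B b) * Pot b ρ) b)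
      decays : (Q ∸ 1) ^ M * 2 ^ y₀ ≤ Q ^ M
      decays = subst (λ k → (Q ∸ 1) ^ k * 2 ^ y₀ ≤ Q ^ k) (sym count-Des)
        (subst (λ q → (Q ∸ 1) ^ (q * y₀) * 2 ^ y₀ ≤ q ^ (q * y₀)) (m+[n∸m]≡n {1} {Q} (<⇒≤ 1<Q)) (decay (Q ∸ 1) y₀))

    share : ∀ y → s₁ ≤ count (K₀ ∩ cand ρ y)
    share y = *-cancelʳ-≤ _ _ (D ^ d) {{m^n≢0 D d {{>-nonZero 0<D}}}} (begin
      s₁ * D ^ d                                ≤⟨ K₀-share ⟩
      count K₀                                  ≤⟨ survives K₀ ρ y (hard y) ⟩
      count (K₀ ∩ cand ρ y) * D ^ placed ρ y    ≤⟨ *-monoʳ-≤ (count (K₀ ∩ cand ρ y)) (^-monoʳ-≤ D {{>-nonZero 0<D}} (placed≤ deg ρ y)) ⟩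
      count (K₀ ∩ cand ρ y) * D ^ d             ∎)

    module _ (W : Fin N → Bool) (K₀⊑W : K₀ ⊑ W) (W⊑B : W ⊑ B) (size : count W ≡ count (not ∘ X)) (close : count W ≤ count K₀ + z₂) where

      -- A set S violating Hall's condition and T = W ∖ Γ(S) have no edge between them although |S| + |T| > |W|; the size of T decides
      -- which of many-candidates, few-fail and share this contradicts.
      module _ (S : Fin n → Bool) (S⊑ : S ⊑ not ∘ X) (deficient : count (W ∩ neighbours (cand ρ) S) < count S) where

        private
          q = count (not ∘ X)
          T = W ∖ neighbours (cand ρ) S
          t = count T
          s = count S

        no-candidate : ∀ y v → S y ≡ true → T v ≡ true → cand ρ y v ≡ true → ⊥
        no-candidate y v Sy Tv c = true≢false (anyB-intro y (∧-intro Sy c)) (not-elim (∧-right {W v} Tv))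

        excess : q < t + s
        excess = begin-strict
          q                                                  ≡⟨ size ⟨
          count W                                            ≡⟨ count-split W (neighbours (cand ρ) S) ⟩
          count (W ∩ neighbours (cand ρ) S) + t              <⟨ +-monoˡ-< t deficient ⟩
          s + t                                              ≡⟨ +-comm s t ⟩
          t + s                                              ∎

        small-impossible : t ≤ s₀ → ⊥
        small-impossible t≤s₀ = <-irrefl refl (begin-strict
          q                                              <⟨ excess ⟩
          t + s                                          ≤⟨ +-monoˡ-≤ s (≤-trans t≤s₀ (many-candidates b (W⊑B b (∧-left Tb)))) ⟩
          count (Des ∩ (λ y → cand ρ y b)) + s           ≤⟨ count-disjoint _ S (not ∘ X) (λ y e → Des⊑ y (∧-left e)) S⊑ (λ y e f → no-candidate y b f Tb (∧-right {Des y} e)) ⟩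
          q                                              ∎)
          where
          nonempty : 0 < t
          nonempty = +-cancelʳ-< s 0 t (≤-trans (s≤s (count-mono S⊑)) excess)
          b = proj₁ (count-pick nonempty)
          Tb : T b ≡ true
          Tb = proj₂ (count-pick nonempty)

        medium-impossible : s₀ < t → t + s₁ ≤ q → ⊥
        medium-impossible s₀<t t≤ = <⇒≱ excess (*-cancelˡ-≤ 2 (linear 0
          (+-mono-≤ (+-mono-≤ (+-mono-≤ (+-mono-≤ T′-large T′-few) r≤q) t≤) s₁-large)
          (ring s t (count T′) z₂ (count K₀) (τ + 1 + τ) q s₁)))
          where
          T′ = T ∩ K₀
          T′-large : t ≤ count T′ + z₂
          T′-large = ≤-trans (≤-reflexive (count-split T K₀)) (+-monoʳ-≤ (count T′)
            (≤-trans (count-mono {q = W ∖ K₀} λ v e → ∧-intro (∧-left (∧-left e)) (∧-right {T v} e))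
              (+-cancelˡ-≤ (count K₀) _ _ (≤-trans (≤-reflexive (sym (count-∖-⊑ W K₀ K₀⊑W))) close))))
          T′-tmin : tmin ≤ count T′
          T′-tmin = +-cancelˡ-≤ z₂ _ _ (≤-trans s₀-large (≤-trans (<⇒≤ s₀<t) (≤-trans T′-large (≤-reflexive (+-comm (count T′) z₂)))))
          all-fail : S ⊑ fails T′ ρ
          all-fail y Sy = fails-intro T′ ρ y (≤-trans (s≤s (≤-reflexive (cong (_* D ^ placed ρ y) (count-none λ v → ¬true⇒false λ e →
            no-candidate y v Sy (∧-left (∧-left e)) (∧-right {T′ v} e))))) (≤-trans 0<tmin T′-tmin))
          T′-few : count T′ + 2 * s ≤ count K₀ + (τ + 1 + τ)
          T′-few = ≤-trans (+-monoʳ-≤ (count T′) (*-monoʳ-≤ 2 (count-mono all-fail))) (few-fail T′ (λ v → ∧-right {T v}) T′-tmin)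
          r≤q : count K₀ ≤ q
          r≤q = ≤-trans (count-mono K₀⊑W) (≤-reflexive size)
          ring : ∀ s t t′ z r σ q s₁ → 2 * (t + s) + (t′ + z + (r + σ) + q + q + s₁) + 0 ≡ 2 * q + (t + (t′ + 2 * s) + r + (t + s₁) + (z + σ))
          ring = solve-∀

        large-impossible : q < t + s₁ → ⊥
        large-impossible q<t+s₁ = <-irrefl refl (begin-strict
          count W                                  ≡⟨ size ⟩
          q                                        <⟨ q<t+s₁ ⟩
          t + s₁                                   ≤⟨ +-monoʳ-≤ t (share y) ⟩
          t + count (K₀ ∩ cand ρ y)                ≤⟨ count-disjoint T (K₀ ∩ cand ρ y) W (λ _ → ∧-left) (λ v e → K₀⊑W v (∧-left e)) (λ v e f → no-candidate y v Sy e (∧-right {K₀ v} f)) ⟩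
          count W                                  ∎)
          where
          picked = count-pick {p = S} (≤-trans (s≤s z≤n) deficient)
          y = proj₁ picked
          Sy : S y ≡ true
          Sy = proj₂ picked

        impossible : ⊥
        impossible = case ≤-<-connex t s₀ of λ
          { (inj₁ small) → small-impossible small
          ; (inj₂ big) → case ≤-<-connex (t + s₁) q of λ
            { (inj₁ medium) → medium-impossible big medium
            ; (inj₂ large) → large-impossible large } }

      completion : Matching (not ∘ X) W (cand ρ)
      completion = hall (count (not ∘ X)) (not ∘ X) W (cand ρ) ≤-refl λ S S⊑ → ≮⇒≥ (impossible S S⊑)

  one-sided : 0 < J * e → ∃ λ ρ → PartialEmbedding X U ρ × X ⊑ dom ρ ×
    (∀ W → K₀ ⊑ W → W ⊑ B → count W ≡ count (not ∘ X) → count W ≤ count K₀ + z₂ → Matching (not ∘ X) W (cand ρ))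
  one-sided 0<Je = let ρ , emb = embedding 0<Je in ρ , proj₁ emb , proj₂ (proj₂ emb) , completion ρ emb

-- Sides of bounded-degree bipartite graphs

count-∪-disjoint : ∀ {n} (p q : Fin n → Bool) → Disjoint p q → count (p ∪ q) ≡ count p + count q
count-∪-disjoint p q dis = ≤-antisym (count-∪ p q) (count-disjoint p q (p ∪ q) (λ i → ∨-introˡ) (λ i → ∨-introʳ {p i}) dis)

double-half : ∀ n → 2 * ⌊ n /2⌋ ≤ n
double-half n = begin
  2 * ⌊ n /2⌋                ≡⟨ cong (⌊ n /2⌋ +_) (+-identityʳ ⌊ n /2⌋) ⟩
  ⌊ n /2⌋ + ⌊ n /2⌋          ≤⟨ +-monoʳ-≤ ⌊ n /2⌋ (⌊n/2⌋≤⌈n/2⌉ n) ⟩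
  ⌊ n /2⌋ + ⌈ n /2⌉          ≡⟨ ⌊n/2⌋+⌈n/2⌉≡n n ⟩
  n                          ∎

below-double-half : ∀ n → n ≤ suc (2 * ⌊ n /2⌋)
below-double-half zero          = z≤n
below-double-half (suc zero)    = s≤s z≤n
below-double-half (suc (suc n)) = ≤-trans (s≤s (s≤s (below-double-half n))) (≤-reflexive (ring ⌊ n /2⌋))
  where
  ring : ∀ h → 2 + (1 + 2 * h) ≡ 1 + 2 * (1 + h)
  ring = solve-∀

half-mono : ∀ {m n} → 2 * m ≤ n → m ≤ ⌊ n /2⌋
half-mono {m} {n} h = ≤-pred (*-cancelˡ-< 2 m (suc ⌊ n /2⌋) (begin-strict
  2 * m                  ≤⟨ h ⟩
  n                      ≤⟨ below-double-half n ⟩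
  suc (2 * ⌊ n /2⌋)      <⟨ ≤-reflexive (ring ⌊ n /2⌋) ⟩
  2 * suc ⌊ n /2⌋        ∎))
  where
  ring : ∀ h → 2 + 2 * h ≡ 2 * (1 + h)
  ring = solve-∀

IsSide : ∀ {n} → Graph n → (Fin n → Bool) → Set
IsSide G X = ∀ i j → adj G i j ≡ true → X i ≢ X j

module Isolated {n} (G : Graph n) (d : ℕ) (deg : ∀ y → count (adj G y) ≤ d) (X : Fin n → Bool) (bip : IsSide G X) where

  touched isolated : Fin n → Bool
  touched y = anyB (λ x → X x ∧ adj G x y)
  isolated = (not ∘ X) ∖ touched

  count-touched : count touched ≤ count X * d
  count-touched = ≤-trans (count-anyB (λ x y → X x ∧ adj G x y)) (≤-trans (sum-mono row) (≤-reflexive (sum-on-const X d)))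
    where
    row : ∀ x → count (λ y → X x ∧ adj G x y) ≤ 𝟙 (X x) * d
    row x with X x
    ... | true  = ≤-trans (deg x) (≤-reflexive (sym (*-identityˡ d)))
    ... | false = ≤-reflexive (count-none {n} (λ _ → refl))

  count-isolated : n ≤ count X + (count X * d + count isolated)
  count-isolated = begin
    n                                          ≡⟨ count-not X ⟨
    count X + count (not ∘ X)                  ≤⟨ +-monoʳ-≤ (count X) (count≤count-∖ (not ∘ X) touched) ⟩
    count X + (count touched + count isolated) ≤⟨ +-monoʳ-≤ (count X) (+-monoˡ-≤ (count isolated) count-touched) ⟩
    count X + (count X * d + count isolated)   ∎

  isolated-no-edge : ∀ i j → isolated i ≡ true → adj G i j ≡ true → ⊥
  isolated-no-edge i j Ii a = true≢false (anyB-intro j (∧-intro Xj (trans (adj-sym G j i) a))) (not-elim (∧-right {not (X i)} Ii))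
    where
    Xj : X j ≡ true
    Xj = case bool-dec (X j) of λ { (inj₁ q) → q ; (inj₂ q) → ⊥-elim (bip i j a (trans (not-elim (∧-left Ii)) (sym q))) }

  enlarge-side : ∀ I → I ⊑ isolated → IsSide G (X ∪ I)
  enlarge-side I I⊑ i j a e = bip i j a (trans (sym (out i (λ Ii → isolated-no-edge i j (I⊑ i Ii) a)))
      (trans e (out j (λ Ij → isolated-no-edge j i (I⊑ j Ij) (trans (adj-sym G j i) a)))))
    where
    out : ∀ i → ¬ (I i ≡ true) → (X ∪ I) i ≡ X i
    out i ne = bool-ext (λ q → [ id , (λ q′ → ⊥-elim (ne q′)) ]′ (∨-elim q)) ∨-introˡ

  -- Isolated vertices may be put on either side; moving them makes the smaller side a constant proportion of the graph.
  enough-isolated : 2 * suc d * count X < n → ⌊ n /2⌋ ∸ count X ≤ count isolated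
  enough-isolated h = m≤n+o⇒m∸n≤o ⌊ n /2⌋ (count X) (*-cancelˡ-≤ 2 (≤-trans (double-half n) bound))
    where
    ring : ∀ n x d i → n + (n + (x + (x * d + i) + (x + (x * d + i)))) + 2 * x ≡ 2 * (x + i) + (2 * (1 + d) * x + (n + n))
    ring = solve-∀
    bound : n ≤ 2 * (count X + count isolated)
    bound = linear {2 * suc d * count X + (n + n)} (2 * count X) (+-mono-≤ (<⇒≤ h) (+-mono-≤ count-isolated count-isolated)) (ring n (count X) d (count isolated))

  half-sized : 2 * count X ≤ n → 2 * suc d * count X < n → ∃ λ X′ → IsSide G X′ × count X′ ≡ ⌊ n /2⌋
  half-sized small h with subset-of-size isolated (⌊ n /2⌋ ∸ count X) (enough-isolated h)
  ... | I , I⊑ , size = X ∪ I , enlarge-side I I⊑ , trans (count-∪-disjoint X I (λ i e f → true≢false e (not-elim (∧-left (I⊑ i f)))))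
        (trans (cong (count X +_) size) (m+[n∸m]≡n (half-mono {count X} small)))

half-large : ∀ n d → 0 < d → 2 ≤ n → n ≤ 2 * suc d * ⌊ n /2⌋
half-large n d 0<d 2≤n = begin
  n                  ≤⟨ below-double-half n ⟩
  1 + 2 * f          ≤⟨ +-monoˡ-≤ (2 * f) (≤-trans (half-mono {1} {n} 2≤n) (m≤m+n f (f + 0))) ⟩
  2 * f + 2 * f      ≡⟨ ring f ⟩
  2 * 2 * f          ≤⟨ *-monoˡ-≤ f (*-monoʳ-≤ 2 (s≤s 0<d)) ⟩
  2 * suc d * f      ∎
  where
  f = ⌊ n /2⌋
  ring : ∀ f → 2 * f + 2 * f ≡ 2 * 2 * f
  ring = solve-∀

balance : ∀ {n} (G : Graph n) d → 0 < d → (∀ y → count (adj G y) ≤ d) → 2 ≤ n → ∀ X → IsSide G X → 2 * count X ≤ n →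
  ∃ λ X′ → IsSide G X′ × 2 * count X′ ≤ n × n ≤ 2 * suc d * count X′
balance {n} G d 0<d deg 2≤n X bip small = [ keep , enlarge ]′ (≤-<-connex n (2 * suc d * count X))
  where
  Result : Set
  Result = ∃ λ X′ → IsSide G X′ × 2 * count X′ ≤ n × n ≤ 2 * suc d * count X′
  keep : n ≤ 2 * suc d * count X → Result
  keep h = X , bip , small , h
  enlarge : 2 * suc d * count X < n → Result
  enlarge h = let X′ , bip′ , size = Isolated.half-sized G d deg X bip small h in
    X′ , bip′ , ≤-trans (≤-reflexive (cong (2 *_) size)) (double-half n) ,
    ≤-trans (half-large n d 0<d 2≤n) (≤-reflexive (cong (2 * suc d *_) (sym size)))

balanced-side : ∀ {n} (G : Graph n) d → 0 < d → (∀ y → count (adj G y) ≤ d) → IsBipartite G → 2 ≤ n →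
  ∃ λ X → IsSide G X × 2 * count X ≤ n × n ≤ 2 * suc d * count X
balanced-side {n} G d 0<d deg (side , bip) 2≤n = case ≤-total (count side) (count (not ∘ side)) of λ
  { (inj₁ h) → balance G d 0<d deg 2≤n side bip (smaller (count side) (count (not ∘ side)) h (count-not side))
  ; (inj₂ h) → balance G d 0<d deg 2≤n (not ∘ side) (λ i j a e → bip i j a (not-injective e))
      (smaller (count (not ∘ side)) (count side) h (trans (+-comm (count (not ∘ side)) (count side)) (count-not side))) }
  where
  open import Data.Bool.Properties using (not-injective)
  smaller : ∀ x y → x ≤ y → x + y ≡ n → 2 * x ≤ n
  smaller x y h e = ≤-trans (+-monoʳ-≤ x (≤-trans (≤-reflexive (+-identityʳ x)) h)) (≤-reflexive e)

Separated : ∀ {n} → Graph n → (Fin n → Bool) → Set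
Separated G Des = ∀ {y y′ x} → Des y ≡ true → Des y′ ≡ true → adj G y x ≡ true → adj G y′ x ≡ true → y ≡ y′

separated-set : ∀ {n} (G : Graph n) d → (∀ y → count (adj G y) ≤ d) → (Y : Fin n → Bool) → ∀ M → M * suc (d * d) ≤ count Y →
  ∃ λ Des → Des ⊑ Y × count Des ≡ M × Separated G Des
separated-set {n} G d deg Y zero h = (λ _ → false) , (λ _ ()) , count-none {n} (λ _ → refl) , λ ()
separated-set {n} G d deg Y (suc M) h with separated-set G d deg Y M (≤-trans (m≤n+m _ _) h)
... | Des , Des⊑ , size , sep = Des ∪ ⁅ y ⁆ , sub , trans (count-∪-disjoint Des ⁅ y ⁆ fresh) (trans (cong₂ _+_ size (count-≟ y)) (+-comm M 1)) , sep′
  where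
  shares : Fin n → Fin n → Bool
  shares y′ y = anyB (λ x → adj G y′ x ∧ adj G x y)
  blocks : Fin n → Fin n → Bool
  blocks y′ y = Des y′ ∧ (⁅ y′ ⁆ y ∨ shares y′ y)
  blocked : Fin n → Bool
  blocked y = anyB (λ y′ → blocks y′ y)
  count-shares : ∀ y′ → count (shares y′) ≤ d * d
  count-shares y′ = begin
    count (shares y′)                                ≤⟨ count-anyB (λ x y → adj G y′ x ∧ adj G x y) ⟩
    sum (λ x → count (λ y → adj G y′ x ∧ adj G x y))  ≤⟨ sum-mono row ⟩
    sum (λ x → 𝟙 (adj G y′ x) * d)                   ≡⟨ sum-on-const (adj G y′) d ⟩
    count (adj G y′) * d                             ≤⟨ *-monoˡ-≤ d (deg y′) ⟩
    d * d                                            ∎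
    where
    row : ∀ x → count (λ y → adj G y′ x ∧ adj G x y) ≤ 𝟙 (adj G y′ x) * d
    row x with adj G y′ x
    ... | true  = ≤-trans (deg x) (≤-reflexive (sym (*-identityˡ d)))
    ... | false = ≤-reflexive (count-none {n} (λ _ → refl))
  count-blocks : ∀ y′ → count (blocks y′) ≤ 𝟙 (Des y′) * suc (d * d)
  count-blocks y′ with Des y′
  ... | true  = ≤-trans (≤-trans (count-∪ ⁅ y′ ⁆ (shares y′)) (+-mono-≤ (≤-reflexive (count-≟ y′)) (count-shares y′))) (≤-reflexive (sym (*-identityˡ _)))
  ... | false = ≤-reflexive (count-none {n} (λ _ → refl))
  count-blocked : count blocked < count Y
  count-blocked = ≤-trans (s≤s (begin
    count blocked                            ≤⟨ count-anyB blocks ⟩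
    sum (λ y′ → count (blocks y′))           ≤⟨ sum-mono count-blocks ⟩
    sum (λ y′ → 𝟙 (Des y′) * suc (d * d))    ≡⟨ trans (sum-on-const Des _) (cong (_* suc (d * d)) size) ⟩
    M * suc (d * d)                          ≤⟨ m≤n+m _ (d * d) ⟩
    d * d + M * suc (d * d)                  ∎)) h
  picked = pick-∖ Y blocked count-blocked
  y = proj₁ picked
  free : ∀ {y′} → Des y′ ≡ true → ⁅ y′ ⁆ y ∨ shares y′ y ≡ true → ⊥
  free {y′} e f = true≢false (anyB-intro y′ (∧-intro e f)) (proj₂ (proj₂ picked))
  sub : (Des ∪ ⁅ y ⁆) ⊑ Y
  sub z e = [ Des⊑ z , (λ f → subst (λ z → Y z ≡ true) (does-elim (y ≟ z) f) (proj₁ (proj₂ picked))) ]′ (∨-elim e)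
  fresh : Disjoint Des ⁅ y ⁆
  fresh z e f = free e (∨-introˡ (does-true (z ≟ y) (sym (does-elim (y ≟ z) f))))
  clash : ∀ {y′ y″ x} → Des y′ ≡ true → ⁅ y ⁆ y″ ≡ true → adj G y′ x ≡ true → adj G y″ x ≡ true → ⊥
  clash {y′} {y″} {x} e f a a″ with does-elim (y ≟ y″) f
  ... | refl = free e (∨-introʳ {⁅ y′ ⁆ y} (anyB-intro x (∧-intro a (trans (adj-sym G x y) a″))))
  sep′ : Separated G (Des ∪ ⁅ y ⁆)
  sep′ {y₁} {y₂} e f a₁ a₂ with ∨-elim {Des y₁} e | ∨-elim {Des y₂} f
  ... | inj₁ e₁ | inj₁ f₁ = sep e₁ f₁ a₁ a₂
  ... | inj₁ e₁ | inj₂ f₂ = ⊥-elim (clash e₁ f₂ a₁ a₂)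
  ... | inj₂ e₂ | inj₁ f₁ = ⊥-elim (clash f₁ e₂ a₂ a₁)
  ... | inj₂ e₂ | inj₂ f₂ = trans (sym (does-elim (y ≟ y₁) e₂)) (does-elim (y ≟ y₂) f₂)

∪-⊑ : ∀ {n} (p q : Fin n → Bool) {r} → p ⊑ r → q ⊑ r → (p ∪ q) ⊑ r
∪-⊑ p q pr qr i e = [ pr i , qr i ]′ (∨-elim {p i} {q i} e)

∖-intro : ∀ {n} (p q : Fin n → Bool) i → p i ≡ true → ¬ (q i ≡ true) → (p ∖ q) i ≡ true
∖-intro p q i e ne = ∧-intro e (not-intro (¬true⇒false ne))

module Assembly (F : GraphSeq) (bip : BipartiteSeq F) (d : ℕ) (0<d : 0 < d) (deg : ∀ k y → count (adj (F k) y) ≤ d)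
  (L : ℕ) (L-large : 2 * d * (8 * 4 ^ d) < L) {N : ℕ} (c : TwoColoring N) where

  open Covers F c
  open Removals F c
  open Ramsey F bip d 0<d deg L L-large c using (ramsey)
  open PartialEmbedding

  removal-resp : ∀ {M R E E′} → E ⊑ E′ → E′ ⊑ E → Removal M R E → Removal M R E′
  removal-resp {M} {R} {E} {E′} h h′ r = record { removed⊑ = λ v e → removed⊑ r v (h′ v e)
    ; restore = λ {Z} {m} RZ C → restore r RZ (cover-resp
        (λ v e → ∧-intro (∧-left e) (not-intro (¬true⇒false λ q → true≢false (h v q) (not-elim (∧-right {Z v} e)))))
        (λ v e → ∧-intro (∧-left e) (not-intro (¬true⇒false λ q → true≢false (h′ v q) (not-elim (∧-right {Z v} e))))) C) }

  removal-exact : ∀ {k Z} → Copy k Z → count Z ≤ k → Removal 1 Z Z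
  removal-exact {k} {Z} P h = removal-resp (vertices⊑ P)
    (⊑-full (vertices P) Z (vertices⊑ P) (≤-trans h (≤-reflexive (sym (count-vertices P))))) (remove-copy P)

  trim : ∀ R S n → S ⊑ R → n ≤ count R → L * (count R ∸ n) ≤ count S →
    ∃ λ E → E ⊑ S × count (R ∖ E) ≡ n × Removal 1 R E
  trim R S n S⊑R n≤ room = go (count R ∸ n) refl
    where
    Result : Set
    Result = ∃ λ E → E ⊑ S × count (R ∖ E) ≡ n × Removal 1 R E
    go : ∀ z → count R ∸ n ≡ z → Result
    go zero e = (λ _ → false) , (λ _ ()) , trans (count-cong λ v → bool-ext ∧-left (λ q → ∧-intro q refl)) (≤-antisym (m∸n≡0⇒m≤n e) n≤) ,
      removal-more z≤n remove-nothing
    go z@(suc _) e = vertices P , vertices⊑ P , +-cancelˡ-≡ z _ _ (trans (sym (count-rest P R S⊑R)) (trans (sym (m∸n+n≡m n≤)) (cong (_+ n) e))) ,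
      removal-weaken S⊑R (remove-copy P)
      where
      P : Copy z S
      P = ramsey z (s≤s z≤n) S (subst (λ z → L * z ≤ count S) e room)

  module _ (b : Bool) (C : ℕ) where

    sparse-copy : ∀ k′ S → IsSide (F k′) S → ∀ Lo P → Disjoint Lo P → count Lo ≡ count S →
      (∀ l → Lo l ≡ true → count (P ∖ edge b l) * (2 * d) ≤ C) → C + 2 * suc k′ ≤ 2 * count P →
      ∃ λ E → E ⊑ P × count E ≡ count (not ∘ S) × Removal 1 (Lo ∪ E) (Lo ∪ E)
    sparse-copy k′ S side Lo P dis size sparse room = E , E⊑P , count-E , removal-exact whole
        (≤-trans (count-∪ Lo E) (≤-reflexive (trans (cong₂ _+_ size count-E) (count-not S))))
      where
      G = F k′
      open Candidates G (edge b)
      M₁ : Matching S Lo (λ _ _ → true)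
      M₁ = hall-greedy S Lo (λ _ _ → true) λ y _ → ≤-trans (≤-reflexive (sym size)) (count-mono λ v e → ∧-intro e refl)
      ρ = Matching.match M₁
      pe : PartialEmbedding S Lo ρ
      pe = record { injective = Matching.injective M₁ ; domain = λ e → proj₁ (Matching.sound M₁ e) ; range = λ e → proj₁ (proj₂ (Matching.sound M₁ e)) }
      full : S ⊑ dom ρ
      full x e = dom-intro {ρ = ρ} (proj₂ (Matching.total M₁ x e))
      misses : Fin (suc k′) → Fin (suc k′) → Fin N → Bool
      misses y x v = adj G y x ∧ (P v ∧ not (sees (ρ x) v))
      count-misses : ∀ y x → count (misses y x) * (2 * d) ≤ 𝟙 (adj G y x) * C
      count-misses y x with adj G y x
      ... | false = ≤-reflexive (cong (_* (2 * d)) (count-none {N} (λ _ → refl)))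
      ... | true with ρ x in e
      ... | just l  = ≤-trans (sparse l (proj₁ (proj₂ (Matching.sound M₁ e)))) (≤-reflexive (sym (*-identityˡ C)))
      ... | nothing = ≤-trans (≤-reflexive (cong (_* (2 * d)) (count-none {N} λ v → ¬true⇒false λ q → true≢false refl (not-elim (∧-right {P v} q))))) z≤n
      uncovered : ∀ y → 2 * count (P ∖ cand ρ y) ≤ C
      uncovered y = *-cancelʳ-≤ _ C d {{>-nonZero 0<d}} (begin
        2 * count (P ∖ cand ρ y) * d                      ≡⟨ ring (count (P ∖ cand ρ y)) d ⟩
        count (P ∖ cand ρ y) * (2 * d)                    ≤⟨ *-monoˡ-≤ (2 * d) (≤-trans (count-mono missed) (count-anyB (misses y))) ⟩
        sum (λ x → count (misses y x)) * (2 * d)          ≡⟨ sum-* (2 * d) _ ⟩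
        sum (λ x → count (misses y x) * (2 * d))          ≤⟨ sum-mono (count-misses y) ⟩
        sum (λ x → 𝟙 (adj G y x) * C)                     ≡⟨ sum-on-const (adj G y) C ⟩
        count (adj G y) * C                               ≤⟨ *-monoˡ-≤ C (deg k′ y) ⟩
        d * C                                             ≡⟨ *-comm d C ⟩
        C * d                                             ∎)
        where
        ring : ∀ x d → 2 * x * d ≡ x * (2 * d)
        ring = solve-∀
        missed : (P ∖ cand ρ y) ⊑ (λ v → anyB (λ x → misses y x v))
        missed v e = case bool-dec (anyB (λ x → misses y x v)) of λ
          { (inj₁ q) → q
          ; (inj₂ q) → ⊥-elim (true≢false (cand-intro {ρ} {y} {v} λ x a yx ρx → case bool-dec (edge b a v) of λ
              { (inj₁ r) → r
              ; (inj₂ r) → ⊥-elim (true≢false (∧-intro yx (∧-intro (∧-left e) (not-intro (trans (cong (λ m → sees m v) ρx) r)))) (anyB-false q x)) })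
              (not-elim (∧-right {P v} e))) }
      M₂ : Matching (not ∘ S) P (cand ρ)
      M₂ = hall-greedy (not ∘ S) P (cand ρ) λ y _ → ≤-trans (≤-trans (m≤n+m (count (not ∘ S)) (count S)) (≤-reflexive (count-not S)))
        (*-cancelˡ-≤ 2 (linear {C + 2 * suc k′ + (2 * count P + 2 * count (P ∖ cand ρ y))} 0
          (+-mono-≤ room (+-mono-≤ (*-monoʳ-≤ 2 (≤-reflexive (count-split P (cand ρ y)))) (uncovered y)))
          (ring (suc k′) (count P) (count (P ∩ cand ρ y)) (count (P ∖ cand ρ y)) C)))
        where
        ring : ∀ k p x u C → 2 * k + (2 * p + (2 * (x + u) + C)) + 0 ≡ 2 * x + (C + 2 * k + (2 * p + 2 * u))
        ring = solve-∀
      module M₂ = Matching M₂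
      E = image M₂.match
      E⊑P : E ⊑ P
      E⊑P v e = let y , q = image-elim {ρ = M₂.match} {v} e in proj₁ (proj₂ (M₂.sound {y} {v} q))
      count-E : count E ≡ count (not ∘ S)
      count-E = ≤-antisym (≤-trans (count-image≤dom M₂.match) (count-mono {p = dom M₂.match} {q = not ∘ S} λ x e → let v , q = dom-elim {ρ = M₂.match} {x} e in proj₁ (M₂.sound {x} {v} q)))
        (≤-trans (count-mono {p = not ∘ S} {q = dom M₂.match} λ x e → dom-intro {ρ = M₂.match} {x} (proj₂ (M₂.total x e))) (injective-count M₂.match M₂.injective))
      M₃ : Matching (not ∘ S) E (cand ρ)
      M₃ = record { match = M₂.match ; total = M₂.total ; injective = λ {x} {y} {v} e f → M₂.injective {x} {y} {v} e f
        ; sound = λ {y} {v} e → proj₁ (M₂.sound {y} {v} e) , image-intro {ρ = M₂.match} {y} {v} e , proj₂ (proj₂ (M₂.sound {y} {v} e)) }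
      whole : Copy (suc k′) (Lo ∪ E)
      whole = bipartite-copy {k′} b S side {Lo} {E} {Lo ∪ E} ρ pe full (λ v q → ∨-introˡ {Lo v} {E v} q) (λ v q → ∨-introʳ {Lo v} {E v} q)
        (λ {x} {v} e q → dis v (range pe {x} {v} e) (E⊑P v q)) M₃

    sparse-removal : ∀ Lo P → Disjoint Lo P → (∀ l → Lo l ≡ true → count (P ∖ edge b l) * (2 * d) ≤ C) →
      C + 4 * count Lo ≤ 2 * count P → ∃ λ E → E ⊑ P × count E ≡ count Lo × Removal 2 (Lo ∪ P) (Lo ∪ E)
    sparse-removal Lo P dis sparse room = go (count Lo) refl
      where
      Result : Set
      Result = ∃ λ E → E ⊑ P × count E ≡ count Lo × Removal 2 (Lo ∪ P) (Lo ∪ E)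
      go : ∀ ℓ → count Lo ≡ ℓ → Result
      go zero e = (λ _ → false) , (λ _ ()) , trans (count-none {N} (λ _ → refl)) (sym e) ,
        removal-more z≤n (removal-resp (λ _ ()) (λ v q → ⊥-elim ([ (λ q → true≢false q (count-zero (≤-reflexive e) v)) , (λ ()) ]′ (∨-elim {Lo v} q))) remove-nothing)
      go (suc k′) e = E₁ ∪ E₂ , ∪-⊑ E₁ E₂ E₁⊑ (λ v q → ∧-left {P v} (E₂⊑ v q)) , size-E ,
          removal-resp forth back (remove-both {1} {1} {Lo ∪ P} {L₁ ∪ E₁} {L₂ ∪ E₂} (removal-weaken sub₁ r₁) (removal-weaken sub₂ r₂))
        where
        S = proj₁ (bip k′)
        side = proj₂ (bip k′)
        part = subset-of-size Lo (count S) (≤-trans (count≤n S) (≤-reflexive (sym e)))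
        L₁ = proj₁ part
        L₁⊑ = proj₁ (proj₂ part)
        size₁ = proj₂ (proj₂ part)
        L₂ = Lo ∖ L₁
        size₂ : count L₂ ≡ count (not ∘ S)
        size₂ = +-cancelˡ-≡ (count S) _ _ (trans (cong (_+ count L₂) (sym size₁)) (trans (sym (count-∖-⊑ Lo L₁ L₁⊑)) (trans e (sym (count-not S)))))
        room′ : C + 4 * suc k′ ≤ 2 * count P
        room′ = subst (λ ℓ → C + 4 * ℓ ≤ 2 * count P) e room
        first = sparse-copy k′ S side L₁ P (λ v q → dis v (L₁⊑ v q)) size₁ (λ l q → sparse l (L₁⊑ l q))
          (≤-trans (+-monoʳ-≤ C (*-monoˡ-≤ (suc k′) (m≤m+n 2 2))) room′)
        E₁ = proj₁ first
        E₁⊑ = proj₁ (proj₂ first)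
        size-E₁ = proj₁ (proj₂ (proj₂ first))
        r₁ = proj₂ (proj₂ (proj₂ first))
        P₂ = P ∖ E₁
        room₂ : C + 2 * suc k′ ≤ 2 * count P₂
        room₂ = linear {C + 4 * suc k′ + (2 * count P + 2 * count E₁)} 0
          (+-mono-≤ room′ (+-mono-≤ (*-monoʳ-≤ 2 (≤-reflexive (count-∖-⊑ P E₁ E₁⊑))) (*-monoʳ-≤ 2 (≤-trans (≤-reflexive size-E₁) (count≤n (not ∘ S))))))
          (ring C (suc k′) (count P) (count E₁) (count P₂))
          where
          ring : ∀ C k p e p₂ → C + 2 * k + (2 * p + (2 * (e + p₂) + 2 * k)) + 0 ≡ 2 * p₂ + (C + 4 * k + (2 * p + 2 * e))
          ring = solve-∀
        sparse₂ : ∀ l → L₂ l ≡ true → count (P₂ ∖ edge b l) * (2 * d) ≤ C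
        sparse₂ l q = ≤-trans (*-monoˡ-≤ (2 * d) (count-mono {p = P₂ ∖ edge b l} {q = P ∖ edge b l} λ v r →
          ∧-intro (∧-left {P v} (∧-left {P₂ v} r)) (∧-right {P₂ v} r))) (sparse l (∧-left {Lo l} q))
        side′ : IsSide (F k′) (not ∘ S)
        side′ i j a q = side i j a (not-injective q)
          where open import Data.Bool.Properties using (not-injective)
        dis₂ : Disjoint L₂ P₂
        dis₂ v q q′ = dis v (∧-left {Lo v} q) (∧-left {P v} q′)
        second : ∃ λ E → E ⊑ P₂ × count E ≡ count (not ∘ (not ∘ S)) × Removal 1 (L₂ ∪ E) (L₂ ∪ E)
        second = sparse-copy k′ (not ∘ S) side′ L₂ P₂ dis₂ size₂ sparse₂ room₂
        E₂ = proj₁ second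
        E₂⊑ : E₂ ⊑ P₂
        E₂⊑ = proj₁ (proj₂ second)
        size-E₂ = proj₁ (proj₂ (proj₂ second))
        r₂ = proj₂ (proj₂ (proj₂ second))
        dis-E : Disjoint E₁ E₂
        dis-E v q q′ = true≢false q (not-elim (∧-right {P v} (E₂⊑ v q′)))
        size-E : count (E₁ ∪ E₂) ≡ count Lo
        size-E = trans (count-∪-disjoint E₁ E₂ dis-E) (trans (cong₂ _+_ size-E₁ size-E₂) (trans (count-not (not ∘ S)) (sym e)))
        sub₁ : (L₁ ∪ E₁) ⊑ (Lo ∪ P)
        sub₁ = ∪-⊑ L₁ E₁ (λ v r → ∨-introˡ {Lo v} {P v} (L₁⊑ v r)) (λ v r → ∨-introʳ {Lo v} {P v} (E₁⊑ v r))
        sub₂ : (L₂ ∪ E₂) ⊑ ((Lo ∪ P) ∖ (L₁ ∪ E₁))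
        sub₂ = ∪-⊑ L₂ E₂
          (λ v r → ∖-intro (Lo ∪ P) (L₁ ∪ E₁) v (∨-introˡ {Lo v} {P v} (∧-left {Lo v} r)) λ s → [ ∖-disjoint Lo L₁ v r , (λ t → dis v (∧-left {Lo v} r) (E₁⊑ v t)) ]′ (∨-elim {L₁ v} {E₁ v} s))
          (λ v r → ∖-intro (Lo ∪ P) (L₁ ∪ E₁) v (∨-introʳ {Lo v} {P v} (∧-left {P v} (E₂⊑ v r))) λ s → [ (λ t → dis v (L₁⊑ v t) (∧-left {P v} (E₂⊑ v r))) , (λ t → dis-E v t r) ]′ (∨-elim {L₁ v} {E₁ v} s))
        forth : ((L₁ ∪ E₁) ∪ (L₂ ∪ E₂)) ⊑ (Lo ∪ (E₁ ∪ E₂))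
        forth = ∪-⊑ (L₁ ∪ E₁) (L₂ ∪ E₂)
          (∪-⊑ L₁ E₁ (λ v s → ∨-introˡ {Lo v} {(E₁ ∪ E₂) v} (L₁⊑ v s)) (λ v s → ∨-introʳ {Lo v} {(E₁ ∪ E₂) v} (∨-introˡ {E₁ v} {E₂ v} s)))
          (∪-⊑ L₂ E₂ (λ v s → ∨-introˡ {Lo v} {(E₁ ∪ E₂) v} (∧-left {Lo v} s)) (λ v s → ∨-introʳ {Lo v} {(E₁ ∪ E₂) v} (∨-introʳ {E₁ v} {E₂ v} s)))
        back : (Lo ∪ (E₁ ∪ E₂)) ⊑ ((L₁ ∪ E₁) ∪ (L₂ ∪ E₂))
        back = ∪-⊑ Lo (E₁ ∪ E₂)
          (λ v r → [ (λ s → ∨-introˡ {(L₁ ∪ E₁) v} {(L₂ ∪ E₂) v} (∨-introˡ {L₁ v} {E₁ v} s))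
                   , (λ s → ∨-introʳ {(L₁ ∪ E₁) v} {(L₂ ∪ E₂) v} (∨-introˡ {L₂ v} {E₂ v} (∧-intro r (not-intro s)))) ]′ (bool-dec (L₁ v)))
          (∪-⊑ E₁ E₂ (λ v s → ∨-introˡ {(L₁ ∪ E₁) v} {(L₂ ∪ E₂) v} (∨-introʳ {L₁ v} {E₁ v} s)) (λ v s → ∨-introʳ {(L₁ ∪ E₁) v} {(L₂ ∪ E₂) v} (∨-introʳ {L₂ v} {E₂ v} s)))

-- Covering a dense pair

-- The hierarchy of constants w ≪ ρ ≪ s₂ ≪ s₀ ≪ s₁ ≪ n under which a pair of size m, dense at scale w with density 1/D, can be finished
-- off together with ρ further vertices.
record Scale (d L m w D ρ n a q : ℕ) : Set where
  field
    s₂ ρ₁ tmin J τ y₀ s₀ s₁ z₂ lb : ℕ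
    0<D         : 0 < D
    2d≤D        : 2 * d ≤ D
    size        : m ≡ n + ρ₁
    slack       : ρ + 3 * w ≤ ρ₁
    fits        : a + s₂ ≤ m
    w≤s₂        : w ≤ s₂
    sparse-room : 4 * ρ + 10 * w ≤ s₂
    degree-room : 2 * ((ρ + 3 * w) * D) ≤ s₂
    trim-room   : L * (ρ₁ + (ρ + w)) + ((ρ + 3 * w) + (a + s₂)) ≤ m
    0<tmin      : 0 < tmin
    tmin-large  : (2 * D) ^ d * w ≤ tmin
    2≤J         : 2 ≤ J
    grow        : ∀ c → c ≤ n → suc J ^ c ≤ 2 ^ τ * J ^ c
    Des-room    : 2 * (2 * (2 * D)) ^ d * y₀ * suc (d * d) ≤ q
    y₀-large    : s₀ + (τ + 1 + lb) ≤ y₀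
    n≤2^lb      : n ≤ 2 ^ lb
    room        : d * w + J * ((J * J) ^ d * (d * w)) + (ρ + 3 * w) ≤ s₂
    room-Des    : (d * (2 * (2 * (2 * D)) ^ d * y₀) + d * w) * (2 * (2 * D)) ≤ a
    s₀-large    : z₂ + tmin ≤ s₀
    s₁-large    : z₂ + (τ + 1 + τ) ≤ s₁
    K₀-share    : s₁ * (2 * D) ^ d + z₂ ≤ q
    K₀-tmin     : tmin + z₂ ≤ q
    leftover    : s₂ + (ρ + w) ≤ z₂
    positive    : 0 < J * ((J * J) ^ d * (d * w))

module Half {n : ℕ} (G : Graph n) {N : ℕ} (g : Fin N → Fin N → Bool) (d : ℕ) (deg : ∀ y → count (adj G y) ≤ d)
  (X : Fin n → Bool) (side : IsSide G X) {L m w D ρ : ℕ} (scale : Scale d L m w D ρ n (count X) (count (not ∘ X))) where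

  open Scale scale
  private
    a = count X
    q = count (not ∘ X)

  Flexible : (U K₀ B : Fin N → Bool) → Set
  Flexible U K₀ B = ∃ λ (φ : PartialMap {n} {N}) → PartialEmbedding X U φ × X ⊑ dom φ ×
    (∀ W → K₀ ⊑ W → W ⊑ B → count W ≡ q → count W ≤ count K₀ + z₂ → Matching (not ∘ X) W (Candidates.cand G g φ))

  half : ∀ (U K₀ B : Fin N → Bool) →
    (∀ T → T ⊑ K₀ → w ≤ count T → count (U ∩ (λ a → suc (count (T ∩ g a) * (2 * D)) ≤ᵇ count T)) ≤ w) →
    (∀ b → B b ≡ true → count U ≤ count (U ∩ (λ a → g a b)) * (2 * D)) →
    a + s₂ ≤ count U + (ρ + 3 * w) → q ≤ count K₀ + z₂ → count K₀ ≤ n → count B ≤ n →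
    Flexible U K₀ B
  half U K₀ B typical min-degree U-large K₀-large K₀≤n B≤n =
    let M = 2 * (2 * (2 * D)) ^ d * y₀
        Des , Des⊑ , size-Des , sep = separated-set G d deg (not ∘ X) M Des-room
    in OneSided.one-sided G g d deg U K₀ (2 * D) w tmin (*-mono-< {0} {2} {0} {D} (s≤s z≤n) 0<D) 0<tmin tmin-large typical X side B min-degree
        Des Des⊑ sep J τ y₀ s₀ s₁ z₂ lb 2≤J grow (+-cancelʳ-≤ z₂ tmin (count K₀) (≤-trans K₀-tmin K₀-large)) K₀≤n size-Des y₀-large (≤-trans B≤n n≤2^lb)
        (≤-trans room′ (n≤1+n (count U)))
        (subst (λ k → (d * k + d * w) * (2 * (2 * D)) ≤ count U) (sym size-Des) (≤-trans room-Des a≤U))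
        s₀-large s₁-large (+-cancelʳ-≤ z₂ (s₁ * (2 * D) ^ d) (count K₀) (≤-trans K₀-share K₀-large)) positive
    where
    e = J * ((J * J) ^ d * (d * w))
    room′ : a + d * w + e ≤ count U
    room′ = linear {d * w + e + (ρ + 3 * w) + (a + s₂)} 0 (+-mono-≤ room U-large) (ring a (d * w) e (ρ + 3 * w) s₂ (count U))
      where
      ring : ∀ a x e r s u → a + x + e + (s + (u + r)) + 0 ≡ u + (x + e + r + (a + s))
      ring = solve-∀
    a≤U : a ≤ count U
    a≤U = ≤-trans (≤-trans (m≤m+n a (d * w)) (m≤m+n (a + d * w) e)) room′

module Finish (F : GraphSeq) (bip : BipartiteSeq F) (d : ℕ) (0<d : 0 < d) (deg : ∀ k y → count (adj (F k) y) ≤ d)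
  (L : ℕ) (L-large : 2 * d * (8 * 4 ^ d) < L) {N : ℕ} (c : TwoColoring N) (b : Bool) (k′ : ℕ)
  (X : Fin (suc k′) → Bool) (side : IsSide (F k′) X)
  {m w D ρ : ℕ} (scale : Scale d L m w D ρ (suc k′) (count X) (count (not ∘ X)))
  (A B R : Fin N → Bool) (A-B : Disjoint A B) (size-A : count A ≡ m) (size-B : count B ≡ m) (size-R : count R ≤ ρ) where

  open Scale scale
  open Covers F c
  open Removals F c
  open Assembly F bip d 0<d deg L L-large c
  open Ramsey F bip d 0<d deg L L-large c using (edge-not)
  open Half (F k′) (edge b) d (deg k′) X side scale

  private
    g : Fin N → Fin N → Bool
    g = edge b
    n a q : ℕ
    n = suc k′
    a = count X
    q = count (not ∘ X)
    a+q : a + q ≡ n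
    a+q = count-not X

  low : (Fin N → Bool) → Fin N → Bool
  low T v = suc (count (T ∩ g v) * D) ≤ᵇ count T

  module _ (dense-A : ∀ T → T ⊑ B → w ≤ count T → count (A ∩ low T) ≤ w) (dense-B : ∀ T → T ⊑ A → w ≤ count T → count (B ∩ low T) ≤ w) where

    private
      chosen-A = subset-of-size A (a + s₂) (≤-trans fits (≤-reflexive (sym size-A)))
      chosen-B = subset-of-size B (a + s₂) (≤-trans fits (≤-reflexive (sym size-B)))

    Au Bu Z A′ B′ Lo P : Fin N → Bool
    Au = proj₁ chosen-A
    Bu = proj₁ chosen-B
    Z = A ∪ (B ∪ R)
    A′ = A ∖ low Bu
    B′ = (Z ∖ A′) ∖ low Au
    Lo = (Z ∖ A′) ∩ low Au
    P = Au ∖ low Bu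

    Au⊑A : Au ⊑ A
    Au⊑A = proj₁ (proj₂ chosen-A)
    Bu⊑B : Bu ⊑ B
    Bu⊑B = proj₁ (proj₂ chosen-B)
    count-Au : count Au ≡ a + s₂
    count-Au = proj₂ (proj₂ chosen-A)
    count-Bu : count Bu ≡ a + s₂
    count-Bu = proj₂ (proj₂ chosen-B)

    low-A : count (A ∩ low Bu) ≤ w
    low-A = dense-A Bu Bu⊑B (≤-trans w≤s₂ (≤-trans (m≤n+m s₂ a) (≤-reflexive (sym count-Bu))))
    low-B : count (B ∩ low Au) ≤ w
    low-B = dense-B Au Au⊑A (≤-trans w≤s₂ (≤-trans (m≤n+m s₂ a) (≤-reflexive (sym count-Au))))

    Z-cases : ∀ v → Z v ≡ true → A′ v ≡ false → B v ≡ true ⊎ (R ∪ (A ∩ low Bu)) v ≡ true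
    Z-cases v z na = case ∨-elim {A v} z of λ
      { (inj₁ e) → inj₂ (∨-introʳ {R v} (∧-intro e (case bool-dec (low Bu v) of λ
          { (inj₁ l) → l ; (inj₂ nl) → ⊥-elim (true≢false (∧-intro e (not-intro nl)) na) })))
      ; (inj₂ e) → case ∨-elim {B v} e of λ { (inj₁ f) → inj₁ f ; (inj₂ f) → inj₂ (∨-introˡ {R v} {(A ∩ low Bu) v} f) } }

    count-extra : count (R ∪ (A ∩ low Bu)) ≤ ρ + w
    count-extra = ≤-trans (count-∪ R (A ∩ low Bu)) (+-mono-≤ size-R low-A)

    count-Lo : count Lo ≤ ρ + w + w
    count-Lo = ≤-trans (count-⊎ (R ∪ (A ∩ low Bu)) (B ∩ low Au) Lo split) (+-mono-≤ count-extra low-B)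
      where
      split : ∀ v → Lo v ≡ true → (R ∪ (A ∩ low Bu)) v ≡ true ⊎ (B ∩ low Au) v ≡ true
      split v e = case Z-cases v (∧-left {Z v} (∧-left {(Z ∖ A′) v} e)) (not-elim (∧-right {Z v} (∧-left {(Z ∖ A′) v} e))) of λ
        { (inj₁ f) → inj₂ (∧-intro f (∧-right {(Z ∖ A′) v} e)) ; (inj₂ f) → inj₁ f }

    P⊑A′ : P ⊑ A′
    P⊑A′ v e = ∧-intro (Au⊑A v (∧-left {Au v} e)) (∧-right {Au v} e)

    Lo-P : Disjoint Lo P
    Lo-P v e f = ∖-disjoint Z A′ v (∧-left {(Z ∖ A′) v} e) (P⊑A′ v f)

    count-P : a + s₂ ≤ w + count P
    count-P = begin
      a + s₂                            ≡⟨ count-Au ⟨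
      count Au                          ≡⟨ count-split Au (low Bu) ⟩
      count (Au ∩ low Bu) + count P     ≤⟨ +-monoˡ-≤ (count P) (≤-trans (count-mono {p = Au ∩ low Bu} {q = A ∩ low Bu} λ v e → ∧-intro (Au⊑A v (∧-left {Au v} e)) (∧-right {Au v} e)) low-A) ⟩
      w + count P                       ∎

    Lo-sparse : ∀ l → Lo l ≡ true → count (P ∖ edge (not b) l) * (2 * d) ≤ a + s₂
    Lo-sparse l e = begin
      count (P ∖ edge (not b) l) * (2 * d)     ≤⟨ *-mono-≤ (count-mono {p = P ∖ edge (not b) l} {q = Au ∩ g l} inside) 2d≤D ⟩
      count (Au ∩ g l) * D                     ≤⟨ <⇒≤ (≤ᵇ-elim {suc (count (Au ∩ g l) * D)} {count Au} (∧-right {(Z ∖ A′) l} e)) ⟩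
      count Au                                 ≡⟨ count-Au ⟩
      a + s₂                                   ∎
      where
      not-not : ∀ {x} → not (not x) ≡ true → x ≡ true
      not-not {true} _ = refl
      inside : (P ∖ edge (not b) l) ⊑ (Au ∩ g l)
      inside v f = ∧-intro (∧-left {Au v} (∧-left {P v} f)) (not-not (trans (cong not (sym (edge-not b l v))) (∧-right {P v} f)))

    sparse-part : ∃ λ E → E ⊑ P × count E ≡ count Lo × Removal 2 (Lo ∪ P) (Lo ∪ E)
    sparse-part = sparse-removal (not b) (a + s₂) Lo P Lo-P Lo-sparse
      (linear {4 * count Lo + (4 * ρ + 10 * w) + (2 * (a + s₂))} a (+-mono-≤ (+-mono-≤ (*-monoʳ-≤ 4 count-Lo) sparse-room) (*-monoʳ-≤ 2 count-P))
        (ring a s₂ (count Lo) ρ w (count P)))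
      where
      ring : ∀ a s l r w p → a + s + 4 * l + (4 * (r + w + w) + s + 2 * (w + p)) + a ≡ 2 * p + (4 * l + (4 * r + 10 * w) + 2 * (a + s))
      ring = solve-∀

    E A₁ : Fin N → Bool
    E = proj₁ sparse-part
    A₁ = A′ ∖ E

    E⊑P : E ⊑ P
    E⊑P = proj₁ (proj₂ sparse-part)

    count-E : count E ≤ ρ + w + w
    count-E = ≤-trans (≤-reflexive (proj₁ (proj₂ (proj₂ sparse-part)))) count-Lo

    count-A₁ : m ≤ (ρ + 3 * w) + count A₁
    count-A₁ = begin
      m                                          ≡⟨ size-A ⟨
      count A                                    ≡⟨ count-split A (low Bu) ⟩
      count (A ∩ low Bu) + count A′              ≡⟨ cong (count (A ∩ low Bu) +_) (count-∖-⊑ A′ E (λ v e → P⊑A′ v (E⊑P v e))) ⟩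
      count (A ∩ low Bu) + (count E + count A₁)  ≤⟨ +-mono-≤ low-A (+-monoˡ-≤ (count A₁) count-E) ⟩
      w + (ρ + w + w + count A₁)                 ≡⟨ ring w ρ (count A₁) ⟩
      (ρ + 3 * w) + count A₁                     ∎
      where
      ring : ∀ w r x → w + (r + w + w + x) ≡ r + 3 * w + x
      ring = solve-∀

    A₁⊑A : A₁ ⊑ A
    A₁⊑A v e = ∧-left {A v} (∧-left {A′ v} e)

    trim-A : ∃ λ T → T ⊑ (A₁ ∖ Au) × count (A₁ ∖ T) ≡ n × Removal 1 A₁ T
    trim-A = trim A₁ (A₁ ∖ Au) n (λ v → ∧-left {A₁ v}) n≤A₁ (≤-trans (*-monoʳ-≤ L excess)
      (linear {L * (ρ₁ + (ρ + w)) + ((ρ + 3 * w) + (a + s₂)) + m + count A₁ + L * ρ₁} 0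
        (+-mono-≤ (+-mono-≤ (+-mono-≤ trim-room count-A₁) (≤-trans (count≤count-∖ A₁ Au) (+-monoˡ-≤ (count (A₁ ∖ Au)) (≤-reflexive count-Au)))) (*-monoʳ-≤ L (m≤m+n ρ₁ (ρ + w))))
        (ring (L * ρ₁) (L * (ρ₁ + (ρ + w))) (ρ + 3 * w) (a + s₂) m (count A₁) (count (A₁ ∖ Au)))))
      where
      n≤A₁ : n ≤ count A₁
      n≤A₁ = linear {m + (ρ + 3 * w) + (n + ρ₁)} 0 (+-mono-≤ (+-mono-≤ count-A₁ slack) (≤-reflexive (sym size))) (ring₂ n m (ρ + 3 * w) ρ₁ (count A₁))
        where
        ring₂ : ∀ n m r r₁ x → n + (r + x + r₁ + m) + 0 ≡ x + (m + r + (n + r₁))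
        ring₂ = solve-∀
      excess : count A₁ ∸ n ≤ ρ₁
      excess = m≤n+o⇒m∸n≤o (count A₁) n (≤-trans (count-mono {p = A₁} {q = A} A₁⊑A) (≤-reflexive (trans size-A size)))
      ring : ∀ z l r u m x y → z + (m + (r + x) + (u + y) + l) + 0 ≡ y + (l + (r + u) + m + x + z)
      ring = solve-∀

    T-A A₂ : Fin N → Bool
    T-A = proj₁ trim-A
    A₂ = A₁ ∖ T-A

    count-A₂ : count A₂ ≡ n
    count-A₂ = proj₁ (proj₂ (proj₂ trim-A))

    B∖low⊑B′ : (B ∖ low Au) ⊑ B′
    B∖low⊑B′ v e = ∧-intro (∖-intro Z A′ v (∨-introʳ {A v} (∨-introˡ {B v} {R v} (∧-left {B v} e))) (λ f → A-B v (∧-left {A v} f) (∧-left {B v} e))) (∧-right {B v} e)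

    count-B′-lower : m ≤ w + count (B′ ∩ B)
    count-B′-lower = begin
      m                                          ≡⟨ size-B ⟨
      count B                                    ≡⟨ count-split B (low Au) ⟩
      count (B ∩ low Au) + count (B ∖ low Au)    ≤⟨ +-mono-≤ low-B (count-mono {p = B ∖ low Au} {q = B′ ∩ B} λ v e → ∧-intro (B∖low⊑B′ v e) (∧-left {B v} e)) ⟩
      w + count (B′ ∩ B)                         ∎

    B′-cases : ∀ v → B′ v ≡ true → B v ≡ true ⊎ (R ∪ (A ∩ low Bu)) v ≡ true
    B′-cases v e = Z-cases v (∧-left {Z v} (∧-left {(Z ∖ A′) v} e)) (not-elim (∧-right {Z v} (∧-left {(Z ∖ A′) v} e)))

    trim-B : ∃ λ T → T ⊑ ((B′ ∩ B) ∖ Bu) × count (B′ ∖ T) ≡ n × Removal 1 B′ T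
    trim-B = trim B′ ((B′ ∩ B) ∖ Bu) n (λ v e → ∧-left {B′ v} (∧-left {(B′ ∩ B) v} e)) n≤B′ (≤-trans (*-monoʳ-≤ L excess)
      (linear {L * (ρ₁ + (ρ + w)) + ((ρ + 3 * w) + (a + s₂)) + m + count (B′ ∩ B)} (ρ + 2 * w)
        (+-mono-≤ (+-mono-≤ trim-room count-B′-lower) (≤-trans (count≤count-∖ (B′ ∩ B) Bu) (+-monoˡ-≤ (count ((B′ ∩ B) ∖ Bu)) (≤-reflexive count-Bu))))
        (ring (L * (ρ₁ + (ρ + w))) ρ w (a + s₂) m (count (B′ ∩ B)) (count ((B′ ∩ B) ∖ Bu)))))
      where
      n≤B′ : n ≤ count B′
      n≤B′ = linear {m + (ρ + 3 * w) + (n + ρ₁)} (ρ + 2 * w)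
        (+-mono-≤ (+-mono-≤ (≤-trans count-B′-lower (+-monoʳ-≤ w (count-mono {p = B′ ∩ B} {q = B′} λ v → ∧-left {B′ v}))) slack) (≤-reflexive (sym size)))
        (ring₂ n m ρ w ρ₁ (count B′))
        where
        ring₂ : ∀ n m r w r₁ x → n + (w + x + r₁ + m) + (r + 2 * w) ≡ x + (m + (r + 3 * w) + (n + r₁))
        ring₂ = solve-∀
      excess : count B′ ∸ n ≤ ρ₁ + (ρ + w)
      excess = m≤n+o⇒m∸n≤o (count B′) n (≤-trans (count-⊎ B (R ∪ (A ∩ low Bu)) B′ B′-cases)
        (≤-trans (+-mono-≤ (≤-reflexive (trans size-B size)) count-extra) (≤-reflexive (+-assoc n ρ₁ (ρ + w)))))
      ring : ∀ l r w u m x y → l + (m + (w + x) + (u + y)) + (r + 2 * w) ≡ y + (l + (r + 3 * w + u) + m + x)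
      ring = solve-∀

    T-B B₂ : Fin N → Bool
    T-B = proj₁ trim-B
    B₂ = B′ ∖ T-B

    count-B₂ : count B₂ ≡ n
    count-B₂ = proj₁ (proj₂ (proj₂ trim-B))

    A₂⊑A′ : A₂ ⊑ A′
    A₂⊑A′ v e = ∧-left {A′ v} (∧-left {A₁ v} e)

    A₂⊑A : A₂ ⊑ A
    A₂⊑A v e = ∧-left {A v} (A₂⊑A′ v e)

    B₂⊑B′ : B₂ ⊑ B′
    B₂⊑B′ v = ∧-left {B′ v}

    A₂-B₂ : Disjoint A₂ B₂
    A₂-B₂ v e f = ∖-disjoint Z A′ v (∧-left {(Z ∖ A′) v} (B₂⊑B′ v f)) (A₂⊑A′ v e)

    U₁ U₂ K₁ K₂ : Fin N → Bool
    U₁ = Au ∩ A₂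
    U₂ = Bu ∩ B₂
    K₁ = (B₂ ∩ B) ∖ Bu
    K₂ = A₂ ∖ Au

    lost-A : count (Au ∖ U₁) ≤ ρ + 3 * w
    lost-A = ≤-trans (count-⊎ (A ∩ low Bu) E (Au ∖ U₁) split) (≤-trans (+-mono-≤ low-A count-E) (≤-reflexive (ring w ρ)))
      where
      ring : ∀ w r → w + (r + w + w) ≡ r + 3 * w
      ring = solve-∀
      split : ∀ v → (Au ∖ U₁) v ≡ true → (A ∩ low Bu) v ≡ true ⊎ E v ≡ true
      split v e = case bool-dec (low Bu v) of λ
        { (inj₁ l) → inj₁ (∧-intro (Au⊑A v (∧-left {Au v} e)) l)
        ; (inj₂ nl) → case bool-dec (E v) of λ
          { (inj₁ f) → inj₂ f
          ; (inj₂ nf) → ⊥-elim (∖-disjoint Au U₁ v e (∧-intro (∧-left {Au v} e)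
              (∖-intro A₁ T-A v (∧-intro (P⊑A′ v (∧-intro (∧-left {Au v} e) (not-intro nl))) (not-intro nf))
                (λ t → ∖-disjoint A₁ Au v (proj₁ (proj₂ trim-A) v t) (∧-left {Au v} e))))) } }

    lost-B : count (Bu ∖ U₂) ≤ ρ + 3 * w
    lost-B = ≤-trans (≤-trans (count-mono {p = Bu ∖ U₂} {q = B ∩ low Au} split) low-B) (linear {0} (ρ + 2 * w) z≤n (ring w ρ))
      where
      ring : ∀ w r → w + 0 + (r + 2 * w) ≡ r + 3 * w + 0
      ring = solve-∀
      split : (Bu ∖ U₂) ⊑ (B ∩ low Au)
      split v e = ∧-intro (Bu⊑B v (∧-left {Bu v} e)) (case bool-dec (low Au v) of λ
        { (inj₁ l) → l
        ; (inj₂ nl) → ⊥-elim (∖-disjoint Bu U₂ v e (∧-intro (∧-left {Bu v} e)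
            (∖-intro B′ T-B v (B∖low⊑B′ v (∧-intro (Bu⊑B v (∧-left {Bu v} e)) (not-intro nl)))
              (λ t → ∖-disjoint (B′ ∩ B) Bu v (proj₁ (proj₂ trim-B) v t) (∧-left {Bu v} e))))) })

    module _ (V U : Fin N → Bool) (U⊑V : U ⊑ V) (count-V : count V ≡ a + s₂) (lost : count (V ∖ U) ≤ ρ + 3 * w) where

      kept : a + s₂ ≤ count U + (ρ + 3 * w)
      kept = begin
        a + s₂                       ≡⟨ count-V ⟨
        count V                      ≤⟨ count≤count-∖ V U ⟩
        count U + count (V ∖ U)      ≤⟨ +-monoʳ-≤ (count U) lost ⟩
        count U + (ρ + 3 * w)        ∎

      kept-degree : ∀ v → low V v ≡ false → count U ≤ count (U ∩ (λ u → g u v)) * (2 * D)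
      kept-degree v ok = ≤-trans (count-mono {p = U} {q = V} U⊑V) (linear {count V + count V + (2 * ((ρ + 3 * w) * D) + (a + s₂))} a
        (+-mono-≤ (+-mono-≤ V≤ V≤) (+-mono-≤ degree-room (≤-reflexive (sym count-V)))) (ring (count V) y (ρ + 3 * w) D a s₂))
        where
        y = count (U ∩ (λ u → g u v))
        V≤ : count V ≤ (y + (ρ + 3 * w)) * D
        V≤ = ≤-trans (≤-pred (≤ᵇ-false {suc (count (V ∩ g v) * D)} {count V} ok)) (*-monoˡ-≤ D (≤-trans (count-⊎ (U ∩ (λ u → g u v)) (V ∖ U) (V ∩ g v) split) (+-monoʳ-≤ y lost)))
          where
          split : ∀ u → (V ∩ g v) u ≡ true → (U ∩ (λ u → g u v)) u ≡ true ⊎ (V ∖ U) u ≡ true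
          split u e = case bool-dec (U u) of λ
            { (inj₁ f) → inj₁ (∧-intro f (trans (edge-sym b u v) (∧-right {V u} e)))
            ; (inj₂ f) → inj₂ (∧-intro (∧-left {V u} e) (not-intro f)) }
        ring : ∀ V y r D a s → V + ((y + r) * D + (y + r) * D + (s + V)) + a ≡ y * (2 * D) + (V + V + (2 * (r * D) + (a + s)))
        ring = solve-∀

    typical-weaken : ∀ V U T → U ⊑ V → count (V ∩ low T) ≤ w → count (U ∩ (λ v → suc (count (T ∩ g v) * (2 * D)) ≤ᵇ count T)) ≤ w
    typical-weaken V U T U⊑V h = ≤-trans (count-mono {p = U ∩ (λ v → suc (count (T ∩ g v) * (2 * D)) ≤ᵇ count T)} {q = V ∩ low T}
      λ v e → ∧-intro (U⊑V v (∧-left {U v} e)) (≤ᵇ-true {suc (count (T ∩ g v) * D)} {count T}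
        (≤-trans (s≤s (*-monoʳ-≤ (count (T ∩ g v)) (m≤m+n D (D + 0)))) (≤ᵇ-elim {suc (count (T ∩ g v) * (2 * D))} {count T} (∧-right {U v} e))))) h

    K₁⊑B : K₁ ⊑ B
    K₁⊑B v e = ∧-right {B₂ v} (∧-left {(B₂ ∩ B) v} e)

    K₁⊑B₂ : K₁ ⊑ B₂
    K₁⊑B₂ v e = ∧-left {B₂ v} (∧-left {(B₂ ∩ B) v} e)

    q≤K₁ : q ≤ count K₁ + z₂
    q≤K₁ = linear {n + (s₂ + (ρ + w)) + (a + q)} 0 (+-mono-≤ (+-mono-≤ bound leftover) (≤-reflexive a+q))
      (ring n q a s₂ (ρ + w) z₂ (count K₁))
      where
      bound : n ≤ count K₁ + (a + s₂) + (ρ + w)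
      bound = begin
        n                                                      ≡⟨ count-B₂ ⟨
        count B₂                                               ≤⟨ count-⊎ (B₂ ∩ B) (R ∪ (A ∩ low Bu)) B₂ (λ v e → [ (λ f → inj₁ (∧-intro e f)) , inj₂ ]′ (B′-cases v (B₂⊑B′ v e))) ⟩
        count (B₂ ∩ B) + count (R ∪ (A ∩ low Bu))              ≤⟨ +-mono-≤ (count≤count-∖ (B₂ ∩ B) Bu) count-extra ⟩
        count Bu + count K₁ + (ρ + w)                          ≡⟨ cong (_+ (ρ + w)) (trans (+-comm (count Bu) (count K₁)) (cong (count K₁ +_) count-Bu)) ⟩
        count K₁ + (a + s₂) + (ρ + w)                          ∎
      ring : ∀ n q a s r z k → q + (k + (a + s) + r + z + n) + 0 ≡ k + z + (n + (s + r) + (a + q))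
      ring = solve-∀

    q≤K₂ : q ≤ count K₂ + z₂
    q≤K₂ = linear {n + (s₂ + (ρ + w)) + (a + q)} (ρ + w) (+-mono-≤ (+-mono-≤ bound leftover) (≤-reflexive a+q))
      (ring n q a s₂ (ρ + w) z₂ (count K₂))
      where
      bound : n ≤ (a + s₂) + count K₂
      bound = ≤-trans (≤-reflexive (sym count-A₂)) (≤-trans (count≤count-∖ A₂ Au) (≤-reflexive (cong (_+ count K₂) count-Au)))
      ring : ∀ n q a s r z k → q + (a + s + k + z + n) + r ≡ k + z + (n + (s + r) + (a + q))
      ring = solve-∀

    embedding₁ : Flexible U₁ K₁ B₂
    embedding₁ = half U₁ K₁ B₂
      (λ T T⊑ T-large → typical-weaken A U₁ T (λ v e → A₂⊑A v (∧-right {Au v} e)) (dense-A T (λ v e → K₁⊑B v (T⊑ v e)) T-large))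
      (λ v e → kept-degree Au U₁ (λ u → ∧-left {Au u}) count-Au lost-A v (not-elim (∧-right {(Z ∖ A′) v} (B₂⊑B′ v e))))
      (kept Au U₁ (λ u → ∧-left {Au u}) count-Au lost-A) q≤K₁
      (≤-trans (count-mono {p = K₁} {q = B₂} K₁⊑B₂) (≤-reflexive count-B₂)) (≤-reflexive count-B₂)

    embedding₂ : Flexible U₂ K₂ A₂
    embedding₂ = half U₂ K₂ A₂
      (λ T T⊑ T-large → typical-weaken B U₂ T (λ v e → Bu⊑B v (∧-left {Bu v} e)) (dense-B T (λ v e → A₂⊑A v (∧-left {A₂ v} (T⊑ v e))) T-large))
      (λ v e → kept-degree Bu U₂ (λ u → ∧-left {Bu u}) count-Bu lost-B v (not-elim (∧-right {A v} (A₂⊑A′ v e))))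
      (kept Bu U₂ (λ u → ∧-left {Bu u}) count-Bu lost-B) q≤K₂
      (≤-trans (count-mono {p = K₂} {q = A₂} (λ v → ∧-left {A₂ v})) (≤-reflexive count-A₂)) (≤-reflexive count-A₂)

    φ₁ φ₂ : PartialMap {n} {N}
    φ₁ = proj₁ embedding₁
    φ₂ = proj₁ embedding₂

    pe₁ : PartialEmbedding X U₁ φ₁
    pe₁ = proj₁ (proj₂ embedding₁)
    pe₂ : PartialEmbedding X U₂ φ₂
    pe₂ = proj₁ (proj₂ embedding₂)

    full₁ : X ⊑ dom φ₁
    full₁ = proj₁ (proj₂ (proj₂ embedding₁))
    full₂ : X ⊑ dom φ₂
    full₂ = proj₁ (proj₂ (proj₂ embedding₂))

    image-size : ∀ {U : Fin N → Bool} φ → PartialEmbedding X U φ → X ⊑ dom φ → count (image φ) ≡ a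
    image-size φ pe full = ≤-antisym (≤-trans (count-image≤dom φ) (count-mono {p = dom φ} {q = X} (PartialEmbedding.dom⊑ pe)))
      (≤-trans (count-mono {p = X} {q = dom φ} full) (injective-count φ (PartialEmbedding.injective pe)))

    image⊑ : ∀ {U : Fin N → Bool} φ → PartialEmbedding X U φ → image φ ⊑ U
    image⊑ φ pe v e = let x , q = image-elim {ρ = φ} {v} e in PartialEmbedding.range pe {x} {v} q

    tighten : ∀ {U : Fin N → Bool} φ → PartialEmbedding X U φ → PartialEmbedding X (image φ) φ
    tighten φ pe = record { injective = PartialEmbedding.injective pe ; domain = PartialEmbedding.domain pe
      ; range = λ {x} {v} e → image-intro {ρ = φ} {x} {v} e }

    W₁ W₂ : Fin N → Bool
    W₁ = B₂ ∖ image φ₂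
    W₂ = A₂ ∖ image φ₁

    image₁⊑A₂ : image φ₁ ⊑ A₂
    image₁⊑A₂ v e = ∧-right {Au v} (image⊑ φ₁ pe₁ v e)
    image₂⊑B₂ : image φ₂ ⊑ B₂
    image₂⊑B₂ v e = ∧-right {Bu v} (image⊑ φ₂ pe₂ v e)

    count-W₁ : count W₁ ≡ q
    count-W₁ = +-cancelˡ-≡ a _ _ (trans (cong (_+ count W₁) (sym (image-size φ₂ pe₂ full₂)))
      (trans (sym (count-∖-⊑ B₂ (image φ₂) image₂⊑B₂)) (trans count-B₂ (sym a+q))))
    count-W₂ : count W₂ ≡ q
    count-W₂ = +-cancelˡ-≡ a _ _ (trans (cong (_+ count W₂) (sym (image-size φ₁ pe₁ full₁)))
      (trans (sym (count-∖-⊑ A₂ (image φ₁) image₁⊑A₂)) (trans count-A₂ (sym a+q))))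

    K₁⊑W₁ : K₁ ⊑ W₁
    K₁⊑W₁ v e = ∖-intro B₂ (image φ₂) v (K₁⊑B₂ v e) (λ i → ∖-disjoint (B₂ ∩ B) Bu v e (∧-left {Bu v} (image⊑ φ₂ pe₂ v i)))
    K₂⊑W₂ : K₂ ⊑ W₂
    K₂⊑W₂ v e = ∖-intro A₂ (image φ₁) v (∧-left {A₂ v} e) (λ i → ∖-disjoint A₂ Au v e (∧-left {Au v} (image⊑ φ₁ pe₁ v i)))

    matching₁ : Matching (not ∘ X) W₁ (Candidates.cand (F k′) g φ₁)
    matching₁ = proj₂ (proj₂ (proj₂ embedding₁)) W₁ K₁⊑W₁ (λ v → ∧-left {B₂ v}) count-W₁ (≤-trans (≤-reflexive count-W₁) q≤K₁)
    matching₂ : Matching (not ∘ X) W₂ (Candidates.cand (F k′) g φ₂)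
    matching₂ = proj₂ (proj₂ (proj₂ embedding₂)) W₂ K₂⊑W₂ (λ v → ∧-left {A₂ v}) count-W₂ (≤-trans (≤-reflexive count-W₂) q≤K₂)

    exact-pair : ∀ {U : Fin N → Bool} W φ (pe : PartialEmbedding X U φ) → X ⊑ dom φ → (∀ v → image φ v ≡ true → W v ≡ true → ⊥) → count W ≡ q →
      Matching (not ∘ X) W (Candidates.cand (F k′) g φ) → Removal 1 (image φ ∪ W) (image φ ∪ W)
    exact-pair W φ pe full dis size-W M = removal-exact
      (bipartite-copy {k′} b X side {image φ} {W} {image φ ∪ W} φ (tighten φ pe) full (λ v → ∨-introˡ {image φ v} {W v}) (λ v → ∨-introʳ {image φ v} {W v})
        (λ {x} {v} e f → dis v (image-intro {ρ = φ} {x} {v} e) f) M)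
      (≤-trans (count-∪ (image φ) W) (≤-reflexive (trans (cong₂ _+_ (image-size φ pe full) size-W) a+q)))

    removal₁ : Removal 1 (image φ₁ ∪ W₁) (image φ₁ ∪ W₁)
    removal₁ = exact-pair W₁ φ₁ pe₁ full₁ (λ v e f → A₂-B₂ v (image₁⊑A₂ v e) (∧-left {B₂ v} f)) count-W₁ matching₁
    removal₂ : Removal 1 (image φ₂ ∪ W₂) (image φ₂ ∪ W₂)
    removal₂ = exact-pair W₂ φ₂ pe₂ full₂ (λ v e f → A₂-B₂ v (∧-left {A₂ v} f) (image₂⊑B₂ v e)) count-W₂ matching₂

    Z₁ Z₂ Z₃ Z₄ : Fin N → Bool
    Z₁ = Z ∖ (Lo ∪ E)
    Z₂ = Z₁ ∖ T-A
    Z₃ = Z₂ ∖ T-B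
    Z₄ = Z₃ ∖ (image φ₁ ∪ W₁)

    A₁⊑Z₁ : A₁ ⊑ Z₁
    A₁⊑Z₁ v e = ∖-intro Z (Lo ∪ E) v (∨-introˡ {A v} {(B ∪ R) v} (A₁⊑A v e)) λ f → case ∨-elim {Lo v} f of λ
      { (inj₁ l) → ∖-disjoint Z A′ v (∧-left {(Z ∖ A′) v} l) (∧-left {A′ v} e) ; (inj₂ f′) → ∖-disjoint A′ E v e f′ }

    T-A⊑A′ : T-A ⊑ A′
    T-A⊑A′ v t = ∧-left {A′ v} (∧-left {A₁ v} (proj₁ (proj₂ trim-A) v t))

    B′⊑Z₂ : B′ ⊑ Z₂
    B′⊑Z₂ v e = ∖-intro Z₁ T-A v (∖-intro Z (Lo ∪ E) v (∧-left {Z v} (∧-left {(Z ∖ A′) v} e)) λ f → case ∨-elim {Lo v} f of λ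
        { (inj₁ l) → true≢false (∧-right {(Z ∖ A′) v} l) (not-elim (∧-right {(Z ∖ A′) v} e))
        ; (inj₂ f′) → outside (P⊑A′ v (E⊑P v f′)) })
      (λ t → outside (T-A⊑A′ v t))
      where
      outside : A′ v ≡ true → ⊥
      outside = ∖-disjoint Z A′ v (∧-left {(Z ∖ A′) v} e)

    A₂⊑Z₃ : A₂ ⊑ Z₃
    A₂⊑Z₃ v e = ∖-intro Z₂ T-B v (∖-intro Z₁ T-A v (A₁⊑Z₁ v (∧-left {A₁ v} e)) (∖-disjoint A₁ T-A v e))
      (λ t → A-B v (A₂⊑A v e) (∧-right {B′ v} (∧-left {(B′ ∩ B) v} (proj₁ (proj₂ trim-B) v t))))

    B₂⊑Z₃ : B₂ ⊑ Z₃
    B₂⊑Z₃ v e = ∖-intro Z₂ T-B v (B′⊑Z₂ v (B₂⊑B′ v e)) (∖-disjoint B′ T-B v e)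

    Z₃-cases : ∀ v → Z₃ v ≡ true → A₂ v ≡ true ⊎ B₂ v ≡ true
    Z₃-cases v z = case bool-dec (A′ v) of λ
      { (inj₁ a′) → inj₁ (∖-intro A₁ T-A v (∖-intro A′ E v a′ (λ e → not-removed (∨-introʳ {Lo v} {E v} e))) (∖-disjoint Z₁ T-A v (∧-left {Z₂ v} z)))
      ; (inj₂ na′) → inj₂ (∖-intro B′ T-B v (∖-intro (Z ∖ A′) (low Au) v (∖-intro Z A′ v inZ (λ a′ → true≢false a′ na′))
          (λ l → not-removed (∨-introˡ {Lo v} {E v} (∧-intro (∖-intro Z A′ v inZ (λ a′ → true≢false a′ na′)) l)))) (∖-disjoint Z₂ T-B v z)) }
      where
      z₁ : Z₁ v ≡ true
      z₁ = ∧-left {Z₁ v} (∧-left {Z₂ v} z)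
      inZ : Z v ≡ true
      inZ = ∧-left {Z v} z₁
      not-removed : (Lo ∪ E) v ≡ true → ⊥
      not-removed = ∖-disjoint Z (Lo ∪ E) v z₁

    first⊑Z₃ : (image φ₁ ∪ W₁) ⊑ Z₃
    first⊑Z₃ = ∪-⊑ (image φ₁) W₁ (λ v e → A₂⊑Z₃ v (image₁⊑A₂ v e)) (λ v e → B₂⊑Z₃ v (∧-left {B₂ v} e))

    second⊑Z₄ : (image φ₂ ∪ W₂) ⊑ Z₄
    second⊑Z₄ = ∪-⊑ (image φ₂) W₂
      (λ v e → ∖-intro Z₃ (image φ₁ ∪ W₁) v (B₂⊑Z₃ v (image₂⊑B₂ v e)) λ f → case ∨-elim {image φ₁ v} f of λ
        { (inj₁ i) → A₂-B₂ v (image₁⊑A₂ v i) (image₂⊑B₂ v e) ; (inj₂ u) → ∖-disjoint B₂ (image φ₂) v u e })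
      (λ v e → ∖-intro Z₃ (image φ₁ ∪ W₁) v (A₂⊑Z₃ v (∧-left {A₂ v} e)) λ f → case ∨-elim {image φ₁ v} f of λ
        { (inj₁ i) → ∖-disjoint A₂ (image φ₁) v e i ; (inj₂ u) → A₂-B₂ v (∧-left {A₂ v} e) (∧-left {B₂ v} u) })

    nothing-left : ∀ v → (Z₄ ∖ (image φ₂ ∪ W₂)) v ≡ false
    nothing-left v = ¬true⇒false λ z →
      let z₄ = ∧-left {Z₄ v} z
          not-first = ∖-disjoint Z₃ (image φ₁ ∪ W₁) v z₄
          not-second = ∖-disjoint Z₄ (image φ₂ ∪ W₂) v z
      in case Z₃-cases v (∧-left {Z₃ v} z₄) of λ
        { (inj₁ e) → not-second (∨-introʳ {image φ₂ v} {W₂ v} (∖-intro A₂ (image φ₁) v e (λ i → not-first (∨-introˡ {image φ₁ v} {W₁ v} i))))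
        ; (inj₂ e) → not-first (∨-introʳ {image φ₁ v} {W₁ v} (∖-intro B₂ (image φ₂) v e (λ i → not-second (∨-introˡ {image φ₂ v} {W₂ v} i)))) }

    finish : Cover 6 (A ∪ (B ∪ R))
    finish = restore (proj₂ (proj₂ (proj₂ sparse-part))) {Z} {4} sparse⊑Z
      (restore (proj₂ (proj₂ (proj₂ trim-A))) {Z₁} {3} A₁⊑Z₁
        (restore (proj₂ (proj₂ (proj₂ trim-B))) {Z₂} {2} B′⊑Z₂
          (restore removal₁ {Z₃} {1} first⊑Z₃
            (restore removal₂ {Z₄} {0} second⊑Z₄ (cover-empty nothing-left)))))
      where
      sparse⊑Z : (Lo ∪ P) ⊑ Z
      sparse⊑Z = ∪-⊑ Lo P (λ v e → ∧-left {Z v} (∧-left {(Z ∖ A′) v} e)) (λ v e → ∨-introˡ {A v} {(B ∪ R) v} (Au⊑A v (∧-left {Au v} e)))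

module Constants (d D h : ℕ) where

  r s : ℕ
  r = 2 * h * ((2 * h * (2 * h)) ^ d * d)
  s = 32 * (r * D)

  make-scale : ∀ {L m w n a q x} → 0 < d → 2 * d ≤ D → 0 < w →
    L ≤ h → 64 * (2 * (2 * D)) ^ d * suc (d * d) ≤ h → 264 * d * suc d * (2 * (2 * D)) ^ d * D ≤ h →
    4 * (s * h) ≤ 2 ^ x → x + 1 ≤ w →
    2 * (s * h) * w ≤ m → m ≤ 4 * (s * h) * w → m ≡ n + (r * w + 3 * w) → a + q ≡ n → 2 * a ≤ n → n ≤ 2 * suc d * a →
    Scale d L m w D (r * w) n a q
  make-scale {L} {m} {w} {n} {a} {q} {x} 0<d 2d≤D 0<w L≤h V≤h DV≤h x-large x<w m-lower m-upper m≡ a+q 2a≤n n≤a = record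
    { s₂ = S ; ρ₁ = ρ + 3 * w ; tmin = T * w ; J = 2 * h ; τ = 4 * S ; y₀ = 16 * S ; s₀ = 4 * S ; s₁ = 16 * S ; z₂ = 2 * S ; lb = x + w
    ; 0<D = 0<D ; 2d≤D = 2d≤D ; size = m≡ ; slack = ≤-refl
    ; fits = ≤-trans (≤-trans (m≤n+m (a + S) (L * (ρ + 3 * w + (ρ + w)) + (ρ + 3 * w))) (≤-reflexive (+-assoc (L * (ρ + 3 * w + (ρ + w))) (ρ + 3 * w) (a + S)))) trim
    ; w≤s₂ = ≤-trans w≤ρ ρ≤S
    ; sparse-room = linear {64 * ρ + 10 * (4 * w)} (50 * ρ + 30 * w) (+-mono-≤ 64ρ≤S (*-monoʳ-≤ 10 4w≤ρ)) (ring₁ ρ w S)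
    ; degree-room = linear {6 * (4 * w * D)} (24 * (ρ * D) + 18 * (w * D)) (*-monoʳ-≤ 6 (*-monoˡ-≤ D 4w≤ρ)) (ring₂ r w D)
    ; trim-room = trim
    ; 0<tmin = *-mono-< {0} {T} {0} {w} 0<T 0<w
    ; tmin-large = ≤-refl
    ; 2≤J = *-monoʳ-≤ 2 0<h
    ; grow = λ c c≤n → growth h (4 * S) c 0<h (≤-trans c≤n (≤-trans n≤m (≤-trans m-upper (≤-reflexive (ring₃ s h w)))))
    ; Des-room = *-cancelˡ-≤ 2 (begin
        2 * (2 * V * (16 * S) * suc (d * d))     ≡⟨ ring₄ V S (suc (d * d)) ⟩
        S * (64 * V * suc (d * d))               ≤⟨ *-monoʳ-≤ S V≤h ⟩
        S * h                                    ≤⟨ Sh≤2q ⟩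
        2 * q                                    ∎)
    ; y₀-large = linear {x + 1 + w} (6 * S) (+-mono-≤ (≤-trans x<w w≤S) w≤S) (ring₅ S x w)
    ; n≤2^lb = begin
        n                        ≤⟨ ≤-trans n≤m m-upper ⟩
        4 * (s * h) * w          ≤⟨ *-mono-≤ x-large (<⇒≤ (n<2^n w)) ⟩
        2 ^ x * 2 ^ w            ≡⟨ ^-distribˡ-+-* 2 x w ⟨
        2 ^ (x + w)              ∎
    ; room = linear {d * w + 64 * ρ + 3 * (4 * w)} (58 * ρ + 9 * w) (+-mono-≤ (+-mono-≤ (*-monoˡ-≤ w d≤r) 64ρ≤S) (*-monoʳ-≤ 3 4w≤ρ)) (ring₆ h ((2 * h * (2 * h)) ^ d) d w S)
    ; room-Des = *-cancelˡ-≤ (2 * suc d) (begin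
        2 * suc d * ((d * (2 * V * (16 * S)) + d * w) * (2 * (2 * D)))       ≤⟨ *-monoʳ-≤ (2 * suc d) (*-monoˡ-≤ (2 * (2 * D)) (+-monoʳ-≤ (d * (2 * V * (16 * S))) (*-monoʳ-≤ d w≤VS))) ⟩
        2 * suc d * ((d * (2 * V * (16 * S)) + d * (V * S)) * (2 * (2 * D)))  ≡⟨ ring₇ d (suc d) V S D ⟩
        S * (264 * d * suc d * V * D)                                         ≤⟨ *-monoʳ-≤ S DV≤h ⟩
        S * h                                                                 ≤⟨ Sh≤n ⟩
        n                                                                     ≤⟨ n≤a ⟩
        2 * suc d * a                                                         ∎)
    ; s₀-large = linear {T * w} S (≤-trans (*-monoˡ-≤ w T≤r) ρ≤S) (ring₈ S (T * w))
    ; s₁-large = linear {1} (5 * S) (≤-trans 0<w w≤S) (ring₉ S)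
    ; K₀-share = *-cancelˡ-≤ 2 (begin
        2 * (16 * S * T + 2 * S)       ≤⟨ *-monoʳ-≤ 2 (+-mono-≤ (*-monoʳ-≤ (16 * S) T≤V) (≤-trans (≤-reflexive (sym (*-identityʳ (2 * S)))) (*-monoʳ-≤ (2 * S) 0<V))) ⟩
        2 * (16 * S * V + 2 * S * V)   ≤⟨ m≤m+n _ (S * (28 * V)) ⟩
        2 * (16 * S * V + 2 * S * V) + S * (28 * V)  ≡⟨ ring₁₀ S V ⟩
        S * (64 * V)                   ≤⟨ *-monoʳ-≤ S 64V≤h ⟩
        S * h                          ≤⟨ Sh≤2q ⟩
        2 * q                          ∎)
    ; K₀-tmin = *-cancelˡ-≤ 2 (begin
        2 * (T * w + 2 * S)            ≤⟨ *-monoʳ-≤ 2 (+-monoˡ-≤ (2 * S) (≤-trans (*-monoˡ-≤ w T≤r) ρ≤S)) ⟩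
        2 * (S + 2 * S)                ≡⟨ ring₁₁ S ⟩
        S * 6                          ≤⟨ *-monoʳ-≤ S (≤-trans (m≤m+n 6 58) 64≤h) ⟩
        S * h                          ≤⟨ Sh≤2q ⟩
        2 * q                          ∎)
    ; leftover = linear {64 * ρ + w} (62 * ρ) (+-mono-≤ 64ρ≤S w≤ρ) (ring₁₂ ρ w S)
    ; positive = *-mono-< {0} {2 * h} {0} (*-mono-< {0} {2} {0} {h} (s≤s z≤n) 0<h)
        (*-mono-< {0} {(2 * h * (2 * h)) ^ d} {0} (m^n>0 (2 * h * (2 * h)) {{m*n≢0 (2 * h) (2 * h)}} d) (*-mono-< {0} {d} {0} {w} 0<d 0<w))
    }
    where
    ρ = r * w
    S = s * w
    T = (2 * D) ^ d
    V = (2 * (2 * D)) ^ d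
    ring₁ : ∀ ρ w S → 4 * ρ + 10 * w + (S + 10 * ρ) + (50 * ρ + 30 * w) ≡ S + (64 * ρ + 10 * (4 * w))
    ring₁ = solve-∀
    ring₂ : ∀ r w D → 2 * ((r * w + 3 * w) * D) + 6 * (r * w * D) + (24 * (r * w * D) + 18 * (w * D)) ≡ 32 * (r * D) * w + 6 * (4 * w * D)
    ring₂ = solve-∀
    ring₃ : ∀ s h w → 4 * (s * h) * w ≡ 4 * (s * w) * h
    ring₃ = solve-∀
    ring₄ : ∀ V S e → 2 * (2 * V * (16 * S) * e) ≡ S * (64 * V * e)
    ring₄ = solve-∀
    ring₅ : ∀ S x w → 4 * S + (4 * S + 1 + (x + w)) + (S + S) + 6 * S ≡ 16 * S + (x + 1 + w)
    ring₅ = solve-∀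
    ring₆ : ∀ h P d w S → d * w + 2 * h * (P * (d * w)) + (2 * h * (P * d) * w + 3 * w) + (2 * h * (P * d) * w + S + 3 * (2 * h * (P * d) * w)) + (58 * (2 * h * (P * d) * w) + 9 * w)
      ≡ S + (d * w + 64 * (2 * h * (P * d) * w) + 3 * (4 * w))
    ring₆ = solve-∀
    ring₇ : ∀ d e V S D → 2 * e * ((d * (2 * V * (16 * S)) + d * (V * S)) * (2 * (2 * D))) ≡ S * (264 * d * e * V * D)
    ring₇ = solve-∀
    ring₈ : ∀ S t → 2 * S + t + S + S ≡ 4 * S + t
    ring₈ = solve-∀
    ring₉ : ∀ S → 2 * S + (4 * S + 1 + 4 * S) + S + 5 * S ≡ 16 * S + 1
    ring₉ = solve-∀
    ring₁₀ : ∀ S V → 2 * (16 * S * V + 2 * S * V) + S * (28 * V) ≡ S * (64 * V)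
    ring₁₀ = solve-∀
    ring₁₁ : ∀ S → 2 * (S + 2 * S) ≡ S * 6
    ring₁₁ = solve-∀
    ring₁₂ : ∀ ρ w S → S + (ρ + w) + (S + ρ) + 62 * ρ ≡ 2 * S + (64 * ρ + w)
    ring₁₂ = solve-∀
    ring₁₃ : ∀ r w → 64 * (r * w) ≡ 32 * (r * 2) * w
    ring₁₃ = solve-∀
    0<D : 0 < D
    0<D = ≤-trans (≤-trans 0<d (m≤m+n d (d + 0))) 2d≤D
    2≤D : 2 ≤ D
    2≤D = ≤-trans (*-monoʳ-≤ 2 0<d) 2d≤D
    0<T : 0 < T
    0<T = m^n>0 (2 * D) {{m*n≢0 2 D {{_}} {{>-nonZero 0<D}}}} d
    T≤V : T ≤ V
    T≤V = ^-monoˡ-≤ d (m≤m+n (2 * D) (2 * D + 0))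
    0<V : 0 < V
    0<V = ≤-trans 0<T T≤V
    64V≤h : 64 * V ≤ h
    64V≤h = ≤-trans (m≤m*n (64 * V) (suc (d * d))) V≤h
    64≤h : 64 ≤ h
    64≤h = ≤-trans (m≤m*n 64 V {{>-nonZero 0<V}}) 64V≤h
    0<h : 0 < h
    0<h = ≤-trans (s≤s z≤n) 64≤h
    instance
      h≢0 : NonZero h
      h≢0 = >-nonZero 0<h
      d≢0 : NonZero d
      d≢0 = >-nonZero 0<d
      2h≢0 : NonZero (2 * h)
      2h≢0 = m*n≢0 2 h
      P≢0 : NonZero ((2 * h * (2 * h)) ^ d)
      P≢0 = m^n≢0 (2 * h * (2 * h)) d {{m*n≢0 (2 * h) (2 * h)}}
    h≤r : h ≤ r
    h≤r = ≤-trans (m≤n*m h 2) (m≤m*n (2 * h) ((2 * h * (2 * h)) ^ d * d) {{m*n≢0 ((2 * h * (2 * h)) ^ d) d}})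
    d≤r : d ≤ r
    d≤r = ≤-trans (m≤n*m d ((2 * h * (2 * h)) ^ d)) (m≤n*m ((2 * h * (2 * h)) ^ d * d) (2 * h))
    T≤r : T ≤ r
    T≤r = ≤-trans T≤V (≤-trans (m≤n*m V 64) (≤-trans 64V≤h h≤r))
    n≤m : n ≤ m
    n≤m = ≤-trans (m≤m+n n (ρ + 3 * w)) (≤-reflexive (sym m≡))
    4w≤ρ : 4 * w ≤ ρ
    4w≤ρ = *-monoˡ-≤ w (≤-trans (m≤m+n 4 60) (≤-trans 64≤h h≤r))
    w≤ρ : w ≤ ρ
    w≤ρ = ≤-trans (m≤n*m w 4) 4w≤ρ
    64ρ≤S : 64 * ρ ≤ S
    64ρ≤S = ≤-trans (≤-reflexive (ring₁₃ r w)) (*-monoˡ-≤ w (*-monoʳ-≤ 32 (*-monoʳ-≤ r 2≤D)))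
    ρ≤S : ρ ≤ S
    ρ≤S = ≤-trans (m≤n*m ρ 64) 64ρ≤S
    w≤S : w ≤ S
    w≤S = ≤-trans w≤ρ ρ≤S
    w≤VS : w ≤ V * S
    w≤VS = ≤-trans w≤S (m≤n*m S V {{>-nonZero 0<V}})
    S≤Sh : S ≤ S * h
    S≤Sh = m≤m*n S h
    Sh≤n : S * h ≤ n
    Sh≤n = linear {2 * (s * h) * w + (64 * ρ + 3 * (4 * w)) + (S + m)} (60 * ρ + 9 * w)
      (+-mono-≤ (+-mono-≤ m-lower (+-mono-≤ 64ρ≤S (*-monoʳ-≤ 3 4w≤ρ))) (+-mono-≤ S≤Sh (≤-reflexive m≡))) (ring s h w n m ρ)
      where
      ring : ∀ s h w n m ρ → s * w * h + (m + (s * w + 3 * ρ) + (s * w * h + (n + (ρ + 3 * w)))) + (60 * ρ + 9 * w)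
        ≡ n + (2 * (s * h) * w + (64 * ρ + 3 * (4 * w)) + (s * w + m))
      ring = solve-∀
    Sh≤2q : S * h ≤ 2 * q
    Sh≤2q = linear {S * h + 2 * a + (2 * n)} 0 (+-mono-≤ (+-mono-≤ Sh≤n 2a≤n) (*-monoʳ-≤ 2 (≤-reflexive (sym a+q)))) (ring (S * h) n a q)
      where
      ring : ∀ y n a q → y + (n + n + 2 * (a + q)) + 0 ≡ 2 * q + (y + 2 * a + 2 * n)
      ring = solve-∀
    trim : L * (ρ + 3 * w + (ρ + w)) + ((ρ + 3 * w) + (a + S)) ≤ m
    trim = *-cancelˡ-≤ 2 (linear {2 * (L * (ρ + 3 * w + (ρ + w))) + 2 * a + h * (64 * ρ) + 2 * (s * h) * w + 2 * h * (4 * w) + 2 * S + n + 8 * ρ + 3 * (4 * w)} (50 * (h * ρ) + 3 * ρ + 6 * w)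
      (+-mono-≤ (+-mono-≤ (+-mono-≤ (+-mono-≤ (+-mono-≤ (+-mono-≤ (+-mono-≤ (+-mono-≤
        (*-monoʳ-≤ 2 (*-monoˡ-≤ (ρ + 3 * w + (ρ + w)) L≤h)) 2a≤n) (*-monoʳ-≤ h 64ρ≤S)) m-lower) (*-monoʳ-≤ (2 * h) 4w≤ρ)) 2S≤Sh) n≤m) (*-monoʳ-≤ 8 (m≤n*m ρ h))) (*-monoʳ-≤ 3 4w≤ρ))
      (ring L ρ w a s h n m))
      where
      2S≤Sh : 2 * S ≤ S * h
      2S≤Sh = ≤-trans (≤-reflexive (*-comm 2 S)) (*-monoʳ-≤ S (≤-trans (m≤m+n 2 62) 64≤h))
      ring : ∀ L ρ w a s h n m →
        2 * (L * (ρ + 3 * w + (ρ + w)) + ((ρ + 3 * w) + (a + s * w)))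
        + (2 * (h * (ρ + 3 * w + (ρ + w))) + n + h * (s * w) + m + 2 * h * ρ + s * w * h + m + 8 * (h * ρ) + 3 * ρ) + (50 * (h * ρ) + 3 * ρ + 6 * w)
        ≡ 2 * m + (2 * (L * (ρ + 3 * w + (ρ + w))) + 2 * a + h * (64 * ρ) + 2 * (s * h) * w + 2 * h * (4 * w) + 2 * (s * w) + n + 8 * ρ + 3 * (4 * w))
      ring = solve-∀

-- Dense pairs and nearly complete pairs

module Exponents (d δ : ℕ) where

  e x : ℕ
  e = (δ + 2) * d + δ + d * 8 + 9
  x = (e + 1) + ((e + 1) + (e + 1)) * d + d + δ + e + 7

  open Constants d (2 ^ δ) (2 ^ e) public

  Θ : ℕ
  Θ = 2 * (s * 2 ^ e)

  private
    V G : ℕ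
    V = (2 * (2 * 2 ^ δ)) ^ d
    G = 2 ^ (d * 8)

    V-power : V ≡ 2 ^ ((δ + 2) * d)
    V-power = trans (cong (_^ d) (trans (ring (2 ^ δ)) (sym (^-distribˡ-+-* 2 δ 2)))) (^-*-assoc 2 (δ + 2) d)
      where
      ring : ∀ z → 2 * (2 * z) ≡ z * 4
      ring = solve-∀

    h-power : 2 ^ e ≡ V * 2 ^ δ * G * 512
    h-power = trans (^-distribˡ-+-* 2 ((δ + 2) * d + δ + d * 8) 9) (cong (_* 512)
      (trans (^-distribˡ-+-* 2 ((δ + 2) * d + δ) (d * 8)) (cong (_* G) (trans (^-distribˡ-+-* 2 ((δ + 2) * d) δ) (cong (_* 2 ^ δ) (sym V-power))))))

    square≤G : 2 ^ d * 2 ^ d ≤ G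
    square≤G = ≤-trans (≤-reflexive (sym (^-distribˡ-+-* 2 d d))) (2^-mono {d + d} {d * 8} (linear {0} (6 * d) z≤n (ring d)))
      where
      ring : ∀ d → d + d + 0 + 6 * d ≡ d * 8 + 0
      ring = solve-∀

  twice-d : d + 1 ≤ δ → 2 * d ≤ 2 ^ δ
  twice-d h = begin
    2 * d           ≤⟨ *-monoʳ-≤ 2 (<⇒≤ (n<2^n d)) ⟩
    2 * 2 ^ d       ≡⟨ trans (^-distribˡ-+-* 2 d 1) (*-comm (2 ^ d) 2) ⟨
    2 ^ (d + 1)     ≤⟨ 2^-mono {d + 1} {δ} h ⟩
    2 ^ δ           ∎

  L≤h : 2 ^ (d * 8) ≤ 2 ^ e
  L≤h = 2^-mono {d * 8} {e} (≤-trans (m≤n+m (d * 8) ((δ + 2) * d + δ)) (m≤m+n _ 9))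

  V≤h : 64 * V * suc (d * d) ≤ 2 ^ e
  V≤h = begin
    64 * V * suc (d * d)              ≤⟨ *-monoʳ-≤ (64 * V) (≤-trans squares (≤-trans (*-mono-≤ (n<2^n d) (n<2^n d)) square≤G)) ⟩
    64 * V * G                        ≤⟨ *-monoˡ-≤ G (*-monoʳ-≤ 64 (m≤m*n V (2 ^ δ) {{m^n≢0 2 δ}})) ⟩
    64 * (V * 2 ^ δ) * G              ≡⟨ ring (V * 2 ^ δ) G ⟩
    V * 2 ^ δ * G * 64                ≤⟨ *-monoʳ-≤ (V * 2 ^ δ * G) (m≤m+n 64 448) ⟩
    V * 2 ^ δ * G * 512               ≡⟨ h-power ⟨
    2 ^ e                             ∎
    where
    ring : ∀ a g → 64 * a * g ≡ a * g * 64
    ring = solve-∀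
    squares : suc (d * d) ≤ suc d * suc d
    squares = ≤-trans (m≤m+n (suc (d * d)) (d + d)) (≤-reflexive (ring₂ d))
      where
      ring₂ : ∀ d → 1 + d * d + (d + d) ≡ (1 + d) * (1 + d)
      ring₂ = solve-∀

  DV≤h : 264 * d * suc d * V * 2 ^ δ ≤ 2 ^ e
  DV≤h = begin
    264 * d * suc d * V * 2 ^ δ       ≡⟨ ring d (suc d) V (2 ^ δ) ⟩
    V * 2 ^ δ * (d * suc d) * 264     ≤⟨ *-mono-≤ (*-monoʳ-≤ (V * 2 ^ δ) (≤-trans (*-mono-≤ (<⇒≤ (n<2^n d)) (n<2^n d)) square≤G)) (m≤m+n 264 248) ⟩
    V * 2 ^ δ * G * 512               ≡⟨ h-power ⟨
    2 ^ e                             ∎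
    where
    ring : ∀ d e v z → 264 * d * e * v * z ≡ v * z * (d * e) * 264
    ring = solve-∀

  x-large : 4 * (s * 2 ^ e) ≤ 2 ^ x
  x-large = begin
    4 * (32 * (2 * 2 ^ e * ((2 * 2 ^ e * (2 * 2 ^ e)) ^ d * d) * 2 ^ δ) * 2 ^ e)
      ≡⟨ ring (2 * 2 ^ e) ((2 * 2 ^ e * (2 * 2 ^ e)) ^ d) d (2 ^ δ) (2 ^ e) ⟩
    2 * 2 ^ e * (2 * 2 ^ e * (2 * 2 ^ e)) ^ d * d * 2 ^ δ * 2 ^ e * 128
      ≤⟨ *-monoˡ-≤ 128 (*-monoˡ-≤ (2 ^ e) (*-monoˡ-≤ (2 ^ δ) (*-monoʳ-≤ (2 * 2 ^ e * (2 * 2 ^ e * (2 * 2 ^ e)) ^ d) (<⇒≤ (n<2^n d))))) ⟩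
    2 * 2 ^ e * (2 * 2 ^ e * (2 * 2 ^ e)) ^ d * 2 ^ d * 2 ^ δ * 2 ^ e * 128
      ≡⟨ cong₂ (λ u v → u * v * 2 ^ d * 2 ^ δ * 2 ^ e * 128) double (trans (cong (_^ d) (trans (cong₂ _*_ double double) (sym (^-distribˡ-+-* 2 (e + 1) (e + 1))))) (^-*-assoc 2 ((e + 1) + (e + 1)) d)) ⟩
    2 ^ (e + 1) * 2 ^ (((e + 1) + (e + 1)) * d) * 2 ^ d * 2 ^ δ * 2 ^ e * 128
      ≡⟨ trans (^-distribˡ-+-* 2 ((e + 1) + ((e + 1) + (e + 1)) * d + d + δ + e) 7) (cong (_* 128)
          (trans (^-distribˡ-+-* 2 ((e + 1) + ((e + 1) + (e + 1)) * d + d + δ) e) (cong (_* 2 ^ e)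
          (trans (^-distribˡ-+-* 2 ((e + 1) + ((e + 1) + (e + 1)) * d + d) δ) (cong (_* 2 ^ δ)
          (trans (^-distribˡ-+-* 2 ((e + 1) + ((e + 1) + (e + 1)) * d) d) (cong (_* 2 ^ d)
          (^-distribˡ-+-* 2 (e + 1) (((e + 1) + (e + 1)) * d))))))))) ⟨
    2 ^ x ∎
    where
    double : 2 * 2 ^ e ≡ 2 ^ (e + 1)
    double = trans (*-comm 2 (2 ^ e)) (sym (^-distribˡ-+-* 2 e 1))
    ring : ∀ u v d z h → 4 * (32 * (u * (v * d) * z) * h) ≡ u * v * d * z * h * 128
    ring = solve-∀

  0<r : 0 < d → 0 < r
  0<r 0<d = *-mono-< {0} {2 * 2 ^ e} {0} (*-mono-< {0} {2} {0} (s≤s z≤n) (2^-pos e))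
    (*-mono-< {0} {(2 * 2 ^ e * (2 * 2 ^ e)) ^ d} {0} (m^n>0 (2 * 2 ^ e * (2 * 2 ^ e)) {{m*n≢0 (2 * 2 ^ e) (2 * 2 ^ e) {{2h≢0}} {{2h≢0}}}} d) 0<d)
    where
    2h≢0 : NonZero (2 * 2 ^ e)
    2h≢0 = m*n≢0 2 (2 ^ e) {{_}} {{m^n≢0 2 e}}

  0<Θ : 0 < d → 0 < Θ
  0<Θ 0<d = *-mono-< {0} {2} {0} (s≤s z≤n) (*-mono-< {0} {s} {0} (*-mono-< {0} {32} {0} (s≤s z≤n) (*-mono-< {0} {r} {0} (0<r 0<d) (2^-pos δ))) (2^-pos e))

  2Θ≤ : 2 * Θ ≤ 2 ^ x
  2Θ≤ = ≤-trans (≤-reflexive (ring (s * 2 ^ e))) x-large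
    where
    ring : ∀ y → 2 * (2 * y) ≡ 4 * y
    ring = solve-∀

  leaves-two : ∀ {m w} → 0 < d → 0 < w → Θ * w ≤ m → 2 + (r * w + 3 * w) ≤ m
  leaves-two {m} {w} 0<d 0<w large = begin
    2 + (r * w + 3 * w)            ≤⟨ +-mono-≤ (*-monoʳ-≤ 2 (*-mono-≤ (0<r 0<d) 0<w)) (+-monoʳ-≤ (r * w) (*-monoʳ-≤ 3 (≤-trans (≤-reflexive (sym (*-identityˡ w))) (*-monoˡ-≤ w (0<r 0<d))))) ⟩
    2 * (r * w) + (r * w + 3 * (r * w))  ≤⟨ m≤m+n _ (58 * (r * w)) ⟩
    2 * (r * w) + (r * w + 3 * (r * w)) + 58 * (r * w)  ≡⟨ ring r w ⟩
    64 * r * w                     ≤⟨ *-monoˡ-≤ w (≤-trans (m≤m*n (64 * r) (2 ^ δ * 2 ^ e) {{m*n≢0 (2 ^ δ) (2 ^ e) {{m^n≢0 2 δ}} {{m^n≢0 2 e}}}}) (≤-reflexive (ring₂ r (2 ^ δ) (2 ^ e)))) ⟩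
    Θ * w                          ≤⟨ large ⟩
    m                              ∎
    where
    ring : ∀ r w → 2 * (r * w) + (r * w + 3 * (r * w)) + 58 * (r * w) ≡ 64 * r * w
    ring = solve-∀
    ring₂ : ∀ r z h → 64 * r * (z * h) ≡ 2 * (32 * (r * z) * h)
    ring₂ = solve-∀

module Dichotomy (F : GraphSeq) (bip : BipartiteSeq F) (d : ℕ) (0<d : 0 < d) (deg : ∀ k y → count (adj (F k) y) ≤ d) {N : ℕ} (c : TwoColoring N) where

  open Covers F c

  L : ℕ
  L = 2 ^ (d * 8)

  L-large : 2 * d * (8 * 4 ^ d) < L
  L-large = ramsey-constant d 0<d

  low : Bool → ℕ → (Fin N → Bool) → Fin N → Bool
  low b D T v = suc (count (T ∩ edge b v) * D) ≤ᵇ count T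

  Dense : Bool → ℕ → ℕ → (A B : Fin N → Bool) → Set
  Dense b D w A B = ∀ T → T ⊑ B → w ≤ count T → count (A ∩ low b D T) ≤ w

  dense-or-sparse : ∀ b D w A B → Dense b D w A B ⊎ (∃ λ T → T ⊑ B × w ≤ count T × w < count (A ∩ low b D T))
  dense-or-sparse b D w A B = [ inj₂ , (λ h → inj₁ λ T T⊑ large → ≮⇒≥ λ lt → h T (T⊑ , large , lt)) ]′
    (search-set (λ T → T ⊑ B × w ≤ count T × w < count (A ∩ low b D T)) resp (λ T → (T ⊑? B) ×-dec (w ≤? count T) ×-dec (w <? count (A ∩ low b D T))))
    where
    resp : ∀ {T T′} → (∀ i → T i ≡ T′ i) → T ⊑ B × w ≤ count T × w < count (A ∩ low b D T) → T′ ⊑ B × w ≤ count T′ × w < count (A ∩ low b D T′)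
    resp {T} {T′} same (T⊑ , large , lt) = (λ i e → T⊑ i (trans (same i) e)) , subst (w ≤_) (count-cong same) large ,
      subst (w <_) (count-cong λ v → cong (A v ∧_) (cong₂ (λ p q → suc (p * D) ≤ᵇ q) (count-cong λ u → cong (_∧ edge b v u) (same u)) (count-cong same))) lt

  finish-at : ∀ δ → d + 1 ≤ δ → let open Exponents d δ in ∀ {m w} b A B R → Disjoint A B → count A ≡ m → count B ≡ m → count R ≤ r * w →
    x + 1 ≤ w → Θ * w ≤ m → m ≤ 2 * Θ * w → Dense b (2 ^ δ) w A B → Dense b (2 ^ δ) w B A → Cover 6 (A ∪ (B ∪ R))
  finish-at δ δ-large {m} {w} b A B R A-B size-A size-B size-R x<w lower upper dense-A dense-B = go (m ∸ (r * w + 3 * w)) refl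
    where
    open Exponents d δ
    0<w : 0 < w
    0<w = ≤-trans (m≤n+m 1 x) x<w
    two-left : 2 ≤ m ∸ (r * w + 3 * w)
    two-left = +-cancelʳ-≤ (r * w + 3 * w) 2 _ (≤-trans (leaves-two 0<d 0<w lower) (≤-reflexive (sym (m∸n+n≡m (≤-trans (m≤n+m _ 2) (leaves-two 0<d 0<w lower))))))
    go : ∀ n → m ∸ (r * w + 3 * w) ≡ n → Cover 6 (A ∪ (B ∪ R))
    go zero e = ⊥-elim (<⇒≱ (≤-trans (s≤s z≤n) two-left) (≤-reflexive e))
    go n@(suc k′) e = Finish.finish F bip d 0<d deg L L-large c b k′ X side scale A B R A-B size-A size-B size-R dense-A dense-B
      where
      balanced = balanced-side (F k′) d 0<d (deg k′) (bip k′) (subst (2 ≤_) e two-left)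
      X = proj₁ balanced
      side : IsSide (F k′) X
      side = proj₁ (proj₂ balanced)
      ring : ∀ t w → 2 * (2 * t) * w ≡ 4 * t * w
      ring = solve-∀
      scale : Scale d L m w (2 ^ δ) (r * w) n (count X) (count (not ∘ X))
      scale = make-scale {L} {m} {w} {n} {count X} {count (not ∘ X)} {x} 0<d (twice-d δ-large) 0<w L≤h V≤h DV≤h x-large x<w lower
        (≤-trans upper (≤-reflexive (ring (s * 2 ^ Exponents.e d δ) w)))
        (trans (sym (m∸n+n≡m (≤-trans (m≤n+m _ 2) (leaves-two 0<d 0<w lower)))) (cong (_+ (r * w + 3 * w)) e))
        (count-not X) (proj₁ (proj₂ (proj₂ balanced))) (proj₂ (proj₂ (proj₂ balanced)))

  double-count : ∀ b (P Q : Fin N → Bool) → sum (λ v → 𝟙 (P v) * count (Q ∩ edge b v)) ≡ sum (λ u → 𝟙 (Q u) * count (P ∩ edge b u))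
  double-count b P Q = trans (sum-cong λ v → trans (cong (𝟙 (P v) *_) (count-sum (Q ∩ edge b v))) (*-sum (𝟙 (P v)) _))
    (trans (sum-swap _) (sum-cong λ u → trans (sum-cong λ v → shuffle v u) (trans (sym (*-sum (𝟙 (Q u)) _)) (cong (𝟙 (Q u) *_) (sym (count-sum (P ∩ edge b u)))))))
    where
    swap : ∀ p q e → p * (q * e) ≡ q * (p * e)
    swap = solve-∀
    shuffle : ∀ v u → 𝟙 (P v) * 𝟙 (Q u ∧ edge b v u) ≡ 𝟙 (Q u) * 𝟙 (P v ∧ edge b u v)
    shuffle v u = trans (cong (𝟙 (P v) *_) (𝟙-∧ (Q u) (edge b v u))) (trans (swap (𝟙 (P v)) (𝟙 (Q u)) (𝟙 (edge b v u)))
      (cong (𝟙 (Q u) *_) (trans (cong (𝟙 (P v) *_) (cong 𝟙 (edge-sym b v u))) (sym (𝟙-∧ (P v) (edge b u v))))))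

  -- A failure of density at scale w in colour b yields a pair, half as large, that is nearly complete in the other colour.
  module _ (b : Bool) (D : ℕ) {w : ℕ} (A T : Fin N → Bool) (T-large : w ≤ count T) (many-low : w < count (A ∩ low b D T)) (0<w : 0 < w) where

    private
      chosen = subset-of-size (A ∩ low b D T) w (<⇒≤ many-low)
      S T′ : Fin N → Bool
      S = proj₁ chosen
      T′ = T ∖ (λ t → suc (2 * w) ≤ᵇ count (S ∩ edge b t) * D)
      size-S : count S ≡ w
      size-S = proj₂ (proj₂ chosen)
      low-S : ∀ v → S v ≡ true → count (T ∩ edge b v) * D ≤ count T
      low-S v e = <⇒≤ (≤ᵇ-elim {suc (count (T ∩ edge b v) * D)} {count T} (∧-right {A v} (proj₁ (proj₂ chosen) v e)))

    count-T′ : count T ≤ 2 * count T′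
    count-T′ = linear {2 * count (T ∩ heavy) + 2 * count T} 0 (+-mono-≤ few (*-monoʳ-≤ 2 (≤-reflexive (count-split T heavy)))) (ring (count T) (count (T ∩ heavy)) (count T′))
      where
      heavy : Fin N → Bool
      heavy t = suc (2 * w) ≤ᵇ count (S ∩ edge b t) * D
      ring : ∀ t h t′ → t + (t + 2 * (h + t′)) + 0 ≡ 2 * t′ + (2 * h + 2 * t)
      ring = solve-∀
      ring₂ : ∀ h w → 2 * h * w ≡ h * (2 * w)
      ring₂ = solve-∀
      term : ∀ t → (T ∩ heavy) t ≡ true → 2 * w ≤ 𝟙 (T t) * count (S ∩ edge b t) * D
      term t e = ≤-trans (<⇒≤ (≤ᵇ-elim {suc (2 * w)} {count (S ∩ edge b t) * D} (∧-right {T t} e)))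
        (≤-reflexive (cong (_* D) (trans (sym (*-identityˡ _)) (cong (λ z → 𝟙 z * count (S ∩ edge b t)) (sym (∧-left {T t} e))))))
      few : 2 * count (T ∩ heavy) ≤ count T
      few = *-cancelʳ-≤ _ _ w {{>-nonZero 0<w}} (begin
        2 * count (T ∩ heavy) * w                                ≡⟨ ring₂ (count (T ∩ heavy)) w ⟩
        count (T ∩ heavy) * (2 * w)                              ≤⟨ markov (T ∩ heavy) (λ t → 𝟙 (T t) * count (S ∩ edge b t) * D) (2 * w) term ⟩
        sum (λ t → 𝟙 (T t) * count (S ∩ edge b t) * D)           ≡⟨ sum-* D _ ⟨
        sum (λ t → 𝟙 (T t) * count (S ∩ edge b t)) * D           ≡⟨ cong (_* D) (double-count b T S) ⟩
        sum (λ v → 𝟙 (S v) * count (T ∩ edge b v)) * D           ≡⟨ trans (sum-* D _) (sum-cong λ v → *-assoc (𝟙 (S v)) _ D) ⟩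
        sum (λ v → 𝟙 (S v) * (count (T ∩ edge b v) * D))         ≤⟨ sum-on-mono S _ (λ _ → count T) low-S ⟩
        sum (λ v → 𝟙 (S v) * count T)                            ≡⟨ trans (sum-on-const S (count T)) (cong (_* count T) size-S) ⟩
        w * count T                                              ≡⟨ *-comm w (count T) ⟩
        count T * w                                              ∎)

    sparse-pair : 2 ≤ w → ∃ λ A₁ → ∃ λ B₁ → A₁ ⊑ A × B₁ ⊑ T × count A₁ ≡ ⌊ w /2⌋ × count B₁ ≡ ⌊ w /2⌋ ×
      (∀ t → B₁ t ≡ true → count (A₁ ∩ edge b t) * D ≤ 6 * ⌊ w /2⌋)
    sparse-pair 2≤w =
      let A₁ , A₁⊑ , size-A₁ = subset-of-size S ⌊ w /2⌋ (≤-trans (⌊n/2⌋≤n w) (≤-reflexive (sym size-S)))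
          B₁ , B₁⊑ , size-B₁ = subset-of-size T′ ⌊ w /2⌋ (*-cancelˡ-≤ 2 (≤-trans (double-half w) (≤-trans T-large count-T′)))
      in A₁ , B₁ , (λ v e → ∧-left {A v} (proj₁ (proj₂ chosen) v (A₁⊑ v e))) , (λ v e → ∧-left {T v} (B₁⊑ v e)) , size-A₁ , size-B₁ ,
         λ t e → ≤-trans (*-monoˡ-≤ D (count-mono {p = A₁ ∩ edge b t} {q = S ∩ edge b t} λ v f → ∧-intro (A₁⊑ v (∧-left {A₁ v} f)) (∧-right {A₁ v} f)))
           (≤-trans (≤-pred (≤ᵇ-false {suc (2 * w)} {count (S ∩ edge b t) * D} (not-elim (∧-right {T t} (B₁⊑ t e))))) bound)
      where
      f = ⌊ w /2⌋
      bound : 2 * w ≤ 6 * f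
      bound = linear {2 * w + 2 * 1} 0 (+-mono-≤ (*-monoʳ-≤ 2 (below-double-half w)) (*-monoʳ-≤ 2 (half-mono {1} {w} 2≤w))) (ring₂ w f)
        where
        ring₂ : ∀ w f → 2 * w + (2 * (1 + 2 * f) + 2 * f) + 0 ≡ 6 * f + (2 * w + 2 * 1)
        ring₂ = solve-∀

module Main (F : GraphSeq) (bip : BipartiteSeq F) (d : ℕ) (0<d : 0 < d) (deg : ∀ k y → count (adj (F k) y) ≤ d) {N : ℕ} (c : TwoColoring N) where

  open Covers F c
  open Removals F c
  open Dichotomy F bip d 0<d deg c
  open Shrinking F bip d 0<d deg L L-large c
  open Ramsey F bip d 0<d deg L L-large c using (edge-not; count-edge-not)

  module _ (b : Bool) {D₀ D w m : ℕ} (A B : Fin N → Bool) (2≤D : 2 ≤ D) (0<w : 0 < w) (D₀-large : 12 * m < D₀ * w)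
    (sparse : ∀ t → B t ≡ true → count (A ∩ edge b t) * D₀ ≤ 6 * m) where

    low-many : ∀ T v → low (not b) D T v ≡ true → count T ≤ 2 * count (T ∩ edge b v)
    low-many T v e = linear {2 * y + 2 * count T} 0
      (+-mono-≤ (≤-trans (≤-reflexive (*-comm 2 y)) (≤-trans (*-monoʳ-≤ y 2≤D) (<⇒≤ (≤ᵇ-elim {suc (y * D)} {count T} e)))) (*-monoʳ-≤ 2 (≤-reflexive (sym (count-edge-not T b v)))))
      (ring (count T) (count (T ∩ edge b v)) y)
      where
      y = count (T ∩ edge (not b) v)
      ring : ∀ t u y → t + (t + 2 * (u + y)) + 0 ≡ 2 * u + (2 * y + 2 * t)
      ring = solve-∀

    dense-A : Dense (not b) D w A B
    dense-A T T⊑ large = ≮⇒≥ λ lt → <-irrefl refl (begin-strict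
        12 * m * count T                                                  <⟨ *-monoˡ-< (count T) {{>-nonZero (≤-trans 0<w large)}} D₀-large ⟩
        D₀ * w * count T                                                  ≤⟨ *-monoˡ-≤ (count T) (*-monoʳ-≤ D₀ (<⇒≤ lt)) ⟩
        D₀ * ℓ * count T                                                  ≡⟨ ring₁ D₀ ℓ (count T) ⟩
        ℓ * count T * D₀                                                  ≡⟨ cong (_* D₀) (sum-on-const Lo (count T)) ⟨
        sum (λ v → 𝟙 (Lo v) * count T) * D₀                               ≤⟨ *-monoˡ-≤ D₀ (sum-on-mono Lo _ (λ v → 2 * count (T ∩ edge b v)) (λ v e → low-many T v (∧-right {A v} e))) ⟩
        sum (λ v → 𝟙 (Lo v) * (2 * count (T ∩ edge b v))) * D₀            ≡⟨ cong (_* D₀) (trans (sum-cong λ v → swap (𝟙 (Lo v)) 2 _) (sym (*-sum 2 _))) ⟩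
        2 * sum (λ v → 𝟙 (Lo v) * count (T ∩ edge b v)) * D₀              ≡⟨ cong (λ t → 2 * t * D₀) (double-count b Lo T) ⟩
        2 * sum (λ t → 𝟙 (T t) * count (Lo ∩ edge b t)) * D₀              ≡⟨ trans (*-assoc 2 (sum (λ t → 𝟙 (T t) * count (Lo ∩ edge b t))) D₀) (cong (2 *_) (trans (sum-* D₀ (λ t → 𝟙 (T t) * count (Lo ∩ edge b t))) (sum-cong λ t → *-assoc (𝟙 (T t)) (count (Lo ∩ edge b t)) D₀))) ⟩
        2 * sum (λ t → 𝟙 (T t) * (count (Lo ∩ edge b t) * D₀))            ≤⟨ *-monoʳ-≤ 2 (sum-on-mono T _ (λ _ → 6 * m) few) ⟩
        2 * sum (λ t → 𝟙 (T t) * (6 * m))                                 ≡⟨ cong (2 *_) (sum-on-const T (6 * m)) ⟩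
        2 * (count T * (6 * m))                                           ≡⟨ ring₂ (count T) m ⟩
        12 * m * count T                                                  ∎)
      where
      Lo = A ∩ low (not b) D T
      ℓ = count Lo
      few : ∀ t → T t ≡ true → count (Lo ∩ edge b t) * D₀ ≤ 6 * m
      few t e = ≤-trans (*-monoˡ-≤ D₀ (count-mono {p = Lo ∩ edge b t} {q = A ∩ edge b t} λ v f → ∧-intro (∧-left {A v} (∧-left {Lo v} f)) (∧-right {Lo v} f))) (sparse t (T⊑ t e))
      ring₁ : ∀ D l t → D * l * t ≡ l * t * D
      ring₁ = solve-∀
      ring₂ : ∀ t m → 2 * (t * (6 * m)) ≡ 12 * m * t
      ring₂ = solve-∀
      swap : ∀ a b c → a * (b * c) ≡ b * (a * c)
      swap = solve-∀

    dense-B : Dense (not b) D w B A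
    dense-B T T⊑ large = ≤-trans (≤-reflexive (count-none {p = B ∩ low (not b) D T} λ t → ¬true⇒false λ e → <⇒≱ D₀-large (begin
        D₀ * w                                    ≤⟨ *-monoʳ-≤ D₀ (≤-trans large (low-many T t (∧-right {B t} e))) ⟩
        D₀ * (2 * count (T ∩ edge b t))           ≡⟨ ring₁ D₀ (count (T ∩ edge b t)) ⟩
        2 * (count (T ∩ edge b t) * D₀)           ≤⟨ *-monoʳ-≤ 2 (≤-trans (*-monoˡ-≤ D₀ (count-mono {p = T ∩ edge b t} {q = A ∩ edge b t} λ v f → ∧-intro (T⊑ v (∧-left {T v} f)) (∧-right {T v} f))) (sparse t (∧-left {B t} e))) ⟩
        2 * (6 * m)                               ≡⟨ ring₂ m ⟩
        12 * m                                    ∎))) z≤n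
      where
      ring₁ : ∀ D y → D * (2 * y) ≡ 2 * (y * D)
      ring₁ = solve-∀
      ring₂ : ∀ m → 2 * (6 * m) ≡ 12 * m
      ring₂ = solve-∀

  private
    module E₁ = Exponents d (d + 1)

  x₁ δ₀ : ℕ
  x₁ = E₁.x
  δ₀ = d + 1 + x₁ + 4

  private
    module E₀ = Exponents d δ₀

  x₀ j jᵣ : ℕ
  x₀ = E₀.x
  j = x₀ + x₀ + (x₁ + x₁) + 4
  jᵣ = x₀ + x₁ + 4

  private
    Θ₀ Θ₁ W : ℕ
    Θ₀ = E₀.Θ
    Θ₁ = E₁.Θ
    W = 2 * (Θ₁ * (x₁ + 1)) + (x₀ + 3)

  scale-of : ∀ Θ m x → 0 < Θ → Θ * (x + 1) ≤ m → ∃ λ w → x + 1 ≤ w × Θ * w ≤ m × m < Θ * (w + 1) × m ≤ 2 * Θ * w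
  scale-of Θ m x 0<Θ large with quotient Θ m 0<Θ (≤-trans (m≤m*n Θ (x + 1) {{>-nonZero (m≤n+m 1 x)}}) large)
  ... | w , 0<w , lower , upper = w , x<w , ≤-trans (≤-reflexive (*-comm Θ w)) lower , upper′ , ≤-trans (<⇒≤ upper′) double
    where
    upper′ : m < Θ * (w + 1)
    upper′ = ≤-trans upper (≤-reflexive (ring Θ w))
      where
      ring : ∀ t w → (1 + w) * t ≡ t * (w + 1)
      ring = solve-∀
    x<w : x + 1 ≤ w
    x<w = ≤-pred (≤-trans (*-cancelˡ-< Θ (x + 1) (w + 1) (≤-trans (s≤s large) upper′)) (≤-reflexive (+-comm w 1)))
    double : Θ * (w + 1) ≤ 2 * Θ * w
    double = linear {Θ * 1} 0 (*-monoʳ-≤ Θ 0<w) (ring Θ w)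
      where
      ring : ∀ t w → t * (w + 1) + t * w + 0 ≡ 2 * t * w + t * 1
      ring = solve-∀

  everything : Fin N → Bool
  everything _ = true

  module Sparse (b : Bool) (m w : ℕ) (A B : Fin N → Bool) (A-B : Disjoint A B) (size-A : count A ≡ m) (size-B : count B ≡ m)
    (sparse : ∀ t → B t ≡ true → count (A ∩ edge b t) * 2 ^ δ₀ ≤ 6 * m)
    (x<w : x₁ + 1 ≤ w) (lower : Θ₁ * w ≤ m) (upper : m ≤ 2 * Θ₁ * w) (N-small : N ≤ 2 ^ jᵣ * w) where

    private
      0<w : 0 < w
      0<w = ≤-trans (m≤n+m 1 x₁) x<w
      R : Fin N → Bool
      R = everything ∖ (A ∪ B)
      shrunk = shrink jᵣ R
      E : Fin N → Bool
      E = proj₁ shrunk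
      rem : Removal (jᵣ * (2 * L)) R E
      rem = proj₁ (proj₂ shrunk)
      size-R : count (R ∖ E) ≤ E₁.r * w
      size-R = ≤-trans (*-cancelˡ-≤ (2 ^ jᵣ) {{m^n≢0 2 jᵣ}} (≤-trans (proj₂ (proj₂ shrunk)) (≤-trans (count≤n R) N-small)))
        (≤-trans (≤-reflexive (sym (*-identityˡ w))) (*-monoˡ-≤ w (E₁.0<r 0<d)))
      D₀-large : 12 * m < 2 ^ δ₀ * w
      D₀-large = begin-strict
        12 * m                            ≤⟨ *-monoʳ-≤ 12 (≤-trans upper (*-monoˡ-≤ w E₁.2Θ≤)) ⟩
        12 * (2 ^ x₁ * w)                 <⟨ m<m+n (12 * (2 ^ x₁ * w)) {4 * (2 ^ x₁ * w)} (*-mono-< {0} {4} {0} (s≤s z≤n) (*-mono-< {0} {2 ^ x₁} {0} (2^-pos x₁) 0<w)) ⟩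
        12 * (2 ^ x₁ * w) + 4 * (2 ^ x₁ * w)  ≡⟨ ring (2 ^ x₁) w ⟩
        2 ^ x₁ * 16 * w                   ≡⟨ cong (_* w) (^-distribˡ-+-* 2 x₁ 4) ⟨
        2 ^ (x₁ + 4) * w                  ≤⟨ *-monoˡ-≤ w (2^-mono {x₁ + 4} {δ₀} (+-monoˡ-≤ 4 (m≤n+m x₁ (d + 1)))) ⟩
        2 ^ δ₀ * w                        ∎
        where
        ring : ∀ p w → 12 * (p * w) + 4 * (p * w) ≡ p * 16 * w
        ring = solve-∀
      2≤D : 2 ≤ 2 ^ (d + 1)
      2≤D = 2^-mono {1} {d + 1} (m≤n+m 1 d)

    cover : Cover (jᵣ * (2 * L) + 6) everything
    cover = restore rem {everything} {6} (λ _ _ → refl) (cover-resp forth back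
      (finish-at (d + 1) ≤-refl {m} {w} (not b) A B (R ∖ E) A-B size-A size-B size-R x<w lower upper
        (dense-A b {2 ^ δ₀} {2 ^ (d + 1)} {w} {m} A B 2≤D 0<w D₀-large sparse)
        (dense-B b {2 ^ δ₀} {2 ^ (d + 1)} {w} {m} A B 2≤D 0<w D₀-large sparse)))
      where
      forth : (A ∪ (B ∪ (R ∖ E))) ⊑ (everything ∖ E)
      forth v e = ∖-intro everything E v refl λ f → case ∨-elim {A v} e of λ
        { (inj₁ a) → ∖-disjoint everything (A ∪ B) v (removed⊑ rem v f) (∨-introˡ {A v} {B v} a)
        ; (inj₂ e′) → case ∨-elim {B v} e′ of λ
          { (inj₁ b) → ∖-disjoint everything (A ∪ B) v (removed⊑ rem v f) (∨-introʳ {A v} {B v} b)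
          ; (inj₂ r) → ∖-disjoint R E v r f } }
      back : (everything ∖ E) ⊑ (A ∪ (B ∪ (R ∖ E)))
      back v e = case bool-dec ((A ∪ B) v) of λ
        { (inj₁ ab) → case ∨-elim {A v} ab of λ { (inj₁ a) → ∨-introˡ {A v} a ; (inj₂ b) → ∨-introʳ {A v} (∨-introˡ {B v} b) }
        ; (inj₂ rest) → ∨-introʳ {A v} (∨-introʳ {B v} (∧-intro (∧-intro refl (not-intro rest)) (∧-right {true} e))) }

  module Large (N-large : 2 ^ j ≤ N) where

    private
      m : ℕ
      m = ⌊ N /2⌋

    room : Θ₀ * W ≤ m
    room = half-mono {Θ₀ * W} (begin
      2 * (Θ₀ * W)                                          ≡⟨ *-assoc 2 Θ₀ W ⟨
      2 * Θ₀ * W                                            ≤⟨ *-mono-≤ E₀.2Θ≤ W≤ ⟩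
      2 ^ x₀ * (2 ^ x₁ * 2 ^ x₁ * (2 ^ x₀ * 16))            ≡⟨ ring₁ (2 ^ x₀) (2 ^ x₁) ⟩
      2 ^ x₀ * 2 ^ x₀ * (2 ^ x₁ * 2 ^ x₁) * 16              ≡⟨ cong (_* 16) (cong₂ _*_ (^-distribˡ-+-* 2 x₀ x₀) (^-distribˡ-+-* 2 x₁ x₁)) ⟨
      2 ^ (x₀ + x₀) * 2 ^ (x₁ + x₁) * 16                    ≡⟨ trans (^-distribˡ-+-* 2 (x₀ + x₀ + (x₁ + x₁)) 4) (cong (_* 16) (^-distribˡ-+-* 2 (x₀ + x₀) (x₁ + x₁))) ⟨
      2 ^ j                                                 ≤⟨ N-large ⟩
      N                                                     ∎)
      where
      ring₁ : ∀ p q → p * (q * q * (p * 16)) ≡ p * p * (q * q) * 16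
      ring₁ = solve-∀
      ring₂ : ∀ u v → u * v + u * 4 * v ≡ 5 * (u * v)
      ring₂ = solve-∀
      p = 2 ^ x₁ * 2 ^ x₁
      instance
        p≢0 : NonZero p
        p≢0 = m*n≢0 (2 ^ x₁) (2 ^ x₁) {{m^n≢0 2 x₁}} {{m^n≢0 2 x₁}}
        q≢0 : NonZero (2 ^ x₀)
        q≢0 = m^n≢0 2 x₀
      first : 2 * (Θ₁ * (x₁ + 1)) ≤ p
      first = ≤-trans (≤-reflexive (sym (*-assoc 2 Θ₁ (x₁ + 1)))) (*-mono-≤ E₁.2Θ≤ (≤-trans (≤-reflexive (+-comm x₁ 1)) (n<2^n x₁)))
      second : x₀ + 3 ≤ 2 ^ x₀ * 4
      second = linear {x₀ + 3 * 1} 0 (+-mono-≤ (<⇒≤ (n<2^n x₀)) (*-monoʳ-≤ 3 (2^-pos x₀))) (ring₃ x₀ (2 ^ x₀))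
        where
        ring₃ : ∀ x q → x + 3 + (q + 3 * q) + 0 ≡ q * 4 + (x + 3 * 1)
        ring₃ = solve-∀
      W≤ : W ≤ p * (2 ^ x₀ * 16)
      W≤ = begin
        2 * (Θ₁ * (x₁ + 1)) + (x₀ + 3)        ≤⟨ +-mono-≤ first second ⟩
        p + 2 ^ x₀ * 4                        ≤⟨ +-mono-≤ (m≤m*n p (2 ^ x₀)) (m≤n*m (2 ^ x₀ * 4) p) ⟩
        p * 2 ^ x₀ + p * (2 ^ x₀ * 4)         ≤⟨ m≤m+n _ (p * (2 ^ x₀ * 11)) ⟩
        p * 2 ^ x₀ + p * (2 ^ x₀ * 4) + p * (2 ^ x₀ * 11)  ≡⟨ ring₄ p (2 ^ x₀) ⟩
        p * (2 ^ x₀ * 16)                     ∎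
        where
        ring₄ : ∀ p q → p * q + p * (q * 4) + p * (q * 11) ≡ p * (q * 16)
        ring₄ = solve-∀

    private
      scaled : ∃ λ w → x₀ + 1 ≤ w × Θ₀ * w ≤ m × m < Θ₀ * (w + 1) × m ≤ 2 * Θ₀ * w
      scaled = scale-of Θ₀ m x₀ (E₀.0<Θ 0<d) (≤-trans (*-monoʳ-≤ Θ₀ (≤-trans (+-monoʳ-≤ x₀ (m≤m+n 1 2)) (m≤n+m (x₀ + 3) (2 * (Θ₁ * (x₁ + 1)))))) room)
      w : ℕ
      w = proj₁ scaled
      x<w : x₀ + 1 ≤ w
      x<w = proj₁ (proj₂ scaled)
      lower : Θ₀ * w ≤ m
      lower = proj₁ (proj₂ (proj₂ scaled))
      upper : m ≤ 2 * Θ₀ * w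
      upper = proj₂ (proj₂ (proj₂ (proj₂ scaled)))
      W≤w : W ≤ w
      W≤w = ≤-pred (≤-trans (*-cancelˡ-< Θ₀ W (w + 1) (≤-trans (s≤s room) (proj₁ (proj₂ (proj₂ (proj₂ scaled)))))) (≤-reflexive (+-comm w 1)))
      0<w : 0 < w
      0<w = ≤-trans (m≤n+m 1 x₀) x<w
      2≤w : 2 ≤ w
      2≤w = ≤-trans (≤-trans (m≤m+n 2 1) (≤-trans (m≤n+m 3 x₀) (m≤n+m (x₀ + 3) (2 * (Θ₁ * (x₁ + 1)))))) W≤w

      m₁ : ℕ
      m₁ = ⌊ w /2⌋
      scaled₁ : ∃ λ w₁ → x₁ + 1 ≤ w₁ × Θ₁ * w₁ ≤ m₁ × m₁ < Θ₁ * (w₁ + 1) × m₁ ≤ 2 * Θ₁ * w₁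
      scaled₁ = scale-of Θ₁ m₁ x₁ (E₁.0<Θ 0<d) (half-mono {Θ₁ * (x₁ + 1)} (≤-trans (m≤m+n (2 * (Θ₁ * (x₁ + 1))) (x₀ + 3)) W≤w))
      w₁ : ℕ
      w₁ = proj₁ scaled₁
      upper₁ : m₁ ≤ 2 * Θ₁ * w₁
      upper₁ = proj₂ (proj₂ (proj₂ (proj₂ scaled₁)))

      N-small : N ≤ 2 ^ jᵣ * w₁
      N-small = begin
        N                                            ≤⟨ below-double-half N ⟩
        suc (2 * m)                                  ≤⟨ +-monoˡ-≤ (2 * m) (≤-trans (*-mono-≤ (E₀.0<Θ 0<d) 0<w) lower) ⟩
        m + 2 * m                                    ≤⟨ *-monoʳ-≤ 3 (≤-trans upper (*-mono-≤ E₀.2Θ≤ (≤-trans (below-double-half w) (+-monoˡ-≤ (2 * m₁) (half-mono {1} {w} 2≤w))))) ⟩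
        3 * (2 ^ x₀ * (m₁ + 2 * m₁))                 ≤⟨ *-monoʳ-≤ 3 (*-monoʳ-≤ (2 ^ x₀) (*-monoʳ-≤ 3 (≤-trans upper₁ (*-monoˡ-≤ w₁ E₁.2Θ≤)))) ⟩
        3 * (2 ^ x₀ * (3 * (2 ^ x₁ * w₁)))           ≤⟨ m≤m+n _ (7 * (2 ^ x₀ * 2 ^ x₁ * w₁)) ⟩
        3 * (2 ^ x₀ * (3 * (2 ^ x₁ * w₁))) + 7 * (2 ^ x₀ * 2 ^ x₁ * w₁)  ≡⟨ ring (2 ^ x₀) (2 ^ x₁) w₁ ⟩
        2 ^ x₀ * 2 ^ x₁ * 16 * w₁                    ≡⟨ cong (_* w₁) (trans (^-distribˡ-+-* 2 (x₀ + x₁) 4) (cong (_* 16) (^-distribˡ-+-* 2 x₀ x₁))) ⟨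
        2 ^ jᵣ * w₁                                  ∎
        where
        ring : ∀ p q w → 3 * (p * (3 * (q * w))) + 7 * (p * q * w) ≡ p * q * 16 * w
        ring = solve-∀

      halves : ∃ λ A → A ⊑ everything × count A ≡ m
      halves = subset-of-size everything m (≤-trans (⌊n/2⌋≤n N) (≤-reflexive (sym (count-true N))))
      A : Fin N → Bool
      A = proj₁ halves
      size-A : count A ≡ m
      size-A = proj₂ (proj₂ halves)
      count-rest-A : m + count (not ∘ A) ≡ N
      count-rest-A = trans (cong (_+ count (not ∘ A)) (sym size-A)) (count-not A)
      other : ∃ λ B → B ⊑ (not ∘ A) × count B ≡ m
      other = subset-of-size (not ∘ A) m (+-cancelˡ-≤ m _ _ (≤-trans (≤-trans (≤-reflexive (cong (m +_) (sym (+-identityʳ m)))) (double-half N)) (≤-reflexive (sym count-rest-A))))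
      B : Fin N → Bool
      B = proj₁ other
      B⊑ : B ⊑ (not ∘ A)
      B⊑ = proj₁ (proj₂ other)
      size-B : count B ≡ m
      size-B = proj₂ (proj₂ other)
      A-B : Disjoint A B
      A-B v e f = true≢false e (not-elim (B⊑ v f))
      R : Fin N → Bool
      R = (not ∘ A) ∖ B
      size-R : count R ≤ 1
      size-R = +-cancelˡ-≤ (2 * m) _ _ (begin
        2 * m + count R              ≡⟨ ring m (count R) ⟩
        m + (m + count R)            ≡⟨ cong (λ k → m + (k + count R)) size-B ⟨
        m + (count B + count R)      ≡⟨ cong (m +_) (count-∖-⊑ (not ∘ A) B B⊑) ⟨
        m + count (not ∘ A)          ≡⟨ count-rest-A ⟩
        N                            ≤⟨ below-double-half N ⟩
        suc (2 * m)                  ≡⟨ +-comm 1 (2 * m) ⟩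
        2 * m + 1                    ∎)
        where
        ring : ∀ m r → 2 * m + r ≡ m + (m + r)
        ring = solve-∀

      whole : everything ⊑ (A ∪ (B ∪ R))
      whole v _ = case bool-dec (A v) of λ
        { (inj₁ a) → ∨-introˡ {A v} a
        ; (inj₂ na) → case bool-dec (B v) of λ
          { (inj₁ b) → ∨-introʳ {A v} (∨-introˡ {B v} b)
          ; (inj₂ nb) → ∨-introʳ {A v} (∨-introʳ {B v} (∧-intro (not-intro na) (not-intro nb))) } }

      from-sparse : ∀ (P Q : Fin N → Bool) → Disjoint P Q → (∃ λ T → T ⊑ Q × w ≤ count T × w < count (P ∩ low true (2 ^ δ₀) T)) → Cover (jᵣ * (2 * L) + 6) everything
      from-sparse P Q P-Q (T , T⊑ , large , many) =
        let A₁ , B₁ , A₁⊑ , B₁⊑ , size-A₁ , size-B₁ , sparse = sparse-pair true (2 ^ δ₀) P T large many 0<w 2≤w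
        in Sparse.cover true m₁ w₁ A₁ B₁ (λ v e f → P-Q v (A₁⊑ v e) (T⊑ v (B₁⊑ v f))) size-A₁ size-B₁ sparse
             (proj₁ (proj₂ scaled₁)) (proj₁ (proj₂ (proj₂ scaled₁))) upper₁ N-small

    cover : Cover (jᵣ * (2 * L) + 6) everything
    cover = case dense-or-sparse true (2 ^ δ₀) w A B of λ
      { (inj₂ sparse) → from-sparse A B A-B sparse
      ; (inj₁ dense) → case dense-or-sparse true (2 ^ δ₀) w B A of λ
        { (inj₂ sparse) → from-sparse B A (λ v e f → A-B v f e) sparse
        ; (inj₁ dense′) → cover-weaken (m≤n+m 6 (jᵣ * (2 * L))) (cover-resp (λ _ _ → refl) whole
            (finish-at δ₀ (≤-trans (m≤m+n (d + 1) x₁) (m≤m+n (d + 1 + x₁) 4)) {m} {w} true A B R A-B size-A size-B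
              (≤-trans size-R (*-mono-≤ (E₀.0<r 0<d) 0<w)) x<w lower upper dense dense′)) } }

  cover-all : Cover (j * (2 * L) + 6) everything
  cover-all = case ≤-<-connex (2 ^ j) N of λ
    { (inj₁ large) → cover-weaken (+-monoˡ-≤ 6 (*-monoˡ-≤ (2 * L) (+-monoˡ-≤ 4 (+-mono-≤ (m≤m+n x₀ x₀) (m≤m+n x₁ x₁))))) (Large.cover large)
    ; (inj₂ small) → cover-weaken (m≤m+n (j * (2 * L)) 6) (cover-small j everything (≤-trans (s≤s (≤-reflexive (count-true N))) small)) }

Exponential : (ℕ → ℕ) → Set
Exponential f = ∃ λ k → ∀ d → 0 < d → f d ≤ 2 ^ (k * d)

exponential-const : ∀ c → Exponential (λ _ → c)
exponential-const c = c , λ d 0<d → ≤-trans (<⇒≤ (n<2^n c)) (2^-mono {c} {c * d} (m≤m*n c d {{>-nonZero 0<d}}))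

exponential-id : Exponential id
exponential-id = 1 , λ d _ → ≤-trans (<⇒≤ (n<2^n d)) (≤-reflexive (cong (2 ^_) (sym (*-identityˡ d))))

exponential-power : ∀ c → Exponential (λ d → 2 ^ (d * c))
exponential-power c = c , λ d _ → ≤-reflexive (cong (2 ^_) (*-comm d c))

exponential-+ : ∀ {f g} → Exponential f → Exponential g → Exponential (λ d → f d + g d)
exponential-+ {f} {g} (k , hf) (l , hg) = k + l + 1 , λ d 0<d → begin
  f d + g d                              ≤⟨ +-mono-≤ (≤-trans (hf d 0<d) (2^-mono {k * d} {(k + l) * d} (*-monoˡ-≤ d (m≤m+n k l)))) (≤-trans (hg d 0<d) (2^-mono {l * d} {(k + l) * d} (*-monoˡ-≤ d (m≤n+m l k)))) ⟩
  2 ^ ((k + l) * d) + 2 ^ ((k + l) * d)  ≡⟨ ring (2 ^ ((k + l) * d)) ⟩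
  2 ^ ((k + l) * d) * 2 ^ 1              ≡⟨ ^-distribˡ-+-* 2 ((k + l) * d) 1 ⟨
  2 ^ ((k + l) * d + 1)                  ≤⟨ 2^-mono {(k + l) * d + 1} {(k + l) * d + d} (+-monoʳ-≤ ((k + l) * d) 0<d) ⟩
  2 ^ ((k + l) * d + d)                  ≡⟨ cong (2 ^_) (trans (cong ((k + l) * d +_) (sym (*-identityˡ d))) (sym (*-distribʳ-+ d (k + l) 1))) ⟩
  2 ^ ((k + l + 1) * d)                  ∎
  where
  ring : ∀ x → x + x ≡ x * 2
  ring = solve-∀

exponential-* : ∀ {f g} → Exponential f → Exponential g → Exponential (λ d → f d * g d)
exponential-* {f} {g} (k , hf) (l , hg) = k + l , λ d 0<d → begin
  f d * g d                    ≤⟨ *-mono-≤ (hf d 0<d) (hg d 0<d) ⟩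
  2 ^ (k * d) * 2 ^ (l * d)    ≡⟨ ^-distribˡ-+-* 2 (k * d) (l * d) ⟨
  2 ^ (k * d + l * d)          ≡⟨ cong (2 ^_) (*-distribʳ-+ d k l) ⟨
  2 ^ ((k + l) * d)            ∎

exponential-x : ∀ {δ : ℕ → ℕ} → Exponential δ → Exponential (λ d → Exponents.x d (δ d))
exponential-x {δ} hδ = (((((e ⊕ c 1) ⊕ (((e ⊕ c 1) ⊕ (e ⊕ c 1)) ⊗ exponential-id)) ⊕ exponential-id) ⊕ hδ) ⊕ e) ⊕ c 7
  where
  infixl 6 _⊕_
  infixl 7 _⊗_
  _⊕_ = exponential-+
  _⊗_ = exponential-*
  c = exponential-const
  e : Exponential (λ d → Exponents.e d (δ d))
  e = (((hδ ⊕ c 2) ⊗ exponential-id) ⊕ hδ ⊕ (exponential-id ⊗ c 8)) ⊕ c 9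

total-bound : ℕ → ℕ
total-bound d = (x₀ + x₀ + (x₁ + x₁) + 4) * (2 * 2 ^ (d * 8)) + 6
  where
  x₁ = Exponents.x d (d + 1)
  x₀ = Exponents.x d (d + 1 + x₁ + 4)

exponential-total : Exponential total-bound
exponential-total = exponential-+ (exponential-* (exponential-+ (exponential-+ (exponential-+ x₀ x₀) (exponential-+ x₁ x₁)) (exponential-const 4))
    (exponential-* (exponential-const 2) (exponential-power 8))) (exponential-const 6)
  where
  d+1 : Exponential (λ d → d + 1)
  d+1 = exponential-+ exponential-id (exponential-const 1)
  x₁ : Exponential (λ d → Exponents.x d (d + 1))
  x₁ = exponential-x d+1
  x₀ : Exponential (λ d → Exponents.x d (d + 1 + Exponents.x d (d + 1) + 4))
  x₀ = exponential-x (exponential-+ (exponential-+ d+1 x₁) (exponential-const 4))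

edgeless-cover : ∀ (F : GraphSeq) → DeltaBounded 0 F → ∀ N (c : TwoColoring N) → PartitionableInto F c 1
edgeless-cover F bounded zero    c = 0 , z≤n , (λ ()) , (λ ()) , (λ ())
edgeless-cover F bounded (suc k) c = 1 , ≤-refl , (λ _ → whole) , (λ v → zero , v , refl) , λ { zero zero _ _ _ → refl }
  where
  no-edge : ∀ i j → adj (F k) i j ≡ false
  no-edge i = count-zero (≤-trans (≤-reflexive (sym (degree-count (F k) i))) (bounded k i))
  whole : MonoCopy F c
  whole = record { index = k ; colour = true ; emb = id ; inj = id ; mono = λ i j e → ⊥-elim (true≢false e (no-edge i j)) }

theorem2 : Σ ℕ λ C → ∀ (Δ : ℕ) (F : GraphSeq) → BipartiteSeq F → DeltaBounded Δ F → ∀ (N : ℕ) (c : TwoColoring N) → PartitionableInto F c (2 ^ (C * Δ))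
theorem2 = C , bound
  where
  C : ℕ
  C = proj₁ exponential-total
  bound : ∀ (Δ : ℕ) (F : GraphSeq) → BipartiteSeq F → DeltaBounded Δ F → ∀ (N : ℕ) (c : TwoColoring N) → PartitionableInto F c (2 ^ (C * Δ))
  bound zero F bip bounded N c = subst (PartitionableInto F c) (cong (2 ^_) (sym (*-zeroʳ C))) (edgeless-cover F bounded N c)
  bound d@(suc _) F bip bounded N c = Covers.partition F c (Covers.cover-weaken F c (proj₂ exponential-total d (s≤s z≤n))
    (Main.cover-all F bip d (s≤s z≤n) (λ k y → ≤-trans (≤-reflexive (sym (degree-count (F k) y))) (bounded k y)) c))
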